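{- The following two identities hold: $$\sum_{k=1}^\infty\frac{(95k^2-84k+16)(9/8)^{k-1}}{k(3k-1)(3k-2)\binom{4k}k}=\frac{2\pi}{\sqrt3}$$ and $$\sum_{k=1}^\infty\frac{(5k^2-4k+1)8^{k}}{k(3k-1)(3k-2)\binom{4k}k}=\frac{3\pi}{2}.$$ -}

module Defs where

open import Data.Bool.Base using (true; false; if_then_else_; T)
open import Data.List.Base using (applyUpTo)
open import Data.Nat.Base as ℕ using (ℕ; zero; suc)
open import Data.Nat.ListAction using (sum)
import Data.Nat.Divisibility as ℕ using (∣⇒≤)
import Data.Nat.DivMod as ℕ using (m≥n⇒m/n>0)
import Data.Nat.Properties as ℕ
import Data.Nat.Tactic.RingSolver as ℕ-Ring
open import Data.Nat.Combinatorics using (_C_; nCk≡n!/k![n-k]!; k![n∸k]!∣n!)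
open import Data.Integer.Base as ℤ using (ℤ; +_; +[1+_]; -[1+_])
import Data.Integer.Properties as ℤ
open import Data.Rational.Base as ℚ using (ℚ; mkℚ; 0ℚ; 1ℚ; _/_)
import Data.Rational.Properties as ℚ
import Data.Rational.Unnormalised.Base as ℚᵘ
import Data.Rational.Unnormalised.Properties as ℚᵘ
open import Data.Rational.Solver using (module +-*-Solver)
open import Function.Base using (it)
open import Data.Product.Base using (_×_; _,_; proj₁; proj₂; ∃-syntax)
open import Data.Sum.Base using (inj₁; inj₂)
open import Relation.Binary.PropositionalEquality
open import Relation.Nullary.Negation using (contradiction)

private

  open +-*-Solver

  triangle : ∀ p q r s {ε} → ℚ.∣ p ℚ.- q ∣ ℚ.+ ℚ.∣ r ℚ.- s ∣ ℚ.< ε →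
             ℚ.∣ (p ℚ.- r) ℚ.- (q ℚ.- s) ∣ ℚ.< ε
  triangle p q r s h = ℚ.≤-<-trans
    (subst (ℚ._≤ ℚ.∣ p ℚ.- q ∣ ℚ.+ ℚ.∣ r ℚ.- s ∣)
      (cong ℚ.∣_∣ (solve 4 (λ p q r s → (p :- q) :- (r :- s) := (p :- r) :- (q :- s)) refl p q r s))
      (ℚ.∣p-q∣≤∣p∣+∣q∣ (p ℚ.- q) (r ℚ.- s)))
    h

  ∣p∣≤∣p-q∣+∣q∣ : ∀ p q → ℚ.∣ p ∣ ℚ.≤ ℚ.∣ p ℚ.- q ∣ ℚ.+ ℚ.∣ q ∣
  ∣p∣≤∣p-q∣+∣q∣ p q = subst (λ z → ℚ.∣ z ∣ ℚ.≤ ℚ.∣ p ℚ.- q ∣ ℚ.+ ℚ.∣ q ∣)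
    (solve 2 (λ p q → (p :- q) :+ q := p) refl p q)
    (ℚ.∣p+q∣≤∣p∣+∣q∣ (p ℚ.- q) q)

  ∣p-q∣≡∣q-p∣ : ∀ p q → ℚ.∣ p ℚ.- q ∣ ≡ ℚ.∣ q ℚ.- p ∣
  ∣p-q∣≡∣q-p∣ p q = trans (sym (ℚ.∣-p∣≡∣p∣ (p ℚ.- q)))
    (cong ℚ.∣_∣ (solve 2 (λ p q → :- (p :- q) := q :- p) refl p q))

  p≤q+r⇒p-q≤r : ∀ p q r → p ℚ.≤ q ℚ.+ r → p ℚ.- q ℚ.≤ r
  p≤q+r⇒p-q≤r p q r h = subst (p ℚ.- q ℚ.≤_)
    (solve 2 (λ q r → q :+ r :- q := r) refl q r)
    (ℚ.+-monoˡ-≤ (ℚ.- q) h)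

  ∣∣p∣-∣q∣∣≤∣p-q∣ : ∀ p q → ℚ.∣ ℚ.∣ p ∣ ℚ.- ℚ.∣ q ∣ ∣ ℚ.≤ ℚ.∣ p ℚ.- q ∣
  ∣∣p∣-∣q∣∣≤∣p-q∣ p q with ℚ.∣p∣≡p∨∣p∣≡-p (ℚ.∣ p ∣ ℚ.- ℚ.∣ q ∣)
  ... | inj₁ e = subst (ℚ._≤ ℚ.∣ p ℚ.- q ∣) (sym e)
    (p≤q+r⇒p-q≤r ℚ.∣ p ∣ ℚ.∣ q ∣ _
      (subst (ℚ.∣ p ∣ ℚ.≤_) (ℚ.+-comm ℚ.∣ p ℚ.- q ∣ ℚ.∣ q ∣) (∣p∣≤∣p-q∣+∣q∣ p q)))
  ... | inj₂ e = subst (ℚ._≤ ℚ.∣ p ℚ.- q ∣)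
    (sym (trans e (solve 2 (λ a b → :- (a :- b) := b :- a) refl ℚ.∣ p ∣ ℚ.∣ q ∣)))
    (p≤q+r⇒p-q≤r ℚ.∣ q ∣ ℚ.∣ p ∣ _
      (subst (ℚ.∣ q ∣ ℚ.≤_)
        (trans (cong (ℚ._+ ℚ.∣ p ∣) (∣p-q∣≡∣q-p∣ q p)) (ℚ.+-comm ℚ.∣ p ℚ.- q ∣ ℚ.∣ p ∣))
        (∣p∣≤∣p-q∣+∣q∣ q p)))

  ∣p-q∣≤r : ∀ p q r → p ℚ.≤ q ℚ.+ r → q ℚ.≤ p ℚ.+ r → ℚ.∣ p ℚ.- q ∣ ℚ.≤ r
  ∣p-q∣≤r p q r h k with ℚ.∣p∣≡p∨∣p∣≡-p (p ℚ.- q)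
  ... | inj₁ e = subst (ℚ._≤ r) (sym e) (p≤q+r⇒p-q≤r p q r h)
  ... | inj₂ e = subst (ℚ._≤ r)
    (sym (trans e (solve 2 (λ p q → :- (p :- q) := q :- p) refl p q)))
    (p≤q+r⇒p-q≤r q p r k)

  ½ε+½ε : ∀ ε → ε ℚ.* ℚ.½ ℚ.+ ε ℚ.* ℚ.½ ≡ ε
  ½ε+½ε ε = trans (sym (ℚ.*-distribˡ-+ ε ℚ.½ ℚ.½)) (ℚ.*-identityʳ ε)

  *-pos : ∀ {p q} → 0ℚ ℚ.< p → 0ℚ ℚ.< q → 0ℚ ℚ.< p ℚ.* q
  *-pos {p} {q} hp hq = ℚ.positive⁻¹ (p ℚ.* q)
    {{ℚ.pos*pos⇒pos p {{ℚ.positive hp}} q {{ℚ.positive hq}}}}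

  *-mono-≤ : ∀ {p q r s} → 0ℚ ℚ.≤ r → 0ℚ ℚ.≤ q → p ℚ.≤ q → r ℚ.≤ s →
             p ℚ.* r ℚ.≤ q ℚ.* s
  *-mono-≤ {p} {q} {r} {s} 0≤r 0≤q p≤q r≤s = ℚ.≤-trans
    (ℚ.*-monoʳ-≤-nonNeg r {{ℚ.nonNegative 0≤r}} p≤q)
    (ℚ.*-monoˡ-≤-nonNeg q {{ℚ.nonNegative 0≤q}} r≤s)

  m≤m⊔n⊔ : ∀ a b {n} → a ℕ.⊔ b ℕ.≤ n → a ℕ.≤ n × b ℕ.≤ n
  m≤m⊔n⊔ a b h = ℕ.≤-trans (ℕ.m≤m⊔n a b) h , ℕ.≤-trans (ℕ.m≤n⊔m a b) h

Cauchy : (ℕ → ℚ) → Set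
Cauchy x = ∀ ε → 0ℚ ℚ.< ε →
  ∃[ N ] (∀ m n → N ℕ.≤ m → N ℕ.≤ n → ℚ.∣ x m ℚ.- x n ∣ ℚ.< ε)

-- Distinct sequences with the same limit are distinct elements of ℝ; _<_ and
-- HasSum depend only on the limits.
record ℝ : Set where
  no-eta-equality
  constructor mkℝ
  field
    seq    : ℕ → ℚ
    cauchy : Cauchy seq

open ℝ public

fromℚ : ℚ → ℝ
fromℚ q = mkℝ (λ _ → q) λ ε 0<ε → 0 , λ _ _ _ _ →
  subst (λ z → ℚ.∣ z ∣ ℚ.< ε) (sym (ℚ.+-inverseʳ q)) 0<ε

infix  4 _<_
infixl 6 _-_
infixl 7 _*_ _÷_

_<_ : ℝ → ℝ → Set
x < y = ∃[ δ ] (0ℚ ℚ.< δ × ∃[ N ] (∀ n → N ℕ.≤ n → seq x n ℚ.+ δ ℚ.≤ seq y n))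

_-_ : ℝ → ℝ → ℝ
seq (x - y) n = seq x n ℚ.- seq y n
cauchy (x - y) ε 0<ε =
  let 0<ε/2  = *-pos 0<ε (ℚ.positive⁻¹ ℚ.½)
      M , hM = cauchy x (ε ℚ.* ℚ.½) 0<ε/2
      N , hN = cauchy y (ε ℚ.* ℚ.½) 0<ε/2
  in M ℕ.⊔ N , λ m n M≤m M≤n →
    let Mm , Nm = m≤m⊔n⊔ M N M≤m ; Mn , Nn = m≤m⊔n⊔ M N M≤n
    in triangle (seq x m) (seq x n) (seq y m) (seq y n)
         (subst (_ ℚ.<_) (½ε+½ε ε) (ℚ.+-mono-< (hM m n Mm Mn) (hN m n Nm Nn)))

∣_∣ : ℝ → ℝ
seq ∣ x ∣ n = ℚ.∣ seq x n ∣
cauchy ∣ x ∣ ε 0<ε =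
  let N , hN = cauchy x ε 0<ε
  in N , λ m n N≤m N≤n →
    ℚ.≤-<-trans (∣∣p∣-∣q∣∣≤∣p-q∣ (seq x m) (seq x n)) (hN m n N≤m N≤n)

private

  bounded : ∀ x → ∃[ B ] ∃[ N ] (0ℚ ℚ.< B × (∀ n → N ℕ.≤ n → ℚ.∣ seq x n ∣ ℚ.≤ B))
  bounded x =
    let N , hN = cauchy x 1ℚ (ℚ.positive⁻¹ 1ℚ)
    in 1ℚ ℚ.+ ℚ.∣ seq x N ∣ , N
     , ℚ.+-mono-<-≤ (ℚ.positive⁻¹ 1ℚ) (ℚ.0≤∣p∣ (seq x N))
     , λ n N≤n → ℚ.≤-trans (∣p∣≤∣p-q∣+∣q∣ (seq x n) (seq x N))
         (ℚ.+-monoˡ-≤ ℚ.∣ seq x N ∣ (ℚ.<⇒≤ (hN n N N≤n ℕ.≤-refl)))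

  product-bound : ∀ a b c d → ℚ.∣ a ℚ.* b ℚ.- c ℚ.* d ∣ ℚ.≤
    ℚ.∣ a ∣ ℚ.* ℚ.∣ b ℚ.- d ∣ ℚ.+ ℚ.∣ a ℚ.- c ∣ ℚ.* ℚ.∣ d ∣
  product-bound a b c d = subst₂ ℚ._≤_
    (cong ℚ.∣_∣ (solve 4 (λ a b c d → a :* (b :- d) :+ (a :- c) :* d := a :* b :- c :* d) refl a b c d))
    (cong₂ ℚ._+_ (ℚ.∣p*q∣≡∣p∣*∣q∣ a (b ℚ.- d)) (ℚ.∣p*q∣≡∣p∣*∣q∣ (a ℚ.- c) d))
    (ℚ.∣p+q∣≤∣p∣+∣q∣ (a ℚ.* (b ℚ.- d)) ((a ℚ.- c) ℚ.* d))

  scaled-radius : ∀ ε B → 0ℚ ℚ.< ε → 0ℚ ℚ.< B → ∃[ δ ] (0ℚ ℚ.< δ × B ℚ.* δ ≡ ε ℚ.* ℚ.½)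
  scaled-radius ε B 0<ε 0<B = ε ℚ.* ℚ.½ ℚ.* 1/B
    , *-pos (*-pos 0<ε (ℚ.positive⁻¹ ℚ.½)) (ℚ.positive⁻¹ 1/B {{ℚ.1/pos⇒pos B}})
    , trans (solve 3 (λ b e i → b :* (e :* i) := e :* (b :* i)) refl B (ε ℚ.* ℚ.½) 1/B)
        (trans (cong ((ε ℚ.* ℚ.½) ℚ.*_) (ℚ.*-inverseʳ B)) (ℚ.*-identityʳ (ε ℚ.* ℚ.½)))
    where
    instance
      _ = ℚ.positive 0<B
      _ = ℚ.pos⇒nonZero B
    1/B = ℚ.1/ B

_*_ : ℝ → ℝ → ℝ
seq (x * y) n = seq x n ℚ.* seq y n
cauchy (x * y) ε 0<ε =
  let A , K , 0<A , hA = bounded x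
      B , L , 0<B , hB = bounded y
      δ , 0<δ , Aδ     = scaled-radius ε A 0<ε 0<A
      η , 0<η , Bη     = scaled-radius ε B 0<ε 0<B
      M , hM           = cauchy x η 0<η
      N , hN           = cauchy y δ 0<δ
  in (K ℕ.⊔ L) ℕ.⊔ (M ℕ.⊔ N) , λ m n hm hn →
    let KLm , MNm = m≤m⊔n⊔ (K ℕ.⊔ L) (M ℕ.⊔ N) hm
        KLn , MNn = m≤m⊔n⊔ (K ℕ.⊔ L) (M ℕ.⊔ N) hn
        Km , Lm = m≤m⊔n⊔ K L KLm ; Kn , Ln = m≤m⊔n⊔ K L KLn
        Mm , Nm = m≤m⊔n⊔ M N MNm ; Mn , Nn = m≤m⊔n⊔ M N MNn
        instance
          _ = ℚ.positive 0<A
          _ = ℚ.positive 0<B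
    in ℚ.≤-<-trans (product-bound (seq x m) (seq y m) (seq x n) (seq y n))
         (subst (_ ℚ.<_)
           (trans (cong₂ ℚ._+_ Aδ (trans (ℚ.*-comm η B) Bη)) (½ε+½ε ε))
           (ℚ.+-mono-<
             (ℚ.≤-<-trans
               (ℚ.*-monoʳ-≤-nonNeg ℚ.∣ seq y m ℚ.- seq y n ∣
                 {{ℚ.∣-∣-nonNeg (seq y m ℚ.- seq y n)}} (hA m Km))
               (ℚ.*-monoʳ-<-pos A (hN m n Nm Nn)))
             (ℚ.≤-<-trans
               (ℚ.*-monoˡ-≤-nonNeg ℚ.∣ seq x m ℚ.- seq x n ∣
                 {{ℚ.∣-∣-nonNeg (seq x m ℚ.- seq x n)}} (hB n Ln))
               (ℚ.*-monoˡ-<-pos B (hM m n Mm Mn)))))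

-- Constructively, x is invertible when its entries are eventually bounded
-- away from zero; x being unequal to zero is not enough.
record Apart₀ (x : ℝ) : Set where
  constructor apart₀
  field
    bound   : ℚ
    0<bound : 0ℚ ℚ.< bound
    from    : ℕ
    bounds  : ∀ n → from ℕ.≤ n → bound ℚ.≤ ℚ.∣ seq x n ∣

-- Only finitely many entries of a sequence apart from zero can vanish, so
-- the value chosen for 1/0 does not affect the quotient.
recip : ℚ → ℚ
recip p@(mkℚ (+ zero) _ _) = 0ℚ
recip p@(mkℚ +[1+ _ ] _ _) = ℚ.1/ p
recip p@(mkℚ -[1+ _ ] _ _) = ℚ.1/ p

private

  recip-inverse : ∀ p → 0ℚ ℚ.< ℚ.∣ p ∣ → recip p ℚ.* p ≡ 1ℚ
  recip-inverse p@(mkℚ (+ zero) _ _) h =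
    contradiction (cong ℚ.∣_∣ (ℚ.↥p≡0⇒p≡0 p refl)) (λ e → ℚ.<-irrefl (sym e) h)
  recip-inverse p@(mkℚ +[1+ _ ] _ _) h = ℚ.*-inverseˡ p
  recip-inverse p@(mkℚ -[1+ _ ] _ _) h = ℚ.*-inverseˡ p

  recip-close : ∀ p q {δ ε} → 0ℚ ℚ.< δ → δ ℚ.≤ ℚ.∣ p ∣ → δ ℚ.≤ ℚ.∣ q ∣ →
    ℚ.∣ p ℚ.- q ∣ ℚ.< ε ℚ.* (δ ℚ.* δ) → ℚ.∣ recip p ℚ.- recip q ∣ ℚ.< ε
  recip-close p q {δ} {ε} 0<δ δ≤p δ≤q h =
    ℚ.*-cancelʳ-<-nonNeg (δ ℚ.* δ) {{ℚ.nonNegative (ℚ.<⇒≤ (*-pos 0<δ 0<δ))}}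
      (ℚ.≤-<-trans
        (ℚ.*-monoˡ-≤-nonNeg ℚ.∣ recip p ℚ.- recip q ∣
          {{ℚ.∣-∣-nonNeg (recip p ℚ.- recip q)}}
          (*-mono-≤ (ℚ.<⇒≤ 0<δ) (ℚ.0≤∣p∣ p) δ≤p δ≤q))
        (subst (ℚ._< _) (sym key) h))
    where
    open ≡-Reasoning
    r = recip p
    s = recip q
    rp : r ℚ.* p ≡ 1ℚ
    rp = recip-inverse p (ℚ.<-≤-trans 0<δ δ≤p)
    sq : s ℚ.* q ≡ 1ℚ
    sq = recip-inverse q (ℚ.<-≤-trans 0<δ δ≤q)
    key : ℚ.∣ r ℚ.- s ∣ ℚ.* (ℚ.∣ p ∣ ℚ.* ℚ.∣ q ∣) ≡ ℚ.∣ p ℚ.- q ∣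
    key = begin
      ℚ.∣ r ℚ.- s ∣ ℚ.* (ℚ.∣ p ∣ ℚ.* ℚ.∣ q ∣)
        ≡⟨ cong (ℚ.∣ r ℚ.- s ∣ ℚ.*_) (ℚ.∣p*q∣≡∣p∣*∣q∣ p q) ⟨
      ℚ.∣ r ℚ.- s ∣ ℚ.* ℚ.∣ p ℚ.* q ∣
        ≡⟨ ℚ.∣p*q∣≡∣p∣*∣q∣ (r ℚ.- s) (p ℚ.* q) ⟨
      ℚ.∣ (r ℚ.- s) ℚ.* (p ℚ.* q) ∣
        ≡⟨ cong ℚ.∣_∣ (solve 4 (λ r s p q →
             (r :- s) :* (p :* q) := (r :* p) :* q :- (s :* q) :* p) refl r s p q) ⟩
      ℚ.∣ (r ℚ.* p) ℚ.* q ℚ.- (s ℚ.* q) ℚ.* p ∣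
        ≡⟨ cong₂ (λ u v → ℚ.∣ u ℚ.* q ℚ.- v ℚ.* p ∣) rp sq ⟩
      ℚ.∣ 1ℚ ℚ.* q ℚ.- 1ℚ ℚ.* p ∣
        ≡⟨ cong₂ (λ u v → ℚ.∣ u ℚ.- v ∣) (ℚ.*-identityˡ q) (ℚ.*-identityˡ p) ⟩
      ℚ.∣ q ℚ.- p ∣
        ≡⟨ ∣p-q∣≡∣q-p∣ q p ⟩
      ℚ.∣ p ℚ.- q ∣ ∎

_⁻¹ : (x : ℝ) → {{Apart₀ x}} → ℝ
seq (x ⁻¹) n = recip (seq x n)
cauchy ((x ⁻¹) {{apart₀ δ 0<δ K hK}}) ε 0<ε =
  let N , hN = cauchy x (ε ℚ.* (δ ℚ.* δ)) (*-pos 0<ε (*-pos 0<δ 0<δ))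
  in K ℕ.⊔ N , λ m n hm hn →
    let Km , Nm = m≤m⊔n⊔ K N hm ; Kn , Nn = m≤m⊔n⊔ K N hn
    in recip-close (seq x m) (seq x n) 0<δ (hK m Km) (hK n Kn) (hN m n Nm Nn)

_÷_ : (x y : ℝ) → {{Apart₀ y}} → ℝ
x ÷ y = x * y ⁻¹

∑₁ : ((k : ℕ) .{{_ : ℕ.NonZero k}} → ℚ) → ℕ → ℚ
∑₁ a zero    = 0ℚ
∑₁ a (suc n) = ∑₁ a n ℚ.+ a (suc n)

HasSum : ((k : ℕ) .{{_ : ℕ.NonZero k}} → ℚ) → ℝ → Set
HasSum a x = ∀ ε → 0ℚ ℚ.< ε →
  ∃[ N ] (∀ n → N ℕ.≤ n → ∣ fromℚ (∑₁ a n) - x ∣ < fromℚ ε)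

private

  toℚᵘ-/ : ∀ i n → ℚ.toℚᵘ (i / suc n) ℚᵘ.≃ ℚᵘ.mkℚᵘ i n
  toℚᵘ-/ i n = ℚ.toℚᵘ-fromℚᵘ (ℚᵘ.mkℚᵘ i n)

  /-≤ : ∀ a m b n → a ℕ.* suc n ℕ.≤ b ℕ.* suc m → + a / suc m ℚ.≤ + b / suc n
  /-≤ a m b n h = ℚ.toℚᵘ-cancel-≤ (begin
    ℚ.toℚᵘ (+ a / suc m) ≃⟨ toℚᵘ-/ (+ a) m ⟩
    ℚᵘ.mkℚᵘ (+ a) m      ≤⟨ ℚᵘ.*≤* (subst₂ ℤ._≤_ (ℤ.pos-* a (suc n)) (ℤ.pos-* b (suc m)) (ℤ.+≤+ h)) ⟩
    ℚᵘ.mkℚᵘ (+ b) n      ≃⟨ toℚᵘ-/ (+ b) n ⟨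
    ℚ.toℚᵘ (+ b / suc n) ∎)
    where open ℚᵘ.≤-Reasoning

  /-+ : ∀ a m b n → + a / suc m ℚ.+ + b / suc n ≡
        + (a ℕ.* suc n ℕ.+ b ℕ.* suc m) / (suc m ℕ.* suc n)
  /-+ a m b n = ℚ.toℚᵘ-injective (begin
    ℚ.toℚᵘ (+ a / suc m ℚ.+ + b / suc n)
      ≈⟨ ℚ.toℚᵘ-homo-+ (+ a / suc m) (+ b / suc n) ⟩
    ℚ.toℚᵘ (+ a / suc m) ℚᵘ.+ ℚ.toℚᵘ (+ b / suc n)
      ≈⟨ ℚᵘ.+-cong (toℚᵘ-/ (+ a) m) (toℚᵘ-/ (+ b) n) ⟩
    ℚᵘ.mkℚᵘ (+ a) m ℚᵘ.+ ℚᵘ.mkℚᵘ (+ b) n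
      ≡⟨ cong (λ z → ℚᵘ.mkℚᵘ z (n ℕ.+ m ℕ.* suc n)) (sym
           (trans (ℤ.pos-+ (a ℕ.* suc n) (b ℕ.* suc m))
             (cong₂ ℤ._+_ (ℤ.pos-* a (suc n)) (ℤ.pos-* b (suc m))))) ⟩
    ℚᵘ.mkℚᵘ (+ (a ℕ.* suc n ℕ.+ b ℕ.* suc m)) (n ℕ.+ m ℕ.* suc n)
      ≈⟨ toℚᵘ-/ _ (n ℕ.+ m ℕ.* suc n) ⟨
    ℚ.toℚᵘ (+ (a ℕ.* suc n ℕ.+ b ℕ.* suc m) / (suc m ℕ.* suc n)) ∎)
    where open import Relation.Binary.Reasoning.Setoid ℚᵘ.≃-setoid

  small : ∀ c ε → 0ℚ ℚ.< ε → ∃[ N ] (+ c / suc N ℚ.< ε)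
  small c ε@(mkℚ +[1+ p ] q _) 0<ε = c ℕ.* suc q , ℚ.toℚᵘ-cancel-< (begin-strict
    ℚ.toℚᵘ (+ c / suc (c ℕ.* suc q)) ≃⟨ toℚᵘ-/ (+ c) (c ℕ.* suc q) ⟩
    ℚᵘ.mkℚᵘ (+ c) (c ℕ.* suc q)      <⟨ ℚᵘ.*<* (subst (ℤ._< +[1+ p ] ℤ.* + suc (c ℕ.* suc q)) (ℤ.pos-* c (suc q))
      (ℤ.+<+ (ℕ.m≤m+n (suc (c ℕ.* suc q)) (p ℕ.* suc (c ℕ.* suc q))))) ⟩
    ℚᵘ.mkℚᵘ +[1+ p ] q               ∎)
    where open ℚᵘ.≤-Reasoning
  small c (mkℚ (+ zero) _ _) (ℚ.*<* (ℤ.+<+ ()))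
  small c (mkℚ -[1+ _ ] _ _) (ℚ.*<* ())

  /-≤-+ : ∀ a d b e c m n →
    a ℕ.* (suc e ℕ.* (suc m ℕ.* suc n)) ℕ.≤
      (b ℕ.* (suc m ℕ.* suc n) ℕ.+ (c ℕ.* suc n ℕ.+ c ℕ.* suc m) ℕ.* suc e) ℕ.* suc d →
    + a / suc d ℚ.≤ + b / suc e ℚ.+ (+ c / suc m ℚ.+ + c / suc n)
  /-≤-+ a d b e c m n h = subst (+ a / suc d ℚ.≤_)
    (sym (trans (cong (+ b / suc e ℚ.+_) (/-+ c m c n))
                (/-+ b e (c ℕ.* suc n ℕ.+ c ℕ.* suc m) (n ℕ.+ m ℕ.* suc n))))
    (/-≤ a d (b ℕ.* (suc m ℕ.* suc n) ℕ.+ (c ℕ.* suc n ℕ.+ c ℕ.* suc m) ℕ.* suc e)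
      ((n ℕ.+ m ℕ.* suc n) ℕ.+ e ℕ.* (suc m ℕ.* suc n)) h)

  regular⇒Cauchy : ∀ {x} c →
    (∀ m n → x m ℚ.≤ x n ℚ.+ (+ c / suc m ℚ.+ + c / suc n)) → Cauchy x
  regular⇒Cauchy {x} c h ε 0<ε =
    let N , hN = small (c ℕ.+ c) ε 0<ε
        bound : ∀ {m} → N ℕ.≤ m → + c / suc m ℚ.≤ + c / suc N
        bound {m} N≤m = /-≤ c m c N (ℕ.*-monoʳ-≤ c (ℕ.s≤s N≤m))
        double : + c / suc N ℚ.+ + c / suc N ℚ.≤ + (c ℕ.+ c) / suc N
        double = subst (ℚ._≤ + (c ℕ.+ c) / suc N) (sym (/-+ c N c N))
          (/-≤ (c ℕ.* suc N ℕ.+ c ℕ.* suc N) (N ℕ.+ N ℕ.* suc N) (c ℕ.+ c) N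
            (ℕ.≤-reflexive (double-eq c (suc N))))
    in N , λ m n N≤m N≤n → ℚ.≤-<-trans
      (∣p-q∣≤r (x m) (x n) _ (h m n)
        (subst (λ z → x n ℚ.≤ x m ℚ.+ z) (ℚ.+-comm (+ c / suc n) (+ c / suc m)) (h n m)))
      (ℚ.≤-<-trans (ℚ.≤-trans (ℚ.+-mono-≤ (bound N≤m) (bound N≤n)) double) hN)
    where
    double-eq : ∀ c n → (c ℕ.* n ℕ.+ c ℕ.* n) ℕ.* n ≡ (c ℕ.+ c) ℕ.* (n ℕ.* n)
    double-eq = ℕ-Ring.solve-∀

isqrt : ℕ → ℕ
isqrt zero    = 0
isqrt (suc n) = if suc (isqrt n) ℕ.* suc (isqrt n) ℕ.≤ᵇ suc n then suc (isqrt n) else isqrt n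

private

  isqrt-spec : ∀ n → isqrt n ℕ.* isqrt n ℕ.≤ n × n ℕ.< suc (isqrt n) ℕ.* suc (isqrt n)
  isqrt-spec zero = ℕ.z≤n , ℕ.s≤s ℕ.z≤n
  isqrt-spec (suc n) with suc (isqrt n) ℕ.* suc (isqrt n) ℕ.≤ᵇ suc n in e
  ... | true  = ℕ.≤ᵇ⇒≤ _ _ (subst T (sym e) _)
              , ℕ.≤-<-trans (proj₂ (isqrt-spec n))
                  (ℕ.*-mono-< (ℕ.n<1+n (suc (isqrt n))) (ℕ.n<1+n (suc (isqrt n))))
  ... | false = ℕ.m≤n⇒m≤1+n (proj₁ (isqrt-spec n))
              , ℕ.≰⇒> (λ h → subst T e (ℕ.≤⇒≤ᵇ h))

  sq-cancel-< : ∀ a b → a ℕ.* a ℕ.< b ℕ.* b → a ℕ.< b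
  sq-cancel-< a b h = ℕ.≰⇒> (λ b≤a → ℕ.<⇒≱ h (ℕ.*-mono-≤ b≤a b≤a))

  isqrt-scale : ∀ a M N → .{{_ : ℕ.NonZero M}} →
    isqrt (a ℕ.* (M ℕ.* M)) ℕ.* N ℕ.< suc (isqrt (a ℕ.* (N ℕ.* N))) ℕ.* M
  isqrt-scale a M N = sq-cancel-< (s ℕ.* N) (suc t ℕ.* M) (begin-strict
    (s ℕ.* N) ℕ.* (s ℕ.* N)             ≡⟨ lemma₁ s N ⟩
    (s ℕ.* s) ℕ.* (N ℕ.* N)             ≤⟨ ℕ.*-monoˡ-≤ (N ℕ.* N) (proj₁ (isqrt-spec (a ℕ.* (M ℕ.* M)))) ⟩
    (a ℕ.* (M ℕ.* M)) ℕ.* (N ℕ.* N)     ≡⟨ lemma₂ a (M ℕ.* M) (N ℕ.* N) ⟩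
    (a ℕ.* (N ℕ.* N)) ℕ.* (M ℕ.* M)     <⟨ ℕ.*-monoˡ-< (M ℕ.* M) {{ℕ.m*n≢0 M M}} (proj₂ (isqrt-spec (a ℕ.* (N ℕ.* N)))) ⟩
    (suc t ℕ.* suc t) ℕ.* (M ℕ.* M)     ≡⟨ lemma₁ (suc t) M ⟨
    (suc t ℕ.* M) ℕ.* (suc t ℕ.* M)     ∎)
    where
    open ℕ.≤-Reasoning
    s = isqrt (a ℕ.* (M ℕ.* M))
    t = isqrt (a ℕ.* (N ℕ.* N))
    lemma₁ : ∀ s n → (s ℕ.* n) ℕ.* (s ℕ.* n) ≡ (s ℕ.* s) ℕ.* (n ℕ.* n)
    lemma₁ = ℕ-Ring.solve-∀
    lemma₂ : ∀ a m n → (a ℕ.* m) ℕ.* n ≡ (a ℕ.* n) ℕ.* m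
    lemma₂ = ℕ-Ring.solve-∀

-- √a = lim ⌊√(a n²)⌋ / n, the k-th entry being that for n = k + 1.
√ : ℕ → ℝ
seq (√ a) k = + isqrt (a ℕ.* (suc k ℕ.* suc k)) / suc k
cauchy (√ a) = regular⇒Cauchy 1 λ m n → /-≤-+ (s m) m (s n) n 1 m n (begin
      s m ℕ.* (suc n ℕ.* (suc m ℕ.* suc n))
        ≡⟨ ℕ.*-assoc (s m) (suc n) (suc m ℕ.* suc n) ⟨
      (s m ℕ.* suc n) ℕ.* (suc m ℕ.* suc n)
        ≤⟨ ℕ.*-monoˡ-≤ (suc m ℕ.* suc n) (ℕ.<⇒≤ (isqrt-scale a (suc m) (suc n))) ⟩
      (suc (s n) ℕ.* suc m) ℕ.* (suc m ℕ.* suc n)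
        ≤⟨ ℕ.m≤m+n _ ((suc n ℕ.* suc n) ℕ.* suc m) ⟩
      (suc (s n) ℕ.* suc m) ℕ.* (suc m ℕ.* suc n) ℕ.+ (suc n ℕ.* suc n) ℕ.* suc m
        ≡⟨ lemma (s n) (suc m) (suc n) ⟩
      (s n ℕ.* (suc m ℕ.* suc n) ℕ.+ (1 ℕ.* suc n ℕ.+ 1 ℕ.* suc m) ℕ.* suc n) ℕ.* suc m ∎)
  where
  open ℕ.≤-Reasoning
  s : ℕ → ℕ
  s k = isqrt (a ℕ.* (suc k ℕ.* suc k))
  lemma : ∀ s m n → (suc s ℕ.* m) ℕ.* (m ℕ.* n) ℕ.+ (n ℕ.* n) ℕ.* m ≡
                    (s ℕ.* (m ℕ.* n) ℕ.+ (1 ℕ.* n ℕ.+ 1 ℕ.* m) ℕ.* n) ℕ.* m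
  lemma = ℕ-Ring.solve-∀

instance
  √-apart₀ : ∀ {a} .{{_ : ℕ.NonZero a}} → Apart₀ (√ a)
  √-apart₀ {a} = apart₀ 1ℚ (ℚ.positive⁻¹ 1ℚ) 0 λ k _ →
    let s   = isqrt (a ℕ.* (suc k ℕ.* suc k))
        k<s : suc k ℕ.≤ s
        k<s = ℕ.s≤s⁻¹ (sq-cancel-< (suc k) (suc s)
                (ℕ.≤-<-trans (ℕ.m≤n*m (suc k ℕ.* suc k) a) (proj₂ (isqrt-spec _))))
        1≤q : 1ℚ ℚ.≤ + s / suc k
        1≤q = /-≤ 1 0 s k (subst₂ ℕ._≤_ (sym (ℕ.*-identityˡ (suc k))) (sym (ℕ.*-identityʳ s)) k<s)
    in subst (1ℚ ℚ.≤_) (sym (ℚ.0≤p⇒∣p∣≡p (ℚ.≤-trans (ℚ.nonNegative⁻¹ 1ℚ) 1≤q))) 1≤q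

∑[_]_ : ℕ → (ℕ → ℕ) → ℕ
∑[ n ] f = sum (applyUpTo f n)

infix 5 ∑[_]_

[_≤_] : ℕ → ℕ → ℕ
[ m ≤ n ] = if m ℕ.≤ᵇ n then 1 else 0

_² : ℕ → ℕ
n ² = n ℕ.* n

infix 8 _²

-- The number of (x , y) ∈ ℤ² with x² + y² ≤ n², where x and y range over
-- i - n and j - n for 0 ≤ i , j ≤ 2n, and ℕ.∣_-_∣ gives their absolute values.
latticePoints : ℕ → ℕ
latticePoints n =
  ∑[ suc (2 ℕ.* n) ] λ i → ∑[ suc (2 ℕ.* n) ] λ j → [ ℕ.∣ i - n ∣ ² ℕ.+ ℕ.∣ j - n ∣ ² ≤ n ² ]

private

  ∑-cong : ∀ n {f g} → (∀ i → i ℕ.< n → f i ≡ g i) → ∑[ n ] f ≡ ∑[ n ] g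
  ∑-cong zero    h = refl
  ∑-cong (suc n) h = cong₂ ℕ._+_ (h 0 ℕ.z<s) (∑-cong n (λ i i<n → h (suc i) (ℕ.s<s i<n)))

  ∑-mono : ∀ n {f g} → (∀ i → i ℕ.< n → f i ℕ.≤ g i) → ∑[ n ] f ℕ.≤ ∑[ n ] g
  ∑-mono zero    h = ℕ.z≤n
  ∑-mono (suc n) h = ℕ.+-mono-≤ (h 0 ℕ.z<s) (∑-mono n (λ i i<n → h (suc i) (ℕ.s<s i<n)))

  ∑-const : ∀ n c → ∑[ n ] (λ _ → c) ≡ n ℕ.* c
  ∑-const zero    c = refl
  ∑-const (suc n) c = cong (c ℕ.+_) (∑-const n c)

  ∑-*ˡ : ∀ n c f → ∑[ n ] (λ i → c ℕ.* f i) ≡ c ℕ.* (∑[ n ] f)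
  ∑-*ˡ zero    c f = sym (ℕ.*-zeroʳ c)
  ∑-*ˡ (suc n) c f = trans (cong (c ℕ.* f 0 ℕ.+_) (∑-*ˡ n c (λ i → f (suc i))))
                           (sym (ℕ.*-distribˡ-+ c (f 0) _))

  ∑-+ : ∀ n f g → ∑[ n ] (λ i → f i ℕ.+ g i) ≡ (∑[ n ] f) ℕ.+ (∑[ n ] g)
  ∑-+ zero    f g = refl
  ∑-+ (suc n) f g = trans (cong (f 0 ℕ.+ g 0 ℕ.+_) (∑-+ n _ _)) (lemma (f 0) (g 0) _ _)
    where
    lemma : ∀ a b c d → a ℕ.+ b ℕ.+ (c ℕ.+ d) ≡ a ℕ.+ c ℕ.+ (b ℕ.+ d)
    lemma = ℕ-Ring.solve-∀

  ∑-split : ∀ m n f → ∑[ m ℕ.+ n ] f ≡ (∑[ m ] f) ℕ.+ (∑[ n ] λ i → f (m ℕ.+ i))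
  ∑-split zero    n f = refl
  ∑-split (suc m) n f = trans (cong (f 0 ℕ.+_) (∑-split m n (λ i → f (suc i))))
                              (sym (ℕ.+-assoc (f 0) _ _))

  ∑-last : ∀ n f → ∑[ suc n ] f ≡ (∑[ n ] f) ℕ.+ f n
  ∑-last zero    f = ℕ.+-comm (f 0) 0
  ∑-last (suc n) f = trans (cong (f 0 ℕ.+_) (∑-last n (λ i → f (suc i))))
                           (sym (ℕ.+-assoc (f 0) _ _))

  ∑-block : ∀ n m f → ∑[ n ℕ.* m ] f ≡ (∑[ n ] λ a → ∑[ m ] λ b → f (a ℕ.* m ℕ.+ b))
  ∑-block zero    m f = refl
  ∑-block (suc n) m f = trans (∑-split m (n ℕ.* m) f) (cong ((∑[ m ] f) ℕ.+_)
    (trans (∑-block n m (λ i → f (m ℕ.+ i)))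
      (∑-cong n (λ a _ → ∑-cong m (λ b _ → cong f (sym (ℕ.+-assoc m (a ℕ.* m) b)))))))

  ∑-shift : ∀ n f → ∑[ n ] f ℕ.≤ f 0 ℕ.+ (∑[ n ] λ i → f (suc i))
  ∑-shift n f = ℕ.≤-trans (ℕ.m≤m+n _ (f n)) (ℕ.≤-reflexive (sym (∑-last n f)))

  ∑-flip : ∀ n (f : ℕ → ℕ) → (∑[ n ] λ i → f (n ℕ.∸ i)) ≡ (∑[ n ] λ i → f (suc i))
  ∑-flip zero    f = refl
  ∑-flip (suc n) f = trans (cong (f (suc n) ℕ.+_) (∑-flip n f))
    (trans (ℕ.+-comm (f (suc n)) _) (sym (∑-last n (λ i → f (suc i)))))

  ∑-abs : ∀ n (f : ℕ → ℕ) → (∑[ suc (2 ℕ.* n) ] λ i → f ℕ.∣ i - n ∣) ≡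
                  f 0 ℕ.+ 2 ℕ.* (∑[ n ] λ i → f (suc i))
  ∑-abs n f = begin
    (∑[ suc (2 ℕ.* n) ] g)
      ≡⟨ cong (λ z → ∑[ z ] g) (lemma₁ n) ⟩
    (∑[ n ℕ.+ suc n ] g)
      ≡⟨ ∑-split n (suc n) g ⟩
    (∑[ n ] g) ℕ.+ (∑[ suc n ] λ i → g (n ℕ.+ i))
      ≡⟨ cong₂ ℕ._+_
           (trans (∑-cong n {g} {λ i → f (n ℕ.∸ i)} (λ i i<n → cong f (ℕ.m≤n⇒∣m-n∣≡n∸m (ℕ.<⇒≤ i<n)))) (∑-flip n f))
           (∑-cong (suc n) {λ i → g (n ℕ.+ i)} {f} (λ i _ → cong f (trans (ℕ.∣-∣-comm (n ℕ.+ i) n) (ℕ.∣m-m+n∣≡n n i)))) ⟩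
    (∑[ n ] λ i → f (suc i)) ℕ.+ (f 0 ℕ.+ (∑[ n ] λ i → f (suc i)))
      ≡⟨ lemma₂ (∑[ n ] λ i → f (suc i)) (f 0) ⟩
    f 0 ℕ.+ 2 ℕ.* (∑[ n ] λ i → f (suc i)) ∎
    where
    open ≡-Reasoning
    g : ℕ → ℕ
    g i = f ℕ.∣ i - n ∣
    lemma₁ : ∀ n → suc (2 ℕ.* n) ≡ n ℕ.+ suc n
    lemma₁ = ℕ-Ring.solve-∀
    lemma₂ : ∀ s a → s ℕ.+ (a ℕ.+ s) ≡ a ℕ.+ 2 ℕ.* s
    lemma₂ = ℕ-Ring.solve-∀

  []-≤1 : ∀ m n → [ m ≤ n ] ℕ.≤ 1
  []-≤1 m n with m ℕ.≤ᵇ n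
  ... | true  = ℕ.≤-refl
  ... | false = ℕ.z≤n

  []-≡1 : ∀ {m n} → m ℕ.≤ n → [ m ≤ n ] ≡ 1
  []-≡1 {m} {n} m≤n with m ℕ.≤ᵇ n in e
  ... | true  = refl
  ... | false = contradiction (ℕ.≤⇒≤ᵇ m≤n) (subst T e)

  []-mono : ∀ {m n m′ n′} → (m ℕ.≤ n → m′ ℕ.≤ n′) → [ m ≤ n ] ℕ.≤ [ m′ ≤ n′ ]
  []-mono {m} {n} h with m ℕ.≤ᵇ n in e
  ... | true  = ℕ.≤-reflexive (sym ([]-≡1 (h (ℕ.≤ᵇ⇒≤ m n (subst T (sym e) _)))))
  ... | false = ℕ.z≤n

  module _ (n : ℕ) where

    cell : ℕ → ℕ → ℕ
    cell i j = [ i ² ℕ.+ j ² ≤ n ² ]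

    cell≤1 : ∀ i j → cell i j ℕ.≤ 1
    cell≤1 i j = []-≤1 (i ² ℕ.+ j ²) (n ²)

    inner outer : ℕ
    inner = ∑[ n ] λ i → ∑[ n ] λ j → cell (suc i) (suc j)
    outer = ∑[ n ] λ i → ∑[ n ] λ j → cell i j

    axis axis′ : ℕ
    axis  = ∑[ n ] λ j → cell 0 (suc j)
    axis′ = ∑[ n ] λ i → cell (suc i) 0

    axis≤n : axis ℕ.≤ n
    axis≤n = ℕ.≤-trans (∑-mono n (λ j _ → cell≤1 0 (suc j)))
      (ℕ.≤-reflexive (trans (∑-const n 1) (ℕ.*-identityʳ n)))

    axis′≤n : axis′ ℕ.≤ n
    axis′≤n = ℕ.≤-trans (∑-mono n (λ i _ → cell≤1 (suc i) 0))
      (ℕ.≤-reflexive (trans (∑-const n 1) (ℕ.*-identityʳ n)))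

    latticePoints≡ : latticePoints n ≡
      (cell 0 0 ℕ.+ 2 ℕ.* axis) ℕ.+ 2 ℕ.* (axis′ ℕ.+ 2 ℕ.* inner)
    latticePoints≡ = begin
      latticePoints n
        ≡⟨ ∑-cong (suc (2 ℕ.* n)) (λ i _ → ∑-abs n (cell ℕ.∣ i - n ∣)) ⟩
      (∑[ suc (2 ℕ.* n) ] λ i → row ℕ.∣ i - n ∣)
        ≡⟨ ∑-abs n row ⟩
      row 0 ℕ.+ 2 ℕ.* (∑[ n ] λ i → row (suc i))
        ≡⟨ cong (λ z → row 0 ℕ.+ 2 ℕ.* z)
             (trans (∑-+ n (λ i → cell (suc i) 0) (λ i → 2 ℕ.* (∑[ n ] λ j → cell (suc i) (suc j))))
               (cong (axis′ ℕ.+_) (∑-*ˡ n 2 (λ i → ∑[ n ] λ j → cell (suc i) (suc j))))) ⟩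
      row 0 ℕ.+ 2 ℕ.* (axis′ ℕ.+ 2 ℕ.* inner) ∎
      where
      open ≡-Reasoning
      row : ℕ → ℕ
      row a = cell a 0 ℕ.+ 2 ℕ.* (∑[ n ] λ j → cell a (suc j))

    outer≤inner : outer ℕ.≤ inner ℕ.+ 2 ℕ.* n
    outer≤inner = begin
      outer
        ≤⟨ ∑-mono n (λ i _ → ℕ.≤-trans (∑-shift n (cell i)) (ℕ.+-monoˡ-≤ (∑[ n ] λ j → cell i (suc j)) (cell≤1 i 0))) ⟩
      (∑[ n ] λ i → 1 ℕ.+ (∑[ n ] λ j → cell i (suc j)))
        ≡⟨ ∑-+ n (λ _ → 1) (λ i → ∑[ n ] λ j → cell i (suc j)) ⟩
      (∑[ n ] λ _ → 1) ℕ.+ (∑[ n ] λ i → ∑[ n ] λ j → cell i (suc j))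
        ≤⟨ ℕ.+-mono-≤ (ℕ.≤-reflexive (trans (∑-const n 1) (ℕ.*-identityʳ n)))
             (∑-shift n (λ i → ∑[ n ] λ j → cell i (suc j))) ⟩
      n ℕ.+ (axis ℕ.+ inner)
        ≤⟨ ℕ.+-monoʳ-≤ n (ℕ.+-monoˡ-≤ inner axis≤n) ⟩
      n ℕ.+ (n ℕ.+ inner)
        ≡⟨ lemma n inner ⟩
      inner ℕ.+ 2 ℕ.* n ∎
      where
      open ℕ.≤-Reasoning
      lemma : ∀ n s → n ℕ.+ (n ℕ.+ s) ≡ s ℕ.+ 2 ℕ.* n
      lemma = ℕ-Ring.solve-∀

  cell-mono : ∀ n i j n′ i′ j′ →
    (i ² ℕ.+ j ² ℕ.≤ n ² → i′ ² ℕ.+ j′ ² ℕ.≤ n′ ²) → cell n i j ℕ.≤ cell n′ i′ j′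
  cell-mono n i j n′ i′ j′ = []-mono {i ² ℕ.+ j ²} {n ²} {i′ ² ℕ.+ j′ ²} {n′ ²}

  refine : ∀ n m (f : ℕ → ℕ → ℕ) → (∑[ n ℕ.* m ] λ i → ∑[ n ℕ.* m ] λ j → f i j) ≡
    (∑[ n ] λ a → ∑[ m ] λ b → ∑[ n ] λ c → ∑[ m ] λ d → f (a ℕ.* m ℕ.+ b) (c ℕ.* m ℕ.+ d))
  refine n m f = trans (∑-block n m _)
    (∑-cong n (λ a _ → ∑-cong m (λ b _ → ∑-block n m (f (a ℕ.* m ℕ.+ b)))))

  coarse : ∀ n m (f : ℕ → ℕ → ℕ) → (∑[ n ] λ a → ∑[ m ] λ (_ : ℕ) → ∑[ n ] λ c → ∑[ m ] λ (_ : ℕ) → f a c) ≡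
    m ² ℕ.* (∑[ n ] λ a → ∑[ n ] λ c → f a c)
  coarse n m f = trans
    (∑-cong n (λ a _ → begin
      (∑[ m ] λ (_ : ℕ) → ∑[ n ] λ c → ∑[ m ] λ (_ : ℕ) → f a c)
        ≡⟨ ∑-const m _ ⟩
      m ℕ.* (∑[ n ] λ c → ∑[ m ] λ (_ : ℕ) → f a c)
        ≡⟨ cong (m ℕ.*_) (trans (∑-cong n (λ c _ → ∑-const m (f a c))) (∑-*ˡ n m (f a))) ⟩
      m ℕ.* (m ℕ.* (∑[ n ] f a))
        ≡⟨ ℕ.*-assoc m m _ ⟨
      m ² ℕ.* (∑[ n ] f a) ∎))
    (∑-*ˡ n (m ²) (λ a → ∑[ n ] f a))
    where open ≡-Reasoning

  scale : ∀ a c n m → a ² ℕ.+ c ² ℕ.≤ n ² → (a ℕ.* m) ² ℕ.+ (c ℕ.* m) ² ℕ.≤ (n ℕ.* m) ²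
  scale a c n m h = subst₂ ℕ._≤_ (lemma₁ a c m) (lemma₂ n m) (ℕ.*-monoˡ-≤ (m ²) h)
    where
    lemma₁ : ∀ a c m → (a ℕ.* a ℕ.+ c ℕ.* c) ℕ.* (m ℕ.* m) ≡
                       (a ℕ.* m) ℕ.* (a ℕ.* m) ℕ.+ (c ℕ.* m) ℕ.* (c ℕ.* m)
    lemma₁ = ℕ-Ring.solve-∀
    lemma₂ : ∀ n m → (n ℕ.* n) ℕ.* (m ℕ.* m) ≡ (n ℕ.* m) ℕ.* (n ℕ.* m)
    lemma₂ = ℕ-Ring.solve-∀

  unscale : ∀ a c n m → .{{_ : ℕ.NonZero m}} →
    (a ℕ.* m) ² ℕ.+ (c ℕ.* m) ² ℕ.≤ (n ℕ.* m) ² → a ² ℕ.+ c ² ℕ.≤ n ²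
  unscale a c n m h = ℕ.*-cancelʳ-≤ _ _ (m ²) {{ℕ.m*n≢0 m m}}
    (subst₂ ℕ._≤_ (lemma₁ a c m) (lemma₂ n m) h)
    where
    lemma₁ : ∀ a c m → (a ℕ.* m) ℕ.* (a ℕ.* m) ℕ.+ (c ℕ.* m) ℕ.* (c ℕ.* m) ≡
                       (a ℕ.* a ℕ.+ c ℕ.* c) ℕ.* (m ℕ.* m)
    lemma₁ = ℕ-Ring.solve-∀
    lemma₂ : ∀ n m → (n ℕ.* m) ℕ.* (n ℕ.* m) ≡ (n ℕ.* n) ℕ.* (m ℕ.* m)
    lemma₂ = ℕ-Ring.solve-∀

  ²-mono : ∀ {a b} → a ℕ.≤ b → a ² ℕ.≤ b ²
  ²-mono h = ℕ.*-mono-≤ h h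

  refine-lower : ∀ n m → m ² ℕ.* inner n ℕ.≤ inner (n ℕ.* m)
  refine-lower n m = begin
    m ² ℕ.* inner n
      ≡⟨ coarse n m (λ a c → cell n (suc a) (suc c)) ⟨
    (∑[ n ] λ a → ∑[ m ] λ (_ : ℕ) → ∑[ n ] λ c → ∑[ m ] λ (_ : ℕ) → cell n (suc a) (suc c))
      ≤⟨ ∑-mono n (λ a _ → ∑-mono m (λ b b<m → ∑-mono n (λ c _ → ∑-mono m (λ d d<m →
           cell-mono n (suc a) (suc c) (n ℕ.* m) (suc (a ℕ.* m ℕ.+ b)) (suc (c ℕ.* m ℕ.+ d)) (λ h → ℕ.≤-trans
             (ℕ.+-mono-≤ (²-mono {b = suc a ℕ.* m} (corner a b b<m)) (²-mono {b = suc c ℕ.* m} (corner c d d<m)))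
             (scale (suc a) (suc c) n m h)))))) ⟩
    (∑[ n ] λ a → ∑[ m ] λ b → ∑[ n ] λ c → ∑[ m ] λ d →
      cell (n ℕ.* m) (suc (a ℕ.* m ℕ.+ b)) (suc (c ℕ.* m ℕ.+ d)))
      ≡⟨ refine n m (λ i j → cell (n ℕ.* m) (suc i) (suc j)) ⟨
    inner (n ℕ.* m) ∎
    where
    open ℕ.≤-Reasoning
    corner : ∀ a b → b ℕ.< m → suc (a ℕ.* m ℕ.+ b) ℕ.≤ suc a ℕ.* m
    corner a b b<m = subst₂ ℕ._≤_ (ℕ.+-suc (a ℕ.* m) b) (ℕ.+-comm (a ℕ.* m) m)
      (ℕ.+-monoʳ-≤ (a ℕ.* m) b<m)

  refine-upper : ∀ n m → .{{_ : ℕ.NonZero m}} → inner (n ℕ.* m) ℕ.≤ m ² ℕ.* outer n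
  refine-upper n m = begin
    inner (n ℕ.* m)
      ≡⟨ refine n m (λ i j → cell (n ℕ.* m) (suc i) (suc j)) ⟩
    (∑[ n ] λ a → ∑[ m ] λ b → ∑[ n ] λ c → ∑[ m ] λ d →
      cell (n ℕ.* m) (suc (a ℕ.* m ℕ.+ b)) (suc (c ℕ.* m ℕ.+ d)))
      ≤⟨ ∑-mono n (λ a _ → ∑-mono m (λ b _ → ∑-mono n (λ c _ → ∑-mono m (λ d _ →
           cell-mono (n ℕ.* m) (suc (a ℕ.* m ℕ.+ b)) (suc (c ℕ.* m ℕ.+ d)) n a c (λ h → unscale a c n m (ℕ.≤-trans
             (ℕ.+-mono-≤ (²-mono {a ℕ.* m} (corner a b)) (²-mono {c ℕ.* m} (corner c d))) h)))))) ⟩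
    (∑[ n ] λ a → ∑[ m ] λ (_ : ℕ) → ∑[ n ] λ c → ∑[ m ] λ (_ : ℕ) → cell n a c)
      ≡⟨ coarse n m (cell n) ⟩
    m ² ℕ.* outer n ∎
    where
    open ℕ.≤-Reasoning
    corner : ∀ a b → a ℕ.* m ℕ.≤ suc (a ℕ.* m ℕ.+ b)
    corner a b = ℕ.m≤n⇒m≤1+n (ℕ.m≤m+n (a ℕ.* m) b)

  4inner≤latticePoints : ∀ n → 4 ℕ.* inner n ℕ.≤ latticePoints n
  4inner≤latticePoints n = subst (4 ℕ.* inner n ℕ.≤_)
    (trans (lemma (cell n 0 0) (axis n) (axis′ n) (inner n)) (sym (latticePoints≡ n)))
    (ℕ.m≤n+m (4 ℕ.* inner n) (cell n 0 0 ℕ.+ 2 ℕ.* axis n ℕ.+ 2 ℕ.* axis′ n))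
    where
    lemma : ∀ e a b s → e ℕ.+ 2 ℕ.* a ℕ.+ 2 ℕ.* b ℕ.+ 4 ℕ.* s ≡
                        (e ℕ.+ 2 ℕ.* a) ℕ.+ 2 ℕ.* (b ℕ.+ 2 ℕ.* s)
    lemma = ℕ-Ring.solve-∀

  latticePoints≤4inner : ∀ n → .{{_ : ℕ.NonZero n}} → latticePoints n ℕ.≤ 4 ℕ.* inner n ℕ.+ 5 ℕ.* n
  latticePoints≤4inner n = subst₂ ℕ._≤_ (sym (latticePoints≡ n)) (lemma n (inner n))
    (ℕ.+-mono-≤
      (ℕ.+-mono-≤ (ℕ.≤-trans (cell≤1 n 0 0) (ℕ.>-nonZero⁻¹ n)) (ℕ.*-monoʳ-≤ 2 (axis≤n n)))
      (ℕ.*-monoʳ-≤ 2 (ℕ.+-monoˡ-≤ (2 ℕ.* inner n) (axis′≤n n))))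
    where
    lemma : ∀ n s → (n ℕ.+ 2 ℕ.* n) ℕ.+ 2 ℕ.* (n ℕ.+ 2 ℕ.* s) ≡ 4 ℕ.* s ℕ.+ 5 ℕ.* n
    lemma = ℕ-Ring.solve-∀

  latticePoints-scale : ∀ m n → .{{_ : ℕ.NonZero m}} → .{{_ : ℕ.NonZero n}} →
    latticePoints m ℕ.* n ² ℕ.≤ latticePoints n ℕ.* m ² ℕ.+ 8 ℕ.* (n ℕ.+ m) ℕ.* (m ℕ.* n)
  latticePoints-scale m n = begin
    latticePoints m ℕ.* n ²
      ≤⟨ ℕ.*-monoˡ-≤ (n ²) (latticePoints≤4inner m) ⟩
    (4 ℕ.* inner m ℕ.+ 5 ℕ.* m) ℕ.* n ²
      ≡⟨ lemma₁ (inner m) m n ⟩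
    4 ℕ.* (n ² ℕ.* inner m) ℕ.+ 5 ℕ.* m ℕ.* n ²
      ≤⟨ ℕ.+-monoˡ-≤ (5 ℕ.* m ℕ.* n ²) (ℕ.*-monoʳ-≤ 4 (refine-lower m n)) ⟩
    4 ℕ.* inner (m ℕ.* n) ℕ.+ 5 ℕ.* m ℕ.* n ²
      ≡⟨ cong (λ z → 4 ℕ.* inner z ℕ.+ 5 ℕ.* m ℕ.* n ²) (ℕ.*-comm m n) ⟩
    4 ℕ.* inner (n ℕ.* m) ℕ.+ 5 ℕ.* m ℕ.* n ²
      ≤⟨ ℕ.+-monoˡ-≤ (5 ℕ.* m ℕ.* n ²) (ℕ.*-monoʳ-≤ 4
           (ℕ.≤-trans (refine-upper n m) (ℕ.*-monoʳ-≤ (m ²) (outer≤inner n)))) ⟩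
    4 ℕ.* (m ² ℕ.* (inner n ℕ.+ 2 ℕ.* n)) ℕ.+ 5 ℕ.* m ℕ.* n ²
      ≤⟨ ℕ.m≤m+n _ (3 ℕ.* m ℕ.* n ²) ⟩
    4 ℕ.* (m ² ℕ.* (inner n ℕ.+ 2 ℕ.* n)) ℕ.+ 5 ℕ.* m ℕ.* n ² ℕ.+ 3 ℕ.* m ℕ.* n ²
      ≡⟨ lemma₂ (inner n) m n ⟩
    4 ℕ.* inner n ℕ.* m ² ℕ.+ 8 ℕ.* (n ℕ.+ m) ℕ.* (m ℕ.* n)
      ≤⟨ ℕ.+-monoˡ-≤ (8 ℕ.* (n ℕ.+ m) ℕ.* (m ℕ.* n)) (ℕ.*-monoˡ-≤ (m ²) (4inner≤latticePoints n)) ⟩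
    latticePoints n ℕ.* m ² ℕ.+ 8 ℕ.* (n ℕ.+ m) ℕ.* (m ℕ.* n) ∎
    where
    open ℕ.≤-Reasoning
    lemma₁ : ∀ s m n → (4 ℕ.* s ℕ.+ 5 ℕ.* m) ℕ.* (n ℕ.* n) ≡
                       4 ℕ.* (n ℕ.* n ℕ.* s) ℕ.+ 5 ℕ.* m ℕ.* (n ℕ.* n)
    lemma₁ = ℕ-Ring.solve-∀
    lemma₂ : ∀ s m n →
      4 ℕ.* (m ℕ.* m ℕ.* (s ℕ.+ 2 ℕ.* n)) ℕ.+ 5 ℕ.* m ℕ.* (n ℕ.* n) ℕ.+ 3 ℕ.* m ℕ.* (n ℕ.* n) ≡
      4 ℕ.* s ℕ.* (m ℕ.* m) ℕ.+ 8 ℕ.* (n ℕ.+ m) ℕ.* (m ℕ.* n)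
    lemma₂ = ℕ-Ring.solve-∀

-- π = lim #{(x , y) ∈ ℤ² : x² + y² ≤ n²} / n²: each point of the unit disk
-- with coordinates in (1/n)ℤ stands for a square of area 1/n². The k-th entry
-- is the one for n = k + 1.
π : ℝ
seq π k = + latticePoints (suc k) / (suc k ℕ.* suc k)
cauchy π = regular⇒Cauchy 8 λ m n →
  /-≤-+ (latticePoints (suc m)) (m ℕ.+ m ℕ.* suc m) (latticePoints (suc n)) (n ℕ.+ n ℕ.* suc n) 8 m n
    (subst₂ ℕ._≤_
      (lemma₁ (latticePoints (suc m)) (suc m) (suc n))
      (lemma₂ (latticePoints (suc n)) (suc m) (suc n))
      (ℕ.*-monoˡ-≤ (suc m ℕ.* suc n) (latticePoints-scale (suc m) (suc n))))
  where
  lemma₁ : ∀ a m n → (a ℕ.* (n ℕ.* n)) ℕ.* (m ℕ.* n) ≡ a ℕ.* ((n ℕ.* n) ℕ.* (m ℕ.* n))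
  lemma₁ = ℕ-Ring.solve-∀
  lemma₂ : ∀ b m n →
    (b ℕ.* (m ℕ.* m) ℕ.+ 8 ℕ.* (n ℕ.+ m) ℕ.* (m ℕ.* n)) ℕ.* (m ℕ.* n) ≡
    (b ℕ.* (m ℕ.* n) ℕ.+ (8 ℕ.* n ℕ.+ 8 ℕ.* m) ℕ.* (n ℕ.* n)) ℕ.* (m ℕ.* m)
  lemma₂ = ℕ-Ring.solve-∀

-- For k ≥ 1 the truncated subtractions are exact.
denom : ℕ → ℕ
denom k = k ℕ.* (3 ℕ.* k ℕ.∸ 1) ℕ.* (3 ℕ.* k ℕ.∸ 2) ℕ.* ((4 ℕ.* k) C k)

private

  C-nonZero : ∀ {n k} → k ℕ.≤ n → ℕ.NonZero (n C k)
  C-nonZero {n} {k} k≤n = subst ℕ.NonZero (sym (nCk≡n!/k![n-k]! k≤n))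
    (ℕ.>-nonZero (ℕ.m≥n⇒m/n>0 (ℕ.∣⇒≤ {{n ℕ.!≢0}} (k![n∸k]!∣n! k≤n))))
    where instance _ = k ℕ.!* (n ℕ.∸ k) !≢0

  3k∸-nonZero : ∀ k i → .{{_ : ℕ.NonZero k}} → i ℕ.< 3 → ℕ.NonZero (3 ℕ.* k ℕ.∸ i)
  3k∸-nonZero k i i<3 = ℕ.>-nonZero (ℕ.m<n⇒0<n∸m (ℕ.<-≤-trans i<3 (ℕ.m≤m*n 3 k)))

  product-nonZero : ∀ a b c d → .{{_ : ℕ.NonZero a}} .{{_ : ℕ.NonZero b}}
    .{{_ : ℕ.NonZero c}} .{{_ : ℕ.NonZero d}} → ℕ.NonZero (a ℕ.* b ℕ.* c ℕ.* d)
  product-nonZero a b c d = ℕ.m*n≢0 (a ℕ.* b ℕ.* c) d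
    {{ℕ.m*n≢0 (a ℕ.* b) c {{ℕ.m*n≢0 a b}}}}

instance
  denom-nonZero : ∀ {k} .{{_ : ℕ.NonZero k}} → ℕ.NonZero (denom k)
  denom-nonZero {k} = product-nonZero k (3 ℕ.* k ℕ.∸ 1) (3 ℕ.* k ℕ.∸ 2) ((4 ℕ.* k) C k)
    {{it}} {{3k∸-nonZero k 1 (ℕ.s<s ℕ.z<s)}} {{3k∸-nonZero k 2 (ℕ.s<s (ℕ.s<s ℕ.z<s))}}
    {{C-nonZero (ℕ.m≤n*m k 4)}}

{-# OPTIONS --safe #-}
module Submission where

-- With y = x (1 - x)³ both series are ∑ ∫₀¹ p(x) (z y)^k dx for a quadratic p and
-- z = 9/8 or 8, by the beta integral. For z = 9/8 the sum p / (1 - z y) of the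
-- geometric series is 6 / (1 + 3 x²). For z = 8 it is (3/2) d/dx arg (D + i v), where
-- D = 1 - 4x + 2x² and v = 2x (1 - x), since 1 - 8y = D² + v²; the argument grows
-- from 0 to π on [0 , 1].
--
-- No integral is formed: on an interval with rational ends, functions ℚ → ℚ with
-- nearly equal derivatives have nearly equal increments. An antiderivative of an
-- approximation to 1 / (1 + s²) stands for arctan, and the functional equations of
-- arctan follow by comparing derivatives. Comparing the lattice points of a disk with
-- sectors of the circle, parametrised rationally by the tangent of half the angle,
-- gives π = 4 arctan 1.
open import Data.Bool.Base using (true; false; T)
open import Data.Integer.Base as ℤ using (ℤ; +[1+_]; -[1+_])
import Data.Integer.Properties as ℤ
open import Data.Nat.Base as ℕ using (ℕ; zero; suc; _!)
import Data.Nat.Divisibility as ℕ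
import Data.Nat.DivMod as ℕ
import Data.Nat.Properties as ℕ
import Data.Nat.Tactic.RingSolver as ℕ-Ring
open import Data.Product.Base using (_×_; _,_; proj₁; proj₂; ∃-syntax)
import Data.Rational.Unnormalised.Base as ℚᵘ
import Data.Rational.Unnormalised.Properties as ℚᵘ
open import Data.Sum.Base using (inj₁; inj₂)
open import Relation.Binary.PropositionalEquality hiding ([_])
open import Relation.Nullary.Decidable.Core using (yes; no; dec⇒maybe)
open import Relation.Nullary.Negation using (contradiction)

-- With k shifted by one, 1 / `denom` is 3/4 of k! (3k)! / (4k + 3)!. The integrals of x², x (1 - x)
-- and (1 - x)² against x^k (1 - x)^(3k) share the denominator (4k + 3)!, so a numerator quadratic
-- in k determines the quadratic p.
--
-- Only rational functions are available, so every antiderivative is a truncation. Truncating a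
-- geometric series with ratio w after n terms multiplies the derivative by 1 - w^n, and such a
-- relative error passes unchanged through substitutions. With `ν` = 1/9 one ratio, 8/9, serves both
-- series and arctan on [-4 , 4].
--
-- The obstacle in the first series is √3. The angles π/3 and π/6 of arctan (√3 x) sit at the
-- rational points 1 and ⅓. Duplication relates them, and x ↦ 1 / (3x) exchanges them, with the
-- point 1/√3 of the angle π/4 fixed. So √3 enters only through a rational approximation to this
-- fixed point, with an error governed by r² - 3.
--
-- For π the obstacle is that the lattice count of a disk can be compared exactly with rectangles
-- only between integral points on its circle. A highly divisible radius supplies as many of these
-- as desired.

module Basics where

  open import Data.Rational.Base
  open import Data.Rational.Properties
  open import Level using (0ℓ)
  open import Tactic.RingSolver public using (solve-∀)
  import Tactic.RingSolver.Core.AlmostCommutativeRing as ACR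

  ring : ACR.AlmostCommutativeRing 0ℓ 0ℓ
  ring = ACR.fromCommutativeRing +-*-commutativeRing λ p → dec⇒maybe (0ℚ ≟ p)

  2ℚ 3ℚ 4ℚ : ℚ
  2ℚ = ℤ.+ 2 / 1
  3ℚ = ℤ.+ 3 / 1
  4ℚ = ℤ.+ 4 / 1

  private
    variable
      p q r s : ℚ

  -- The form in which inequalities are certified: d is a combination of visibly nonnegative
  -- factors, and the equation is left to the ring solver.
  ≤-by : ∀ {d} → 0ℚ ≤ d → p + d ≡ q → p ≤ q
  ≤-by {p} {q} {d} 0≤d e = subst (p ≤_) e (subst (_≤ p + d) (+-identityʳ p) (+-monoʳ-≤ p 0≤d))

  p≤q⇒0≤q-p : p ≤ q → 0ℚ ≤ q - p
  p≤q⇒0≤q-p {p} {q} p≤q = subst (_≤ q - p) (+-inverseʳ p) (+-monoˡ-≤ (- p) p≤q)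

  0≤+ : 0ℚ ≤ p → 0ℚ ≤ q → 0ℚ ≤ p + q
  0≤+ = +-mono-≤ {0ℚ} {_} {0ℚ}

  0≤* : 0ℚ ≤ p → 0ℚ ≤ q → 0ℚ ≤ p * q
  0≤* {p} {q} 0≤p 0≤q = subst (_≤ p * q) (*-zeroʳ p) (*-monoˡ-≤-nonNeg p {{nonNegative 0≤p}} 0≤q)

  *-mono-≤ : 0ℚ ≤ p → 0ℚ ≤ r → p ≤ q → r ≤ s → p * r ≤ q * s
  *-mono-≤ {p} {r} {q} {s} 0≤p 0≤r p≤q r≤s = ≤-trans
    (*-monoʳ-≤-nonNeg r {{nonNegative 0≤r}} p≤q)
    (*-monoˡ-≤-nonNeg q {{nonNegative (≤-trans 0≤p p≤q)}} r≤s)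

  *-mono-≤ˡ : 0ℚ ≤ r → p ≤ q → r * p ≤ r * q
  *-mono-≤ˡ {r} 0≤r = *-monoˡ-≤-nonNeg r {{nonNegative 0≤r}}

  0<* : 0ℚ < p → 0ℚ < q → 0ℚ < p * q
  0<* {p} {q} 0<p 0<q = positive⁻¹ (p * q) {{pos*pos⇒pos p {{positive 0<p}} q {{positive 0<q}}}}

  0≤p² : ∀ p → 0ℚ ≤ p * p
  0≤p² p = subst (0ℚ ≤_) (lemma (∣p∣≡p∨∣p∣≡-p p)) (0≤* (0≤∣p∣ p) (0≤∣p∣ p))
    where
    neg² : ∀ p → - p * - p ≡ p * p
    neg² = solve-∀ ring
    lemma : _ → ∣ p ∣ * ∣ p ∣ ≡ p * p
    lemma (inj₁ e) = cong₂ _*_ e e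
    lemma (inj₂ e) = trans (cong₂ _*_ e e) (neg² p)

  p≤∣p∣ : ∀ p → p ≤ ∣ p ∣
  p≤∣p∣ p with ≤-total 0ℚ p
  ... | inj₁ 0≤p = ≤-reflexive (sym (0≤p⇒∣p∣≡p 0≤p))
  ... | inj₂ p≤0 = ≤-trans p≤0 (0≤∣p∣ p)

  -p≤∣p∣ : ∀ p → - p ≤ ∣ p ∣
  -p≤∣p∣ p = subst (- p ≤_) (∣-p∣≡∣p∣ p) (p≤∣p∣ (- p))

  ∣∣≤ : p ≤ q → - p ≤ q → ∣ p ∣ ≤ q
  ∣∣≤ {p} h k with ∣p∣≡p∨∣p∣≡-p p
  ... | inj₁ e = subst (_≤ _) (sym e) h
  ... | inj₂ e = subst (_≤ _) (sym e) k

  ∣∣≤-+ : ∣ p ∣ ≤ q → ∣ r ∣ ≤ s → ∣ p + r ∣ ≤ q + s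
  ∣∣≤-+ {p} {q} {r} h k = ≤-trans (∣p+q∣≤∣p∣+∣q∣ p r) (+-mono-≤ h k)

  ∣∣≤-neg : ∣ p ∣ ≤ q → ∣ - p ∣ ≤ q
  ∣∣≤-neg {p} = subst (_≤ _) (sym (∣-p∣≡∣p∣ p))

  ∣∣≤-- : ∣ p ∣ ≤ q → ∣ r ∣ ≤ s → ∣ p - r ∣ ≤ q + s
  ∣∣≤-- h k = ∣∣≤-+ h (∣∣≤-neg k)

  ∣∣≤-* : ∣ p ∣ ≤ q → ∣ r ∣ ≤ s → ∣ p * r ∣ ≤ q * s
  ∣∣≤-* {p} {q} {r} h k = subst (_≤ _) (sym (∣p*q∣≡∣p∣*∣q∣ p r))
    (*-mono-≤ (0≤∣p∣ p) (0≤∣p∣ r) h k)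

  ∣∣≤⇒0≤ : ∣ p ∣ ≤ q → 0ℚ ≤ q
  ∣∣≤⇒0≤ {p} = ≤-trans (0≤∣p∣ p)

  0≤p≤q⇒∣p∣≤q : 0ℚ ≤ p → p ≤ q → ∣ p ∣ ≤ q
  0≤p≤q⇒∣p∣≤q 0≤p = subst (_≤ _) (sym (0≤p⇒∣p∣≡p 0≤p))

  ∣-∣-trans : ∀ p q r {a b} → ∣ p - q ∣ ≤ a → ∣ q - r ∣ ≤ b → ∣ p - r ∣ ≤ a + b
  ∣-∣-trans p q r h k = subst (λ z → ∣ z ∣ ≤ _) (lemma p q r) (∣∣≤-+ h k)
    where
    lemma : ∀ p q r → (p - q) + (q - r) ≡ p - r
    lemma = solve-∀ ring

  *-cancelʳ-≡ : ∀ r → 0ℚ < r → p * r ≡ q * r → p ≡ q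
  *-cancelʳ-≡ r 0<r e = ≤-antisym
    (*-cancelʳ-≤-pos r {{positive 0<r}} (≤-reflexive e))
    (*-cancelʳ-≤-pos r {{positive 0<r}} (≤-reflexive (sym e)))

  ≡-by₁ : ∀ {l m} c → p ≡ q → l ≡ m + c * (p - q) → l ≡ m
  ≡-by₁ {p} {q} {l} {m} c refl e = trans e (lemma m c p)
    where
    lemma : ∀ m c p → m + c * (p - p) ≡ m
    lemma = solve-∀ ring

  ≡-by₂ : ∀ {l m} c d → p ≡ q → r ≡ s → l ≡ m + c * (p - q) + d * (r - s) → l ≡ m
  ≡-by₂ c d e f g = ≡-by₁ c e (≡-by₁ d f g)

  infix 4 _∈[_,_]

  _∈[_,_] : ℚ → ℚ → ℚ → Set
  x ∈[ a , b ] = a ≤ x × x ≤ b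

-- Differentiation with a bounded quadratic remainder

module Calculus where

  open import Data.Rational.Base
  open import Data.Rational.Properties
  open import Algebra.Definitions.RawSemiring +-*-rawSemiring using (_^_)
  open Basics

  Bounded : ℚ → ℚ → (ℚ → ℚ → ℚ) → Set
  Bounded a b f = ∃[ B ] (∀ {s t} → s ∈[ a , b ] → t ∈[ a , b ] → ∣ f s t ∣ ≤ B)

  private
    variable
      a b c d ε δ : ℚ
      f g F G q : ℚ → ℚ
      φ ψ : ℚ → ℚ → ℚ

  bounded-const : ∀ p → Bounded a b (λ _ _ → p)
  bounded-const p = ∣ p ∣ , λ _ _ → ≤-refl

  bounded-id : Bounded a b (λ s _ → s)
  bounded-id {a} {b} = ∣ a ∣ + ∣ b ∣ , λ { (a≤s , s≤b) _ → ∣∣≤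
    (≤-trans s≤b (≤-trans (p≤∣p∣ b) (≤-by (0≤∣p∣ a) (+-comm ∣ b ∣ ∣ a ∣))))
    (≤-trans (neg-antimono-≤ a≤s) (≤-trans (-p≤∣p∣ a) (≤-by (0≤∣p∣ b) refl))) }

  bounded-+ : Bounded a b φ → Bounded a b ψ → Bounded a b (λ s t → φ s t + ψ s t)
  bounded-+ (B , h) (C , k) = B + C , λ s∈ t∈ → ∣∣≤-+ (h s∈ t∈) (k s∈ t∈)

  bounded-* : Bounded a b φ → Bounded a b ψ → Bounded a b (λ s t → φ s t * ψ s t)
  bounded-* (B , h) (C , k) = B * C , λ s∈ t∈ → ∣∣≤-* (h s∈ t∈) (k s∈ t∈)

  bounded-neg : Bounded a b φ → Bounded a b (λ s t → - φ s t)
  bounded-neg (B , h) = B , λ s∈ t∈ → ∣∣≤-neg (h s∈ t∈)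

  bounded-second : Bounded a b (λ s _ → f s) → Bounded a b (λ _ t → f t)
  bounded-second (B , h) = B , λ s∈ t∈ → h t∈ t∈

  bounded-Δ : Bounded a b (λ s t → t - s)
  bounded-Δ = bounded-+ (bounded-second bounded-id) (bounded-neg bounded-id)

  -- A first-order Taylor expansion stated as an equation, so that no limit occurs and the rules for
  -- sums, products, reciprocals and composites are polynomial identities. Bounds for F and f are
  -- carried along because the remainder of a product contains both.
  record Diff (a b : ℚ) (F f : ℚ → ℚ) : Set where
    field
      rem    : ℚ → ℚ → ℚ
      expand : ∀ {s t} → s ∈[ a , b ] → t ∈[ a , b ] →
               F t ≡ F s + (t - s) * (f s + (t - s) * rem s t)
      F-bounded   : Bounded a b (λ s _ → F s)
      f-bounded   : Bounded a b (λ s _ → f s)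
      rem-bounded : Bounded a b rem

  open Diff

  diff-cong : (∀ {s} → s ∈[ a , b ] → f s ≡ g s) → Diff a b F f → Diff a b F g
  diff-cong {f = f} {g = g} {F = F} e D = record
    { rem         = rem D
    ; expand      = λ {s} {t} s∈ t∈ → trans (expand D s∈ t∈)
                      (cong (λ z → F s + (t - s) * (z + (t - s) * rem D s t)) (e s∈))
    ; F-bounded   = F-bounded D
    ; f-bounded   = proj₁ (f-bounded D) , λ s∈ t∈ →
                      subst (λ z → ∣ z ∣ ≤ _) (e s∈) (proj₂ (f-bounded D) s∈ t∈)
    ; rem-bounded = rem-bounded D
    }

  diff-cong-F : (∀ s → F s ≡ G s) → Diff a b F f → Diff a b G f
  diff-cong-F {f = f} e D = record
    { rem         = rem D
    ; expand      = λ {s} {t} s∈ t∈ → trans (sym (e t)) (trans (expand D s∈ t∈)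
                      (cong (_+ (t - s) * (f s + (t - s) * rem D s t)) (e s)))
    ; F-bounded   = proj₁ (F-bounded D) , λ {s} s∈ t∈ →
                      subst (λ z → ∣ z ∣ ≤ _) (e s) (proj₂ (F-bounded D) s∈ t∈)
    ; f-bounded   = f-bounded D
    ; rem-bounded = rem-bounded D
    }

  diff-restrict : c ∈[ a , b ] → d ∈[ a , b ] → Diff a b F f → Diff c d F f
  diff-restrict (a≤c , _) (_ , d≤b) D = record
    { rem         = rem D
    ; expand      = λ s∈ t∈ → expand D (widen s∈) (widen t∈)
    ; F-bounded   = restrict (F-bounded D)
    ; f-bounded   = restrict (f-bounded D)
    ; rem-bounded = restrict (rem-bounded D)
    }
    where
    widen : ∀ {s} → s ∈[ _ , _ ] → s ∈[ _ , _ ]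
    widen (c≤s , s≤d) = ≤-trans a≤c c≤s , ≤-trans s≤d d≤b
    restrict : Bounded _ _ φ → Bounded _ _ φ
    restrict (B , h) = B , λ s∈ t∈ → h (widen s∈) (widen t∈)

  diff-const : ∀ p → Diff a b (λ _ → p) (λ _ → 0ℚ)
  diff-const p = record
    { rem         = λ _ _ → 0ℚ
    ; expand      = λ {s} {t} _ _ → lemma p s t
    ; F-bounded   = bounded-const p
    ; f-bounded   = bounded-const 0ℚ
    ; rem-bounded = bounded-const 0ℚ
    }
    where
    lemma : ∀ p s t → p ≡ p + (t - s) * (0ℚ + (t - s) * 0ℚ)
    lemma = solve-∀ ring

  diff-id : Diff a b (λ s → s) (λ _ → 1ℚ)
  diff-id = record
    { rem         = λ _ _ → 0ℚ
    ; expand      = λ {s} {t} _ _ → lemma s t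
    ; F-bounded   = bounded-id
    ; f-bounded   = bounded-const 1ℚ
    ; rem-bounded = bounded-const 0ℚ
    }
    where
    lemma : ∀ s t → t ≡ s + (t - s) * (1ℚ + (t - s) * 0ℚ)
    lemma = solve-∀ ring

  diff-+ : Diff a b F f → Diff a b G g → Diff a b (λ s → F s + G s) (λ s → f s + g s)
  diff-+ {F = F} {f = f} {G = G} {g = g} D E = record
    { rem         = λ s t → rem D s t + rem E s t
    ; expand      = λ {s} {t} s∈ t∈ → trans (cong₂ _+_ (expand D s∈ t∈) (expand E s∈ t∈))
                      (lemma (F s) (f s) (rem D s t) (G s) (g s) (rem E s t) (t - s))
    ; F-bounded   = bounded-+ (F-bounded D) (F-bounded E)
    ; f-bounded   = bounded-+ (f-bounded D) (f-bounded E)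
    ; rem-bounded = bounded-+ (rem-bounded D) (rem-bounded E)
    }
    where
    lemma : ∀ F f p G g q d → F + d * (f + d * p) + (G + d * (g + d * q)) ≡
            (F + G) + d * (f + g + d * (p + q))
    lemma = solve-∀ ring

  diff-* : Diff a b F f → Diff a b G g →
           Diff a b (λ s → F s * G s) (λ s → f s * G s + F s * g s)
  diff-* {F = F} {f = f} {G = G} {g = g} D E = record
    { rem         = λ s t → F s * rem E s t + G s * rem D s t +
                            (f s + (t - s) * rem D s t) * (g s + (t - s) * rem E s t)
    ; expand      = λ {s} {t} s∈ t∈ → trans (cong₂ _*_ (expand D s∈ t∈) (expand E s∈ t∈))
                      (lemma (F s) (f s) (rem D s t) (G s) (g s) (rem E s t) (t - s))
    ; F-bounded   = bounded-* (F-bounded D) (F-bounded E)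
    ; f-bounded   = bounded-+ (bounded-* (f-bounded D) (F-bounded E)) (bounded-* (F-bounded D) (f-bounded E))
    ; rem-bounded = bounded-+
        (bounded-+ (bounded-* (F-bounded D) (rem-bounded E)) (bounded-* (F-bounded E) (rem-bounded D)))
        (bounded-* (bounded-+ (f-bounded D) (bounded-* bounded-Δ (rem-bounded D)))
                   (bounded-+ (f-bounded E) (bounded-* bounded-Δ (rem-bounded E))))
    }
    where
    lemma : ∀ F f p G g q d → (F + d * (f + d * p)) * (G + d * (g + d * q)) ≡
            F * G + d * ((f * G + F * g) + d * (F * q + G * p + (f + d * p) * (g + d * q)))
    lemma = solve-∀ ring

  diff-scale : ∀ p → Diff a b F f → Diff a b (λ s → p * F s) (λ s → p * f s)
  diff-scale {F = F} {f = f} p D = diff-cong (λ {s} _ → lemma p (F s) (f s)) (diff-* (diff-const p) D)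
    where
    lemma : ∀ p F f → 0ℚ * F + p * f ≡ p * f
    lemma = solve-∀ ring

  diff-recip : Diff a b F f → (∀ {s} → s ∈[ a , b ] → G s * F s ≡ 1ℚ) →
               Bounded a b (λ s _ → G s) → Diff a b G (λ s → - (f s * (G s * G s)))
  diff-recip {F = F} {f = f} {G = G} D inv G-bounded = record
    -- From G t = G s - G s * G t * (F t - F s), applied a second time to the G t in the linear
    -- term.
    { rem         = λ s t → G s * G s * G t * (f s * (f s + (t - s) * rem D s t)) - rem D s t * (G s * G t)
    ; expand      = λ {s} {t} s∈ t∈ →
        lemma (F s) (f s) (rem D s t) (G s) (G t) (F t) (t - s) (inv s∈) (inv t∈) (expand D s∈ t∈)
    ; F-bounded   = G-bounded
    ; f-bounded   = bounded-neg (bounded-* (f-bounded D) (bounded-* G-bounded G-bounded))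
    ; rem-bounded = bounded-+
        (bounded-* (bounded-* (bounded-* G-bounded G-bounded) G′-bounded)
          (bounded-* (f-bounded D) (bounded-+ (f-bounded D) (bounded-* bounded-Δ (rem-bounded D)))))
        (bounded-neg (bounded-* (rem-bounded D) (bounded-* G-bounded G′-bounded)))
    }
    where
    G′-bounded = bounded-second G-bounded
    lemma : ∀ F f p G G′ F′ d → G * F ≡ 1ℚ → G′ * F′ ≡ 1ℚ → F′ ≡ F + d * (f + d * p) →
            G′ ≡ G + d * (- (f * (G * G)) + d * (G * G * G′ * (f * (f + d * p)) - p * (G * G′)))
    lemma F f p G G′ F′ d e e′ refl =
      ≡-by₂ (- ((1ℚ - d * f * G) * G′)) ((1ℚ - d * f * G) * G) e e′ (expanded F f p G G′ d)
      where
      expanded : ∀ F f p G G′ d → G′ ≡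
        G + d * (- (f * (G * G)) + d * (G * G * G′ * (f * (f + d * p)) - p * (G * G′)))
          + - ((1ℚ - d * f * G) * G′) * (G * F - 1ℚ)
          + (1ℚ - d * f * G) * G * (G′ * (F + d * (f + d * p)) - 1ℚ)
      expanded = solve-∀ ring

  bounded-∘ : {σ : ℚ → ℚ} → (∀ {s} → s ∈[ a , b ] → σ s ∈[ c , d ]) →
              Bounded c d φ → Bounded a b (λ s t → φ (σ s) (σ t))
  bounded-∘ σ∈ (B , h) = B , λ s∈ t∈ → h (σ∈ s∈) (σ∈ t∈)

  diff-∘ : {σ σ′ : ℚ → ℚ} → Diff c d F f → Diff a b σ σ′ →
           (∀ {s} → s ∈[ a , b ] → σ s ∈[ c , d ]) →
           Diff a b (λ s → F (σ s)) (λ s → f (σ s) * σ′ s)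
  diff-∘ {F = F} {f = f} {σ = σ} {σ′ = σ′} D E σ∈ = record
    { rem         = λ s t → f (σ s) * rem E s t +
                      (σ′ s + (t - s) * rem E s t) * (σ′ s + (t - s) * rem E s t) * rem D (σ s) (σ t)
    ; expand      = λ {s} {t} s∈ t∈ → trans (expand D (σ∈ s∈) (σ∈ t∈))
                      (lemma (F (σ s)) (f (σ s)) (rem D (σ s) (σ t)) (σ s) (σ t) (σ′ s) (rem E s t) (t - s)
                        (expand E s∈ t∈))
    ; F-bounded   = bounded-∘ σ∈ (F-bounded D)
    ; f-bounded   = bounded-* (bounded-∘ σ∈ (f-bounded D)) (f-bounded E)
    ; rem-bounded = bounded-+
        (bounded-* (bounded-∘ σ∈ (f-bounded D)) (rem-bounded E))
        (bounded-* (bounded-* step-bounded step-bounded) (bounded-∘ σ∈ (rem-bounded D)))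
    }
    where
    step-bounded = bounded-+ (f-bounded E) (bounded-* bounded-Δ (rem-bounded E))
    expanded : ∀ F f p s s′ q d → F + (s + d * (s′ + d * q) - s) * (f + (s + d * (s′ + d * q) - s) * p) ≡
      F + d * (f * s′ + d * (f * q + (s′ + d * q) * (s′ + d * q) * p))
    expanded = solve-∀ ring
    lemma : ∀ F f p s t s′ q d → t ≡ s + d * (s′ + d * q) → F + (t - s) * (f + (t - s) * p) ≡
      F + d * (f * s′ + d * (f * q + (s′ + d * q) * (s′ + d * q) * p))
    lemma F f p s t s′ q d refl = expanded F f p s s′ q d

  -- Bisecting n times divides the quadratic remainder by 2ⁿ.
  module _ (½ : ℚ) (0≤½ : 0ℚ ≤ ½) (½+½≡1 : ½ + ½ ≡ 1ℚ) where

    private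

      midpoint : ∀ {s t} → s ≤ t → let m = (s + t) * ½ in
                 (s ≤ m × m ≤ t) × (m - s ≡ (t - s) * ½ × t - m ≡ (t - s) * ½)
      midpoint {s} {t} s≤t =
        (≤-by 0≤h (trans (cong (s +_) (sym e)) (cancel s ((s + t) * ½))) ,
         ≤-by 0≤h (trans (cong ((s + t) * ½ +_) (sym e′)) (cancel ((s + t) * ½) t))) , e , e′
        where
        0≤h : 0ℚ ≤ (t - s) * ½
        0≤h = 0≤* (p≤q⇒0≤q-p s≤t) 0≤½
        cancel : ∀ x y → x + (y - x) ≡ y
        cancel = solve-∀ ring
        expanded : ∀ s t h → (s + t) * h - s ≡ (t - s) * h + s * (h + h - 1ℚ)
        expanded = solve-∀ ring
        expanded′ : ∀ s t h → t - (s + t) * h ≡ (t - s) * h + - t * (h + h - 1ℚ)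
        expanded′ = solve-∀ ring
        e : (s + t) * ½ - s ≡ (t - s) * ½
        e = ≡-by₁ s ½+½≡1 (expanded s t ½)
        e′ : t - (s + t) * ½ ≡ (t - s) * ½
        e′ = ≡-by₁ (- t) ½+½≡1 (expanded′ s t ½)

    private

      bound₀ : ∀ x y d f p {B} → y ≡ x + d * (f + d * p) → ∣ f ∣ ≤ ε → ∣ p ∣ ≤ B → 0ℚ ≤ d →
               ∣ y - x ∣ ≤ ε * d + B * (d * d) * 1ℚ
      bound₀ {ε = ε} x y d f p {B} refl f≤ε p≤B 0≤d =
        subst₂ _≤_ (cong ∣_∣ (e₁ x f d p)) (e₂ ε d B)
          (∣∣≤-+ (∣∣≤-* f≤ε (0≤p≤q⇒∣p∣≤q 0≤d ≤-refl))
                 (∣∣≤-* p≤B (0≤p≤q⇒∣p∣≤q (0≤* 0≤d 0≤d) ≤-refl)))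
        where
        e₁ : ∀ x f d p → f * d + p * (d * d) ≡ x + d * (f + d * p) - x
        e₁ = solve-∀ ring
        e₂ : ∀ ε d B → ε * d + B * (d * d) ≡ ε * d + B * (d * d) * 1ℚ
        e₂ = solve-∀ ring

      boundₙ : ∀ x y z d d₁ d₂ B k → d₁ ≡ d * ½ → d₂ ≡ d * ½ →
               ∣ z - y ∣ ≤ ε * d₂ + B * (d₂ * d₂) * k → ∣ y - x ∣ ≤ ε * d₁ + B * (d₁ * d₁) * k →
               ∣ z - x ∣ ≤ ε * d + B * (d * d) * (½ * k)
      boundₙ {ε = ε} x y z d _ _ B k refl refl h₁ h₂ =
        subst (∣ z - x ∣ ≤_) (≡-by₁ (ε * d + B * d * d * ½ * k) ½+½≡1 (expanded ½ ε d B k))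
          (∣-∣-trans z y x h₁ h₂)
        where
        expanded : ∀ h ε d B k →
          ε * (d * h) + B * ((d * h) * (d * h)) * k + (ε * (d * h) + B * ((d * h) * (d * h)) * k) ≡
          ε * d + B * (d * d) * (h * k) + (ε * d + B * d * d * h * k) * (h + h - 1ℚ)
        expanded = solve-∀ ring

    increment-bound : (D : Diff a b F f) → (∀ {s} → s ∈[ a , b ] → ∣ f s ∣ ≤ ε) → ∀ n {s t} →
                      s ∈[ a , b ] → t ∈[ a , b ] → s ≤ t →
                      ∣ F t - F s ∣ ≤ ε * (t - s) + proj₁ (rem-bounded D) * ((t - s) * (t - s)) * ½ ^ n
    increment-bound {F = F} {f = f} D f≤ε zero {s} {t} s∈ t∈ s≤t =
      bound₀ (F s) (F t) (t - s) (f s) (rem D s t) (expand D s∈ t∈) (f≤ε s∈)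
        (proj₂ (rem-bounded D) s∈ t∈) (p≤q⇒0≤q-p s≤t)
    increment-bound {F = F} {ε = ε} D f≤ε (suc n) {s} {t} (a≤s , s≤b) (a≤t , t≤b) s≤t =
      let ((s≤m , m≤t) , e₁ , e₂) = midpoint s≤t
          m = (s + t) * ½
          a≤m = ≤-trans a≤s s≤m
          m≤b = ≤-trans m≤t t≤b
      in boundₙ {ε = ε} (F s) (F m) (F t) (t - s) (m - s) (t - m) (proj₁ (rem-bounded D)) (½ ^ n) e₁ e₂
        (increment-bound D f≤ε n (a≤m , m≤b) (a≤t , t≤b) m≤t)
        (increment-bound D f≤ε n (a≤s , s≤b) (a≤m , m≤b) s≤m)

-- Embedding of the integers, archimedean estimates and the mean value inequality

module Limits where

  open import Data.Rational.Base
  open import Data.Rational.Properties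
  open import Algebra.Definitions.RawSemiring +-*-rawSemiring using (_^_)
  open Basics
  open Calculus

  toℚᵘ-/ : ∀ i n → toℚᵘ (i / suc n) ℚᵘ.≃ ℚᵘ.mkℚᵘ i n
  toℚᵘ-/ i n = toℚᵘ-fromℚᵘ (ℚᵘ.mkℚᵘ i n)

  opaque

    fromℤ : ℤ → ℚ
    fromℤ i = i / 1

  fromℕ : ℕ → ℚ
  fromℕ n = fromℤ (ℤ.+ n)

  opaque
    unfolding fromℤ

    fromℤ≡/1 : ∀ i → fromℤ i ≡ i / 1
    fromℤ≡/1 i = refl

    fromℕ-0 : fromℕ 0 ≡ 0ℚ
    fromℕ-0 = refl

    fromℕ-1 : fromℕ 1 ≡ 1ℚ
    fromℕ-1 = refl

    fromℤ-+ : ∀ i j → fromℤ (i ℤ.+ j) ≡ fromℤ i + fromℤ j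
    fromℤ-+ i j = toℚᵘ-injective (begin
      toℚᵘ (fromℤ (i ℤ.+ j))             ≈⟨ toℚᵘ-/ (i ℤ.+ j) 0 ⟩
      ℚᵘ.mkℚᵘ (i ℤ.+ j) 0                ≡⟨ cong (λ k → ℚᵘ.mkℚᵘ k 0)
        (cong₂ ℤ._+_ (ℤ.*-identityʳ i) (ℤ.*-identityʳ j)) ⟨
      ℚᵘ.mkℚᵘ i 0 ℚᵘ.+ ℚᵘ.mkℚᵘ j 0       ≈⟨ ℚᵘ.+-cong (toℚᵘ-/ i 0) (toℚᵘ-/ j 0) ⟨
      toℚᵘ (fromℤ i) ℚᵘ.+ toℚᵘ (fromℤ j) ≈⟨ toℚᵘ-homo-+ (fromℤ i) (fromℤ j) ⟨
      toℚᵘ (fromℤ i + fromℤ j)           ∎)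
      where open import Relation.Binary.Reasoning.Setoid ℚᵘ.≃-setoid

    fromℤ-* : ∀ i j → fromℤ (i ℤ.* j) ≡ fromℤ i * fromℤ j
    fromℤ-* i j = toℚᵘ-injective (begin
      toℚᵘ (fromℤ (i ℤ.* j))             ≈⟨ toℚᵘ-/ (i ℤ.* j) 0 ⟩
      ℚᵘ.mkℚᵘ i 0 ℚᵘ.* ℚᵘ.mkℚᵘ j 0       ≈⟨ ℚᵘ.*-cong (toℚᵘ-/ i 0) (toℚᵘ-/ j 0) ⟨
      toℚᵘ (fromℤ i) ℚᵘ.* toℚᵘ (fromℤ j) ≈⟨ toℚᵘ-homo-* (fromℤ i) (fromℤ j) ⟨
      toℚᵘ (fromℤ i * fromℤ j)           ∎)
      where open import Relation.Binary.Reasoning.Setoid ℚᵘ.≃-setoid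

    fromℤ-neg : ∀ i → fromℤ (ℤ.- i) ≡ - fromℤ i
    fromℤ-neg i = toℚᵘ-injective (begin
      toℚᵘ (fromℤ (ℤ.- i))  ≈⟨ toℚᵘ-/ (ℤ.- i) 0 ⟩
      ℚᵘ.- ℚᵘ.mkℚᵘ i 0      ≈⟨ ℚᵘ.-‿cong (toℚᵘ-/ i 0) ⟨
      ℚᵘ.- toℚᵘ (fromℤ i)   ≈⟨ toℚᵘ-homo‿- (fromℤ i) ⟨
      toℚᵘ (- fromℤ i)      ∎)
      where open import Relation.Binary.Reasoning.Setoid ℚᵘ.≃-setoid

    fromℕ-mono-≤ : ∀ {m n} → m ℕ.≤ n → fromℕ m ≤ fromℕ n
    fromℕ-mono-≤ {m} {n} m≤n = toℚᵘ-cancel-≤ (begin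
      toℚᵘ (fromℕ m)     ≃⟨ toℚᵘ-/ (ℤ.+ m) 0 ⟩
      ℚᵘ.mkℚᵘ (ℤ.+ m) 0  ≤⟨ ℚᵘ.*≤* (ℤ.*-monoʳ-≤-nonNeg (ℤ.+ 1) (ℤ.+≤+ m≤n)) ⟩
      ℚᵘ.mkℚᵘ (ℤ.+ n) 0  ≃⟨ toℚᵘ-/ (ℤ.+ n) 0 ⟨
      toℚᵘ (fromℕ n)     ∎)
      where open ℚᵘ.≤-Reasoning

    /-*-cancel : ∀ i n .{{_ : ℕ.NonZero n}} → i / n * fromℕ n ≡ fromℤ i
    /-*-cancel i n@(suc k) = toℚᵘ-injective (begin
      toℚᵘ (i / n * fromℕ n)
        ≈⟨ toℚᵘ-homo-* (i / n) (fromℕ n) ⟩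
      toℚᵘ (i / n) ℚᵘ.* toℚᵘ (fromℕ n)
        ≈⟨ ℚᵘ.*-cong (toℚᵘ-/ i k) (toℚᵘ-/ (ℤ.+ n) 0) ⟩
      ℚᵘ.mkℚᵘ i k ℚᵘ.* ℚᵘ.mkℚᵘ (ℤ.+ n) 0
        ≈⟨ ℚᵘ.*≡* (trans (ℤ.*-identityʳ (i ℤ.* ℤ.+ n)) (cong (λ z → i ℤ.* ℤ.+ z) (sym (ℕ.*-identityʳ n)))) ⟩
      ℚᵘ.mkℚᵘ i 0
        ≈⟨ toℚᵘ-/ i 0 ⟨
      toℚᵘ (fromℤ i) ∎)
      where open import Relation.Binary.Reasoning.Setoid ℚᵘ.≃-setoid

  fromℤ-- : ∀ i j → fromℤ (i ℤ.- j) ≡ fromℤ i - fromℤ j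
  fromℤ-- i j = trans (fromℤ-+ i (ℤ.- j)) (cong (fromℤ i +_) (fromℤ-neg j))

  fromℕ-+ : ∀ m n → fromℕ (m ℕ.+ n) ≡ fromℕ m + fromℕ n
  fromℕ-+ m n = trans (cong fromℤ (ℤ.pos-+ m n)) (fromℤ-+ (ℤ.+ m) (ℤ.+ n))

  fromℕ-* : ∀ m n → fromℕ (m ℕ.* n) ≡ fromℕ m * fromℕ n
  fromℕ-* m n = trans (cong fromℤ (ℤ.pos-* m n)) (fromℤ-* (ℤ.+ m) (ℤ.+ n))

  fromℕ-suc : ∀ n → fromℕ (suc n) ≡ 1ℚ + fromℕ n
  fromℕ-suc n = trans (fromℕ-+ 1 n) (cong (_+ fromℕ n) fromℕ-1)

  0≤fromℕ : ∀ n → 0ℚ ≤ fromℕ n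
  0≤fromℕ n = subst (_≤ fromℕ n) fromℕ-0 (fromℕ-mono-≤ ℕ.z≤n)

  1≤fromℕ-suc : ∀ n → 1ℚ ≤ fromℕ (suc n)
  1≤fromℕ-suc n = subst (_≤ fromℕ (suc n)) fromℕ-1 (fromℕ-mono-≤ {1} (ℕ.s≤s ℕ.z≤n))

  0<fromℕ-suc : ∀ n → 0ℚ < fromℕ (suc n)
  0<fromℕ-suc n = <-≤-trans (positive⁻¹ 1ℚ) (1≤fromℕ-suc n)

  0<fromℕ : ∀ n .{{_ : ℕ.NonZero n}} → 0ℚ < fromℕ n
  0<fromℕ (suc n) = 0<fromℕ-suc n

  fromℕ-cancel-≤ : ∀ {m n} → fromℕ m ≤ fromℕ n → m ℕ.≤ n
  fromℕ-cancel-≤ {m} {n} h with m ℕ.≤? n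
  ... | yes m≤n = m≤n
  ... | no  m≰n = contradiction
    (<-≤-trans (subst (fromℕ n <_) (sym (fromℕ-suc n)) (subst (_< 1ℚ + fromℕ n) (+-identityˡ (fromℕ n))
      (+-monoˡ-< (fromℕ n) (positive⁻¹ 1ℚ)))) (≤-trans (fromℕ-mono-≤ (ℕ.≰⇒> m≰n)) h))
    (<-irrefl refl)

  private

    numerator-bound : ∀ p → ∃[ n ] p ≤ fromℕ n
    numerator-bound p@(mkℚ (ℤ.+ m) d _) = m , toℚᵘ-cancel-≤ (begin
      toℚᵘ p             ≤⟨ ℚᵘ.*≤* (ℤ.*-monoˡ-≤-nonNeg (ℤ.+ m) (ℤ.+≤+ (ℕ.s≤s (ℕ.z≤n {d})))) ⟩
      ℚᵘ.mkℚᵘ (ℤ.+ m) 0  ≃⟨ toℚᵘ-/ (ℤ.+ m) 0 ⟨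
      toℚᵘ (ℤ.+ m / 1)   ≡⟨ cong toℚᵘ (fromℤ≡/1 (ℤ.+ m)) ⟨
      toℚᵘ (fromℕ m)     ∎)
      where open ℚᵘ.≤-Reasoning
    numerator-bound (mkℚ -[1+ _ ] _ _) = 0 , ≤-trans (*≤* ℤ.-≤+) (0≤fromℕ 0)

    denominator-bound : ∀ p → 0ℚ < p → ∃[ n ] 1ℚ ≤ fromℕ n * p
    denominator-bound p@(mkℚ +[1+ m ] d _) _ = suc d ,
      subst (1ℚ ≤_) (trans (sym (/-*-cancel +[1+ m ] (suc d)))
          (trans (*-comm (+[1+ m ] / suc d) (fromℕ (suc d))) (cong (fromℕ (suc d) *_) (fromℚᵘ-toℚᵘ p))))
        (1≤fromℕ-suc m)
    denominator-bound (mkℚ (ℤ.+ zero) _ _) (*<* (ℤ.+<+ ()))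
    denominator-bound (mkℚ -[1+ _ ] _ _) (*<* ())

  archimedean : ∀ C {d} → 0ℚ < d → ∃[ n ] C ≤ fromℕ n * d
  archimedean C {d} 0<d =
    let M , C≤M = numerator-bound C
        N , 1≤Nd = denominator-bound d 0<d
    in M ℕ.* N , ≤-trans C≤M (subst₂ _≤_ (*-identityʳ (fromℕ M))
         (trans (sym (*-assoc (fromℕ M) (fromℕ N) d)) (cong (_* d) (sym (fromℕ-* M N))))
         (*-mono-≤ˡ (0≤fromℕ M) 1≤Nd))

  ^-nonNeg : ∀ {ρ} → 0ℚ ≤ ρ → ∀ n → 0ℚ ≤ ρ ^ n
  ^-nonNeg 0≤ρ zero    = nonNegative⁻¹ 1ℚ
  ^-nonNeg 0≤ρ (suc n) = 0≤* 0≤ρ (^-nonNeg 0≤ρ n)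

  -- Bernoulli's inequality multiplied out, so that it bounds ρ ^ n from above without a division.
  -- With δ = 1 - ρ the induction step is (1 - δ) (1 + (n + 1) δ) = 1 + n δ - (n + 1) δ².
  bernoulli : ∀ {ρ} → 0ℚ ≤ ρ → ∀ n → ρ ^ n * (1ℚ + fromℕ n * (1ℚ - ρ)) ≤ 1ℚ
  bernoulli {ρ} 0≤ρ zero    = ≤-reflexive
    (trans (cong (λ z → 1ℚ * (1ℚ + z * (1ℚ - ρ))) fromℕ-0) (lemma (1ℚ - ρ)))
    where
    lemma : ∀ δ → 1ℚ * (1ℚ + 0ℚ * δ) ≡ 1ℚ
    lemma = solve-∀ ring
  bernoulli {ρ} 0≤ρ (suc n) = ≤-trans
    (≤-by (0≤* (^-nonNeg 0≤ρ n) (0≤* (0≤fromℕ (suc n)) (0≤p² (1ℚ - ρ))))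
      (lemma ρ (ρ ^ n) (fromℕ n) (fromℕ (suc n)) (fromℕ-suc n)))
    (bernoulli 0≤ρ n)
    where
    expanded : ∀ ρ x n → ρ * x * (1ℚ + (1ℚ + n) * (1ℚ - ρ)) + x * ((1ℚ + n) * ((1ℚ - ρ) * (1ℚ - ρ))) ≡
      x * (1ℚ + n * (1ℚ - ρ))
    expanded = solve-∀ ring
    lemma : ∀ ρ x n m → m ≡ 1ℚ + n → ρ * x * (1ℚ + m * (1ℚ - ρ)) + x * (m * ((1ℚ - ρ) * (1ℚ - ρ))) ≡
      x * (1ℚ + n * (1ℚ - ρ))
    lemma ρ x n _ refl = expanded ρ x n

  geometric-decay : ∀ {ρ} → 0ℚ ≤ ρ → ρ < 1ℚ → ∀ C {ε} → 0ℚ < ε →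
                    ∃[ N ] (∀ n → N ℕ.≤ n → C * ρ ^ n ≤ ε)
  geometric-decay {ρ} 0≤ρ ρ<1 C {ε} 0<ε =
    let N , C≤Nd = archimedean C (0<* 0<1-ρ 0<ε)
    in N , λ n N≤n → ≤-trans
      (*-monoʳ-≤-nonNeg (ρ ^ n) {{nonNegative (^-nonNeg 0≤ρ n)}}
        (≤-trans C≤Nd (*-monoʳ-≤-nonNeg ((1ℚ - ρ) * ε) {{nonNegative (<⇒≤ (0<* 0<1-ρ 0<ε))}}
          (fromℕ-mono-≤ N≤n))))
      (≤-trans
        (≤-by (0≤* (<⇒≤ 0<ε) (^-nonNeg 0≤ρ n)) (lemma (fromℕ n) (1ℚ - ρ) ε (ρ ^ n)))
        (subst (ε * (ρ ^ n * (1ℚ + fromℕ n * (1ℚ - ρ))) ≤_) (*-identityʳ ε)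
          (*-mono-≤ˡ (<⇒≤ 0<ε) (bernoulli 0≤ρ n))))
    where
    0<1-ρ : 0ℚ < 1ℚ - ρ
    0<1-ρ = subst (_< 1ℚ - ρ) (+-inverseʳ ρ) (+-monoˡ-< (- ρ) ρ<1)
    lemma : ∀ n δ ε x → n * (δ * ε) * x + ε * x ≡ ε * (x * (1ℚ + n * δ))
    lemma = solve-∀ ring

  ≤-by-approximation : ∀ {p q} → (∀ {ε} → 0ℚ < ε → p ≤ q + ε) → p ≤ q
  ≤-by-approximation {p} {q} h = ≮⇒≥ λ q<p →
    let m , q<m , m<p = <-dense q<p
    in <-irrefl refl (<-≤-trans m<p (subst (p ≤_) (lemma q m)
         (h (subst (_< m - q) (+-inverseʳ q) (+-monoˡ-< (- q) q<m)))))
    where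
    lemma : ∀ q m → q + (m - q) ≡ m
    lemma = solve-∀ ring

  -- The mean value inequality. No intermediate point is found, as ℚ need not contain one: the
  -- quadratic error left by bisection falls below every positive η.
  increment≤ : ∀ {a b F f ε} → a ≤ b → Diff a b F f → (∀ {s} → s ∈[ a , b ] → ∣ f s ∣ ≤ ε) →
               ∣ F b - F a ∣ ≤ ε * (b - a)
  increment≤ {a} {b} {F} {f} {ε} a≤b D f≤ε = ≤-by-approximation λ {η} 0<η →
    let N , h = geometric-decay (nonNegative⁻¹ ½) ½<1 (B * ((b - a) * (b - a))) 0<η
    in ≤-trans (increment-bound ½ (nonNegative⁻¹ ½) refl D f≤ε N (≤-refl , a≤b) (a≤b , ≤-refl) a≤b)
         (+-monoʳ-≤ (ε * (b - a)) (h N ℕ.≤-refl))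
    where
    B = proj₁ (Diff.rem-bounded D)
    ½<1 : ½ < 1ℚ
    ½<1 = *<* (ℤ.+<+ (ℕ.s≤s (ℕ.s≤s ℕ.z≤n)))

-- Approximate antiderivatives and their comparison

module Antiderivative where

  open import Data.Rational.Base
  open import Data.Rational.Properties
  open import Algebra.Definitions.RawSemiring +-*-rawSemiring using (_^_)
  open import Defs using (recip)
  open Basics
  open Calculus
  open Limits

  private
    variable
      a b c d p q ε δ : ℚ
      f F G h k σ σ′ : ℚ → ℚ

  recip-inverseˡ : 0ℚ < p → recip p * p ≡ 1ℚ
  recip-inverseˡ {p@(mkℚ +[1+ _ ] _ _)} _ = *-inverseˡ p
  recip-inverseˡ {mkℚ (ℤ.+ zero) _ _} (*<* (ℤ.+<+ ()))
  recip-inverseˡ {mkℚ -[1+ _ ] _ _} (*<* ())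

  0<recip : 0ℚ < p → 0ℚ < recip p
  0<recip {p@(mkℚ +[1+ _ ] _ _)} _ = positive⁻¹ (1/ p) {{1/pos⇒pos p}}
  0<recip {mkℚ (ℤ.+ zero) _ _} (*<* (ℤ.+<+ ()))
  0<recip {mkℚ -[1+ _ ] _ _} (*<* ())

  recip-anti-≤ : 0ℚ < p → p ≤ q → recip q ≤ recip p
  recip-anti-≤ {p} {q} 0<p p≤q = ≤-by
    (0≤* (0≤* (<⇒≤ (0<recip 0<p)) (<⇒≤ (0<recip 0<q))) (p≤q⇒0≤q-p p≤q))
    (≡-by₂ (recip p) (- recip q) (recip-inverseˡ 0<q) (recip-inverseˡ 0<p)
      (lemma p q (recip p) (recip q)))
    where
    0<q = <-≤-trans 0<p p≤q
    lemma : ∀ p q r s → s + r * s * (q - p) ≡ r + r * (s * q - 1ℚ) + - s * (r * p - 1ℚ)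
    lemma = solve-∀ ring

  recip-bounded : 0ℚ < d → (∀ {s} → s ∈[ a , b ] → d ≤ F s) → Bounded a b (λ s _ → recip (F s))
  recip-bounded {d = d} 0<d d≤F = recip d , λ s∈ _ →
    0≤p≤q⇒∣p∣≤q (<⇒≤ (0<recip (<-≤-trans 0<d (d≤F s∈)))) (recip-anti-≤ 0<d (d≤F s∈))

  diff-1/ : 0ℚ < d → (∀ {s} → s ∈[ a , b ] → d ≤ F s) → Diff a b F f →
            Diff a b (λ s → recip (F s)) (λ s → - (f s * (recip (F s) * recip (F s))))
  diff-1/ 0<d d≤F D = diff-recip D (λ s∈ → recip-inverseˡ (<-≤-trans 0<d (d≤F s∈))) (recip-bounded 0<d d≤F)

  diff-^ : ∀ n → Diff a b F f → Diff a b (λ s → F s ^ suc n) (λ s → fromℕ (suc n) * F s ^ n * f s)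
  diff-^ {F = F} {f = f} zero D = diff-cong (λ {s} _ → lemma (F s) (f s) fromℕ-1) (diff-* D (diff-const 1ℚ))
    where
    lemma : ∀ F f {k} → k ≡ 1ℚ → f * 1ℚ + F * 0ℚ ≡ k * 1ℚ * f
    lemma F f refl = expanded F f
      where
      expanded : ∀ F f → f * 1ℚ + F * 0ℚ ≡ 1ℚ * 1ℚ * f
      expanded = solve-∀ ring
  diff-^ {F = F} {f = f} (suc n) D = diff-cong
    (λ {s} _ → lemma (F s) (f s) (F s ^ n) (fromℕ (suc n)) (fromℕ-suc (suc n)))
    (diff-* D (diff-^ n D))
    where
    expanded : ∀ F f x m → f * (F * x) + F * (m * x * f) ≡ (1ℚ + m) * (F * x) * f
    expanded = solve-∀ ring
    lemma : ∀ F f x m {k} → k ≡ 1ℚ + m → f * (F * x) + F * (m * x * f) ≡ k * (F * x) * f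
    lemma F f x m refl = expanded F f x m

  -- The error is relative to q, which makes it invariant under substitutions.
  record Primitive (ε a b : ℚ) (F q : ℚ → ℚ) : Set where
    field
      {F′} : ℚ → ℚ
      err  : ℚ → ℚ
      diff : Diff a b F F′
      F′≡  : ∀ {s} → s ∈[ a , b ] → F′ s ≡ q s * (1ℚ - err s)
      err≤ : ∀ {s} → s ∈[ a , b ] → ∣ err s ∣ ≤ ε

  open Primitive

  primitive-cong : (∀ {s} → s ∈[ a , b ] → h s ≡ k s) → Primitive ε a b F h → Primitive ε a b F k
  primitive-cong e P = record
    { err  = err P
    ; diff = diff P
    ; F′≡  = λ {s} s∈ → trans (F′≡ P s∈) (cong (_* (1ℚ - err P s)) (e s∈))
    ; err≤ = err≤ P
    }

  primitive-restrict : c ∈[ a , b ] → d ∈[ a , b ] → Primitive ε a b F h → Primitive ε c d F h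
  primitive-restrict c∈@(a≤c , _) d∈@(_ , d≤b) P = record
    { err  = err P
    ; diff = diff-restrict c∈ d∈ (diff P)
    ; F′≡  = λ s∈ → F′≡ P (widen s∈)
    ; err≤ = λ s∈ → err≤ P (widen s∈)
    }
    where
    widen : ∀ {s} → s ∈[ _ , _ ] → s ∈[ _ , _ ]
    widen (c≤s , s≤d) = ≤-trans a≤c c≤s , ≤-trans s≤d d≤b

  primitive-scale : ∀ p → Primitive ε a b F h → Primitive ε a b (λ s → p * F s) (λ s → p * h s)
  primitive-scale {h = h} p P = record
    { err  = err P
    ; diff = diff-scale p (diff P)
    ; F′≡  = λ {s} s∈ → trans (cong (p *_) (F′≡ P s∈)) (sym (*-assoc p (h s) (1ℚ - err P s)))
    ; err≤ = err≤ P
    }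

  primitive-∘ : Primitive ε c d F h → Diff a b σ σ′ → (∀ {s} → s ∈[ a , b ] → σ s ∈[ c , d ]) →
                Primitive ε a b (λ s → F (σ s)) (λ s → h (σ s) * σ′ s)
  primitive-∘ {h = h} {σ = σ} {σ′ = σ′} P D σ∈ = record
    { err  = λ s → err P (σ s)
    ; diff = diff-∘ (diff P) D σ∈
    ; F′≡  = λ {s} s∈ → trans (cong (_* σ′ s) (F′≡ P (σ∈ s∈))) (lemma (h (σ s)) (err P (σ s)) (σ′ s))
    ; err≤ = λ s∈ → err≤ P (σ∈ s∈)
    }
    where
    lemma : ∀ x y z → x * (1ℚ - y) * z ≡ x * z * (1ℚ - y)
    lemma = solve-∀ ring

  -- This replaces the statement that an integral does not depend on the antiderivative: F - G has
  -- the derivative h times the difference of two relative errors, and the mean value inequality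
  -- applies. All functional equations below come from it.
  primitive-compare : ∀ {Q} → a ≤ b → Primitive ε a b F h → Primitive δ a b G h →
                      (∀ {s} → s ∈[ a , b ] → ∣ h s ∣ ≤ Q) →
                      ∣ (F b - F a) - (G b - G a) ∣ ≤ Q * (ε + δ) * (b - a)
  primitive-compare {a} {b} {ε} {F} {h} {δ} {G} {Q} a≤b P R h≤Q =
    subst (λ z → ∣ z ∣ ≤ Q * (ε + δ) * (b - a)) (lemma (F a) (F b) (G a) (G b))
      (increment≤ a≤b (diff-+ (diff P) (diff-scale (- 1ℚ) (diff R))) bound)
    where
    lemma : ∀ x y z w → (y + - 1ℚ * w) - (x + - 1ℚ * z) ≡ (y - x) - (w - z)
    lemma = solve-∀ ring
    difference : ∀ h x y → h * (y - x) ≡ h * (1ℚ - x) + - 1ℚ * (h * (1ℚ - y))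
    difference = solve-∀ ring
    bound : ∀ {s} → s ∈[ a , b ] → ∣ F′ P s + - 1ℚ * F′ R s ∣ ≤ Q * (ε + δ)
    bound {s} s∈ = subst₂ _≤_
      (cong ∣_∣ (trans (difference (h s) (err P s) (err R s))
        (sym (cong₂ (λ x y → x + - 1ℚ * y) (F′≡ P s∈) (F′≡ R s∈)))))
      (cong (Q *_) (+-comm δ ε))
      (∣∣≤-* (h≤Q s∈) (∣∣≤-- (err≤ R s∈) (err≤ P s∈)))

  geometricSum : ℕ → ℚ → ℚ
  geometricSum zero    w = 0ℚ
  geometricSum (suc n) w = geometricSum n w + w ^ n

  geometricSum-closed : ∀ n w → geometricSum n w * (1ℚ - w) ≡ 1ℚ - w ^ n
  geometricSum-closed zero w = lemma w
    where
    lemma : ∀ w → 0ℚ * (1ℚ - w) ≡ 1ℚ - 1ℚ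
    lemma = solve-∀ ring
  geometricSum-closed (suc n) w = ≡-by₁ 1ℚ (geometricSum-closed n w) (lemma (geometricSum n w) w (w ^ n))
    where
    lemma : ∀ g w x → (g + x) * (1ℚ - w) ≡ 1ℚ - w * x + 1ℚ * (g * (1ℚ - w) - (1ℚ - x))
    lemma = solve-∀ ring

  ∣∣≤-^ : ∀ {w ρ} → ∣ w ∣ ≤ ρ → ∀ n → ∣ w ^ n ∣ ≤ ρ ^ n
  ∣∣≤-^ w≤ρ zero    = ≤-refl
  ∣∣≤-^ w≤ρ (suc n) = ∣∣≤-* w≤ρ (∣∣≤-^ w≤ρ n)

-- Rational approximations to arctan

module Arctan where

  open import Data.Rational.Base
  open import Data.Rational.Properties
  open import Algebra.Definitions.RawSemiring +-*-rawSemiring using (_^_)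
  open import Defs using (recip)
  open Basics
  open Calculus
  open Limits
  open Antiderivative

  private
    variable
      a b : ℚ

  opaque

    -- The value 1/9 does two things: x (1 - x)³ ≤ ν makes 8 ν = 8/9 bound the ratio of either
    -- series, and for ∣ s ∣ ≤ 4 the ratio 1 - ν (1 + s²) is at least 1 - 17 ν = - 8/9.
    ν : ℚ
    ν = ℤ.+ 1 / 9

    0<ν : 0ℚ < ν
    0<ν = positive⁻¹ ν

    9ν≡1 : (ℤ.+ 9 / 1) * ν ≡ 1ℚ
    9ν≡1 = refl

  ρ : ℚ
  ρ = 1ℚ - ν

  8ν≡ρ : (ℤ.+ 8 / 1) * ν ≡ ρ
  8ν≡ρ = ≡-by₁ 1ℚ 9ν≡1 (lemma ν)
    where
    lemma : ∀ ν → (ℤ.+ 8 / 1) * ν ≡ 1ℚ - ν + 1ℚ * ((ℤ.+ 9 / 1) * ν - 1ℚ)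
    lemma = solve-∀ ring

  0≤ρ : 0ℚ ≤ ρ
  0≤ρ = subst (0ℚ ≤_) 8ν≡ρ (0≤* (nonNegative⁻¹ (ℤ.+ 8 / 1)) (<⇒≤ 0<ν))

  ρ<1 : ρ < 1ℚ
  ρ<1 = subst (ρ <_) (lemma ν) (subst (_< ρ + ν) (+-identityʳ ρ) (+-monoʳ-< ρ 0<ν))
    where
    lemma : ∀ ν → 1ℚ - ν + ν ≡ 1ℚ
    lemma = solve-∀ ring

  0<1+p² : ∀ p → 0ℚ < 1ℚ + p * p
  0<1+p² p = <-≤-trans (positive⁻¹ 1ℚ) (≤-by (0≤p² p) refl)

  -- 1 + s² = (1 - w s) / ν, and ∣ w s ∣ ≤ ρ for ∣ s ∣ ≤ 4, so that 1 / (1 + s²) is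
  -- the sum of a geometric series converging uniformly there.
  w : ℚ → ℚ
  w s = (1ℚ - ν) + (- ν) * (s * s)

  w-bound : ∀ {s} → s ∈[ - 4ℚ , 4ℚ ] → ∣ w s ∣ ≤ ρ
  w-bound {s} (-4≤s , s≤4) = ∣∣≤
    (≤-by (0≤* (<⇒≤ 0<ν) (0≤p² s)) (upper ν s))
    (≤-by (0≤* (<⇒≤ 0<ν) (0≤* (p≤q⇒0≤q-p s≤4) (p≤q⇒0≤q-p -4≤s)))
      (≡-by₁ (1ℚ + 1ℚ) 9ν≡1 (lower ν s)))
    where
    upper : ∀ ν s → (1ℚ - ν) + (- ν) * (s * s) + ν * (s * s) ≡ 1ℚ - ν
    upper = solve-∀ ring
    lower : ∀ ν s → - ((1ℚ - ν) + (- ν) * (s * s)) + ν * ((4ℚ - s) * (s - (- 4ℚ))) ≡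
            1ℚ - ν + (1ℚ + 1ℚ) * ((ℤ.+ 9 / 1) * ν - 1ℚ)
    lower = solve-∀ ring

  diff-w : Diff a b w (λ s → (- ν) * (s + s))
  diff-w = diff-cong (λ {s} _ → lemma ν s)
    (diff-+ (diff-const (1ℚ - ν)) (diff-scale (- ν) (diff-* diff-id diff-id)))
    where
    lemma : ∀ ν s → 0ℚ + (- ν) * (1ℚ * s + s * 1ℚ) ≡ (- ν) * (s + s)
    lemma = solve-∀ ring

  -- Since s w′ = 2 (w - (1 - ν)), the derivative of s w^(k + 1) is (2k + 3) w^(k + 1) - 2 (k + 1)
  -- (1 - ν) w^k; solving for w^(k + 1) gives the recursion.
  ∫w^ : ℕ → ℚ → ℚ
  ∫w^ zero    s = s
  ∫w^ (suc k) s = recip (fromℕ (3 ℕ.+ 2 ℕ.* k)) *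
    (s * w s ^ suc k + (1ℚ + 1ℚ) * (1ℚ - ν) * fromℕ (suc k) * ∫w^ k s)

  diff-∫w^ : ∀ k → Diff a b (∫w^ k) (λ s → w s ^ k)
  diff-∫w^ zero    = diff-id
  diff-∫w^ (suc k) = diff-cong
    (λ {s} _ → lemma (recip (fromℕ (3 ℕ.+ 2 ℕ.* k))) ν s (w s ^ k) (fromℕ (suc k)) (fromℕ (3 ℕ.+ 2 ℕ.* k))
      (recip-inverseˡ (0<fromℕ-suc _)) 2k+3)
    (diff-scale (recip (fromℕ (3 ℕ.+ 2 ℕ.* k))) (diff-+ (diff-* diff-id (diff-^ k diff-w))
      (diff-scale ((1ℚ + 1ℚ) * (1ℚ - ν) * fromℕ (suc k)) (diff-∫w^ k))))
    where
    2k+3 : fromℕ (3 ℕ.+ 2 ℕ.* k) ≡ 1ℚ + (1ℚ + 1ℚ) * fromℕ (suc k)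
    2k+3 = begin
      fromℕ (3 ℕ.+ 2 ℕ.* k)                   ≡⟨ cong (λ n → fromℕ (2 ℕ.+ n)) (ℕ.+-suc k (k ℕ.+ 0)) ⟨
      fromℕ (1 ℕ.+ 2 ℕ.* suc k)               ≡⟨ fromℕ-suc (2 ℕ.* suc k) ⟩
      1ℚ + fromℕ (2 ℕ.* suc k)                ≡⟨ cong (1ℚ +_) (trans (fromℕ-* 2 (suc k))
        (cong (_* fromℕ (suc k)) (trans (fromℕ-suc 1) (cong (1ℚ +_) fromℕ-1)))) ⟩
      1ℚ + (1ℚ + 1ℚ) * fromℕ (suc k)          ∎
      where open ≡-Reasoning
    expanded : ∀ r ν s x m →
      r * (1ℚ * (((1ℚ - ν) + (- ν) * (s * s)) * x) + s * (m * x * ((- ν) * (s + s))) +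
        (1ℚ + 1ℚ) * (1ℚ - ν) * m * x) ≡
      ((1ℚ - ν) + (- ν) * (s * s)) * x +
        ((1ℚ - ν) + (- ν) * (s * s)) * x * (r * (1ℚ + (1ℚ + 1ℚ) * m) - 1ℚ)
    expanded = solve-∀ ring
    lemma : ∀ r ν s x m n → r * n ≡ 1ℚ → n ≡ 1ℚ + (1ℚ + 1ℚ) * m →
      r * (1ℚ * (((1ℚ - ν) + (- ν) * (s * s)) * x) + s * (m * x * ((- ν) * (s + s))) +
        (1ℚ + 1ℚ) * (1ℚ - ν) * m * x) ≡
      ((1ℚ - ν) + (- ν) * (s * s)) * x
    lemma r ν s x m n e refl = ≡-by₁ (((1ℚ - ν) + (- ν) * (s * s)) * x) e (expanded r ν s x m)

  arctan : ℕ → ℚ → ℚ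
  arctan zero    s = 0ℚ
  arctan (suc K) s = arctan K s + ν * ∫w^ K s

  diff-arctan : ∀ K → Diff a b (arctan K) (λ s → ν * geometricSum K (w s))
  diff-arctan zero    = diff-cong (λ _ → sym (*-zeroʳ ν)) (diff-const 0ℚ)
  diff-arctan (suc K) = diff-cong
    (λ {s} _ → sym (*-distribˡ-+ ν (geometricSum K (w s)) (w s ^ K)))
    (diff-+ (diff-arctan K) (diff-scale ν (diff-∫w^ K)))

  arctan′ : ℚ → ℚ
  arctan′ s = recip (1ℚ + s * s)

  -- As 1 - w s = ν (1 + s²), the closed form of the finite geometric sum is the exact derivative
  -- times 1 - (w s)^K, so the relative error is (w s)^K itself.
  arctan-primitive : ∀ K → Primitive (ρ ^ K) (- 4ℚ) 4ℚ (arctan K) arctan′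
  arctan-primitive K = record
    { err  = λ s → w s ^ K
    ; diff = diff-arctan K
    ; F′≡  = λ {s} _ → ≡-by₂ (- (ν * geometricSum K (w s))) (recip (1ℚ + s * s))
               (recip-inverseˡ (0<1+p² s)) (geometricSum-closed K (w s))
               (lemma ν s (geometricSum K (w s)) (recip (1ℚ + s * s)) (w s ^ K))
    ; err≤ = λ s∈ → ∣∣≤-^ (w-bound s∈) K
    }
    where
    lemma : ∀ ν s g r x → ν * g ≡ r * (1ℚ - x) + - (ν * g) * (r * (1ℚ + s * s) - 1ℚ) +
      r * (g * (1ℚ - ((1ℚ - ν) + (- ν) * (s * s))) - (1ℚ - x))
    lemma = solve-∀ ring

  arctan-0 : ∀ K → arctan K 0ℚ ≡ 0ℚ
  arctan-0 zero    = refl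
  arctan-0 (suc K) = trans (cong₂ (λ x y → x + ν * y) (arctan-0 K) (∫w^-0 K)) (lemma ν)
    where
    lemma : ∀ ν → 0ℚ + ν * 0ℚ ≡ 0ℚ
    lemma = solve-∀ ring
    zeros : ∀ r x m → r * (0ℚ * x + m * 0ℚ) ≡ 0ℚ
    zeros = solve-∀ ring
    ∫w^-0 : ∀ k → ∫w^ k 0ℚ ≡ 0ℚ
    ∫w^-0 zero    = refl
    ∫w^-0 (suc k) = trans
      (cong (λ z → recip (fromℕ (3 ℕ.+ 2 ℕ.* k)) *
        (0ℚ * w 0ℚ ^ suc k + (1ℚ + 1ℚ) * (1ℚ - ν) * fromℕ (suc k) * z)) (∫w^-0 k))
      (zeros (recip (fromℕ (3 ℕ.+ 2 ℕ.* k))) (w 0ℚ ^ suc k) ((1ℚ + 1ℚ) * (1ℚ - ν) * fromℕ (suc k)))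

  arctan-odd : ∀ K s → arctan K (- s) ≡ - arctan K s
  arctan-odd zero    s = refl
  arctan-odd (suc K) s = trans (cong₂ (λ x y → x + ν * y) (arctan-odd K s) (∫w^-odd K s))
    (lemma ν (arctan K s) (∫w^ K s))
    where
    lemma : ∀ ν a x → - a + ν * (- x) ≡ - (a + ν * x)
    lemma = solve-∀ ring
    even : ∀ ν s → (1ℚ - ν) + (- ν) * (- s * - s) ≡ (1ℚ - ν) + (- ν) * (s * s)
    even = solve-∀ ring
    odd : ∀ r s x m y → r * (- s * x + m * - y) ≡ - (r * (s * x + m * y))
    odd = solve-∀ ring
    ∫w^-odd : ∀ k s → ∫w^ k (- s) ≡ - ∫w^ k s
    ∫w^-odd zero    s = refl
    ∫w^-odd (suc k) s = trans
      (cong₂ (λ x y → r * (- s * x ^ suc k + m * y)) (even ν s) (∫w^-odd k s))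
      (odd r s (w s ^ suc k) m (∫w^ k s))
      where
      r = recip (fromℕ (3 ℕ.+ 2 ℕ.* k))
      m = (1ℚ + 1ℚ) * (1ℚ - ν) * fromℕ (suc k)

-- The beta integral and the polynomial x (1 - x)³

module Beta where

  open import Data.Rational.Base
  open import Data.Rational.Properties
  open import Algebra.Definitions.RawSemiring +-*-rawSemiring using (_^_)
  open import Defs using (recip)
  open Basics
  open Calculus
  open Limits
  open Antiderivative
  open Arctan using (ν; 9ν≡1)

  private
    variable
      a b : ℚ

  -- The recursion is integration by parts of x^m (1 - x)^n.
  beta : ℕ → ℕ → ℚ → ℚ
  beta m zero    x = recip (fromℕ (suc m)) * x ^ suc m
  beta m (suc n) x = recip (fromℕ (suc m)) *
    (x ^ suc m * (1ℚ - x) ^ suc n + fromℕ (suc n) * beta (suc m) n x)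

  diff-1- : Diff a b (λ x → 1ℚ - x) (λ _ → - 1ℚ)
  diff-1- = diff-cong-F (λ x → lemma x)
    (diff-cong (λ _ → refl) (diff-+ (diff-const 1ℚ) (diff-scale (- 1ℚ) diff-id)))
    where
    lemma : ∀ x → 1ℚ + - 1ℚ * x ≡ 1ℚ - x
    lemma = solve-∀ ring

  diff-beta : ∀ m n → Diff a b (beta m n) (λ x → x ^ m * (1ℚ - x) ^ n)
  diff-beta m zero = diff-cong
    (λ {x} _ → ≡-by₁ (x ^ m) (recip-inverseˡ (0<fromℕ-suc m))
      (lemma (recip (fromℕ (suc m))) (fromℕ (suc m)) (x ^ m)))
    (diff-scale (recip (fromℕ (suc m))) (diff-^ m diff-id))
    where
    lemma : ∀ r k y → r * (k * y * 1ℚ) ≡ y * 1ℚ + y * (r * k - 1ℚ)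
    lemma = solve-∀ ring
  diff-beta m (suc n) = diff-cong
    (λ {x} _ → ≡-by₁ (x ^ m * ((1ℚ - x) * (1ℚ - x) ^ n)) (recip-inverseˡ (0<fromℕ-suc m))
      (lemma (recip (fromℕ (suc m))) (fromℕ (suc m)) (fromℕ (suc n)) x (x ^ m) ((1ℚ - x) ^ n)))
    (diff-scale (recip (fromℕ (suc m))) (diff-+
      (diff-* (diff-^ m diff-id) (diff-^ n diff-1-))
      (diff-scale (fromℕ (suc n)) (diff-beta (suc m) n))))
    where
    lemma : ∀ r k l x y z →
      r * (k * y * 1ℚ * ((1ℚ - x) * z) + x * y * (l * z * - 1ℚ) + l * (x * y * z)) ≡
      y * ((1ℚ - x) * z) + y * ((1ℚ - x) * z) * (r * k - 1ℚ)
    lemma = solve-∀ ring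

  beta-0 : ∀ m n → beta m n 0ℚ ≡ 0ℚ
  beta-0 m zero    = trans (cong (recip (fromℕ (suc m)) *_) (*-zeroˡ (0ℚ ^ m)))
    (*-zeroʳ (recip (fromℕ (suc m))))
  beta-0 m (suc n) = trans
    (cong (λ z → recip (fromℕ (suc m)) * (0ℚ * 0ℚ ^ m * (1ℚ - 0ℚ) ^ suc n + fromℕ (suc n) * z))
      (beta-0 (suc m) n))
    (lemma (recip (fromℕ (suc m))) (0ℚ ^ m) ((1ℚ - 0ℚ) ^ suc n) (fromℕ (suc n)))
    where
    lemma : ∀ r x y l → r * (0ℚ * x * y + l * 0ℚ) ≡ 0ℚ
    lemma = solve-∀ ring

  1^ : ∀ n → 1ℚ ^ n ≡ 1ℚ
  1^ zero    = refl
  1^ (suc n) = trans (*-identityˡ (1ℚ ^ n)) (1^ n)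

  fromℕ-! : ∀ n → fromℕ (suc n !) ≡ fromℕ (suc n) * fromℕ (n !)
  fromℕ-! n = fromℕ-* (suc n) (n !)

  -- Euler's value of the integral of x^m (1 - x)^n over [0 , 1]; the boundary term of the
  -- integration by parts vanishes at 1. The recursion keeps m + n + 1 fixed but only up to a proved
  -- equality, so k is a variable with an equation.
  beta-1 : ∀ m n {k} → k ≡ suc (m ℕ.+ n) → beta m n 1ℚ * fromℕ (k !) ≡ fromℕ (m !) * fromℕ (n !)
  beta-1 m zero refl = begin
    recip (fromℕ (suc m)) * 1ℚ ^ suc m * fromℕ (suc (m ℕ.+ 0) !)
      ≡⟨ cong₂ (λ x y → recip (fromℕ (suc m)) * x * y) (1^ (suc m))
           (trans (cong (λ i → fromℕ (suc i !)) (ℕ.+-identityʳ m)) (fromℕ-! m)) ⟩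
    recip (fromℕ (suc m)) * 1ℚ * (fromℕ (suc m) * fromℕ (m !))
      ≡⟨ ≡-by₂ (fromℕ (m !)) (- fromℕ (m !)) (recip-inverseˡ (0<fromℕ-suc m)) fromℕ-1
           (lemma (recip (fromℕ (suc m))) (fromℕ (suc m)) (fromℕ (m !)) (fromℕ 1)) ⟩
    fromℕ (m !) * fromℕ 1 ∎
    where
    open ≡-Reasoning
    lemma : ∀ r k x o → r * 1ℚ * (k * x) ≡ x * o + x * (r * k - 1ℚ) + - x * (o - 1ℚ)
    lemma = solve-∀ ring
  beta-1 m (suc n) {k} e = begin
    recip (fromℕ (suc m)) * (1ℚ ^ suc m * (0ℚ * 0ℚ ^ n) + fromℕ (suc n) * beta (suc m) n 1ℚ) * fromℕ (k !)
      ≡⟨ lemma₁ (recip (fromℕ (suc m))) (1ℚ ^ suc m) (0ℚ ^ n) (fromℕ (suc n)) (beta (suc m) n 1ℚ)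
        (fromℕ (k !)) ⟩
    recip (fromℕ (suc m)) * fromℕ (suc n) * (beta (suc m) n 1ℚ * fromℕ (k !))
      ≡⟨ cong (recip (fromℕ (suc m)) * fromℕ (suc n) *_)
        (trans (beta-1 (suc m) n (trans e (cong suc (ℕ.+-suc m n))))
           (cong (_* fromℕ (n !)) (fromℕ-! m))) ⟩
    recip (fromℕ (suc m)) * fromℕ (suc n) * (fromℕ (suc m) * fromℕ (m !) * fromℕ (n !))
      ≡⟨ ≡-by₁ (fromℕ (m !) * (fromℕ (suc n) * fromℕ (n !))) (recip-inverseˡ (0<fromℕ-suc m))
           (lemma₂ (recip (fromℕ (suc m))) (fromℕ (suc n)) (fromℕ (suc m)) (fromℕ (m !)) (fromℕ (n !))) ⟩
    fromℕ (m !) * (fromℕ (suc n) * fromℕ (n !))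
      ≡⟨ cong (fromℕ (m !) *_) (fromℕ-! n) ⟨
    fromℕ (m !) * fromℕ (suc n !) ∎
    where
    open ≡-Reasoning
    lemma₁ : ∀ r x y l b z → r * (x * (0ℚ * y) + l * b) * z ≡ r * l * (b * z)
    lemma₁ = solve-∀ ring
    lemma₂ : ∀ r l k x y → r * l * (k * x * y) ≡ x * (l * y) + x * (l * y) * (r * k - 1ℚ)
    lemma₂ = solve-∀ ring

  x[1-x]³ : ℚ → ℚ
  x[1-x]³ x = x * ((1ℚ - x) * ((1ℚ - x) * (1ℚ - x)))

  x[1-x]³≥0 : ∀ {x} → x ∈[ 0ℚ , 1ℚ ] → 0ℚ ≤ x[1-x]³ x
  x[1-x]³≥0 {x} (0≤x , x≤1) = 0≤* 0≤x (0≤* (p≤q⇒0≤q-p x≤1) (0≤p² (1ℚ - x)))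

  -- The maximum is 27/256 < 1/9, at x = 1/4.
  x[1-x]³≤ν : ∀ x → x[1-x]³ x ≤ ν
  x[1-x]³≤ν x = *-cancelˡ-≤-pos (ℤ.+ 9 / 1) {{_}} (subst ((ℤ.+ 9 / 1) * x[1-x]³ x ≤_) (sym 9ν≡1)
    (≤-by (0≤+ (0≤* (nonNegative⁻¹ (ℤ.+ 9 / 1)) (0≤* (0≤p² (x - ℤ.+ 1 / 4))
        (0≤+ (0≤p² (x - ℤ.+ 5 / 4)) (nonNegative⁻¹ (ℤ.+ 1 / 8))))) (nonNegative⁻¹ (ℤ.+ 13 / 256)))
      (lemma x)))
    where
    lemma : ∀ x → (ℤ.+ 9 / 1) * (x * ((1ℚ - x) * ((1ℚ - x) * (1ℚ - x)))) +
      ((ℤ.+ 9 / 1) * ((x - ℤ.+ 1 / 4) * (x - ℤ.+ 1 / 4) *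
        ((x - ℤ.+ 5 / 4) * (x - ℤ.+ 5 / 4) + ℤ.+ 1 / 8)) + ℤ.+ 13 / 256) ≡ 1ℚ
    lemma = solve-∀ ring

-- The partial sums as integrals of finite geometric sums

module Series where

  open import Data.Rational.Base
  open import Data.Rational.Properties
  open import Algebra.Bundles using (module CommutativeRing)
  open import Algebra.Definitions.RawSemiring +-*-rawSemiring using (_^_)
  open import Data.Nat.Combinatorics using (_C_; nCk≡n!/k![n-k]!; k![n∸k]!∣n!)
  open import Algebra.Properties.Semiring.Exp (CommutativeRing.semiring +-*-commutativeRing) using (^-assocʳ)
  open import Algebra.Properties.CommutativeSemiring.Exp (CommutativeRing.commutativeSemiring +-*-commutativeRing) using (^-distrib-*)
  open import Defs using (recip; denom; denom-nonZero; ∑₁)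
  open Basics
  open Calculus
  open Limits
  open Antiderivative
  open Arctan using (ν; ρ; 0<ν; 8ν≡ρ)
  open Beta

  private
    variable
      a b : ℚ

  nCk*k!*[n∸k]! : ∀ {n k} → k ℕ.≤ n → (n C k) ℕ.* (k ! ℕ.* (n ℕ.∸ k) !) ≡ n !
  nCk*k!*[n∸k]! {n} {k} k≤n = trans
    (cong (ℕ._* (k ! ℕ.* (n ℕ.∸ k) !)) (nCk≡n!/k![n-k]! k≤n))
    (ℕ.m/n*n≡m {{k ℕ.!* (n ℕ.∸ k) !≢0}} (k![n∸k]!∣n! k≤n))

  -- After multiplication by k + 1, the factors 3 (k + 1), 3k + 2 and 3k + 1 complete (3k)! to (3k +
  -- 3)!, the binomial coefficient turns the product into (4k + 4)!, and k + 1 cancels against 4k +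
  -- 4.
  denom-! : ∀ k → denom (suc k) ℕ.* (3 ℕ.* (k ! ℕ.* (3 ℕ.* k) !)) ≡ 4 ℕ.* (3 ℕ.+ 4 ℕ.* k) !
  denom-! k = ℕ.*-cancelˡ-≡ _ _ (suc k) (begin
    suc k ℕ.* (suc k ℕ.* (3 ℕ.* suc k ℕ.∸ 1) ℕ.* (3 ℕ.* suc k ℕ.∸ 2) ℕ.* c ℕ.* (3 ℕ.* (k ! ℕ.* (3 ℕ.* k) !)))
      ≡⟨ cong (λ m → suc k ℕ.* (suc k ℕ.* (m ℕ.∸ 1) ℕ.* (m ℕ.∸ 2) ℕ.* c
        ℕ.* (3 ℕ.* (k ! ℕ.* (3 ℕ.* k) !)))) 3k+3 ⟩
    suc k ℕ.* (suc k ℕ.* (2 ℕ.+ 3 ℕ.* k) ℕ.* (1 ℕ.+ 3 ℕ.* k) ℕ.* c ℕ.* (3 ℕ.* (k ! ℕ.* (3 ℕ.* k) !)))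
      ≡⟨ lemma k c (k !) ((3 ℕ.* k) !) ⟩
    c ℕ.* (suc k ! ℕ.* (3 ℕ.+ 3 ℕ.* k) !)
      ≡⟨ cong (λ m → c ℕ.* (suc k ! ℕ.* m !)) 4k+4∸[k+1] ⟨
    c ℕ.* (suc k ! ℕ.* (4 ℕ.* suc k ℕ.∸ suc k) !)
      ≡⟨ nCk*k!*[n∸k]! (ℕ.m≤n*m (suc k) 4) ⟩
    (4 ℕ.* suc k) !
      ≡⟨ cong _! 4k+4 ⟩
    (4 ℕ.+ 4 ℕ.* k) ℕ.* (3 ℕ.+ 4 ℕ.* k) !
      ≡⟨ lemma′ k ((3 ℕ.+ 4 ℕ.* k) !) ⟩
    suc k ℕ.* (4 ℕ.* (3 ℕ.+ 4 ℕ.* k) !) ∎)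
    where
    open ≡-Reasoning
    c = (4 ℕ.* suc k) C suc k
    3k+3 : 3 ℕ.* suc k ≡ 3 ℕ.+ 3 ℕ.* k
    3k+3 = ℕ.*-suc 3 k
    4k+4 : 4 ℕ.* suc k ≡ 4 ℕ.+ 4 ℕ.* k
    4k+4 = ℕ.*-suc 4 k
    4k+4∸[k+1] : 4 ℕ.* suc k ℕ.∸ suc k ≡ 3 ℕ.+ 3 ℕ.* k
    4k+4∸[k+1] = trans (ℕ.m+n∸m≡n (suc k) (3 ℕ.* suc k)) 3k+3
    lemma : ∀ k c x y → suc k ℕ.* (suc k ℕ.* (2 ℕ.+ 3 ℕ.* k) ℕ.* (1 ℕ.+ 3 ℕ.* k) ℕ.* c ℕ.* (3 ℕ.* (x ℕ.* y))) ≡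
      c ℕ.* ((suc k ℕ.* x) ℕ.* ((3 ℕ.+ 3 ℕ.* k) ℕ.* ((2 ℕ.+ 3 ℕ.* k) ℕ.* ((1 ℕ.+ 3 ℕ.* k) ℕ.* y))))
    lemma = ℕ-Ring.solve-∀
    lemma′ : ∀ k x → (4 ℕ.+ 4 ℕ.* k) ℕ.* x ≡ suc k ℕ.* (4 ℕ.* x)
    lemma′ = ℕ-Ring.solve-∀

  ratio : (ℕ → ℤ) → ℕ → ℚ
  ratio num k = (num (suc k) / denom (suc k)) {{denom-nonZero {suc k}}}

  -- For κ = k, k! (3k)! / (4k + 3)! times this is the integral of
  -- x^k (1 - x)^(3k) (α x² + β x (1 - x) + γ (1 - x)²) over [0 , 1].
  moment : ℚ → ℚ → ℚ → ℚ → ℚ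
  moment α β γ κ =
    α * ((1ℚ + κ) * (2ℚ + κ)) + β * ((1ℚ + κ) * (1ℚ + 3ℚ * κ)) + γ * ((1ℚ + 3ℚ * κ) * (2ℚ + 3ℚ * κ))

  module _ (z α β γ : ℚ) where

    -- The quadratic p in the homogeneous basis of x and 1 - x. In this basis all three exponent
    -- pairs in `∫term` add up to 4k + 2, so that the beta values share one factorial.
    weight : ℚ → ℚ
    weight x = α * (x * x) + β * (x * (1ℚ - x)) + γ * ((1ℚ - x) * (1ℚ - x))

    ∫term : ℕ → ℚ → ℚ
    ∫term k x = α * beta (2 ℕ.+ k) (3 ℕ.* k) x + β * beta (1 ℕ.+ k) (1 ℕ.+ 3 ℕ.* k) x +
                γ * beta k (2 ℕ.+ 3 ℕ.* k) x

    ∫partialSum : ℕ → ℚ → ℚ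
    ∫partialSum zero    x = 0ℚ
    ∫partialSum (suc n) x = ∫partialSum n x + z ^ n * ∫term n x

    [z*x[1-x]³]^ : ∀ n x → (z * x[1-x]³ x) ^ n ≡ z ^ n * (x ^ n * (1ℚ - x) ^ (3 ℕ.* n))
    [z*x[1-x]³]^ n x = begin
      (z * (x * cube)) ^ n                        ≡⟨ ^-distrib-* z (x * cube) n ⟩
      z ^ n * (x * cube) ^ n                      ≡⟨ cong (z ^ n *_) (^-distrib-* x cube n) ⟩
      z ^ n * (x ^ n * cube ^ n)                  ≡⟨ cong (λ c → z ^ n * (x ^ n * c ^ n)) (lemma (1ℚ - x)) ⟩
      z ^ n * (x ^ n * ((1ℚ - x) ^ 3) ^ n)        ≡⟨ cong (λ y → z ^ n * (x ^ n * y)) (^-assocʳ (1ℚ - x) 3 n) ⟩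
      z ^ n * (x ^ n * (1ℚ - x) ^ (3 ℕ.* n))      ∎
      where
      open ≡-Reasoning
      cube = (1ℚ - x) * ((1ℚ - x) * (1ℚ - x))
      lemma : ∀ y → y * (y * y) ≡ y * (y * (y * 1ℚ))
      lemma = solve-∀ ring

    diff-∫term : ∀ k → Diff a b (∫term k) (λ x → weight x * (x ^ k * (1ℚ - x) ^ (3 ℕ.* k)))
    diff-∫term k = diff-cong (λ {x} _ → lemma α β γ x (x ^ k) ((1ℚ - x) ^ (3 ℕ.* k)))
      (diff-+ (diff-+ (diff-scale α (diff-beta (2 ℕ.+ k) (3 ℕ.* k)))
        (diff-scale β (diff-beta (1 ℕ.+ k) (1 ℕ.+ 3 ℕ.* k))))
              (diff-scale γ (diff-beta k (2 ℕ.+ 3 ℕ.* k))))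
      where
      lemma : ∀ α β γ x y z → α * (x * (x * y) * z) + β * (x * y * ((1ℚ - x) * z)) +
        γ * (y * ((1ℚ - x) * ((1ℚ - x) * z))) ≡
        (α * (x * x) + β * (x * (1ℚ - x)) + γ * ((1ℚ - x) * (1ℚ - x))) * (y * z)
      lemma = solve-∀ ring

    diff-∫partialSum : ∀ n → Diff a b (∫partialSum n) (λ x → weight x * geometricSum n (z * x[1-x]³ x))
    diff-∫partialSum zero    = diff-cong (λ {x} _ → sym (*-zeroʳ (weight x))) (diff-const 0ℚ)
    diff-∫partialSum (suc n) = diff-cong
      (λ {x} _ → trans (cong (weight x * geometricSum n (z * x[1-x]³ x) +_)
                   (trans (lemma (weight x) (z ^ n) (x ^ n * (1ℚ - x) ^ (3 ℕ.* n)))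
                     (cong (weight x *_) (sym ([z*x[1-x]³]^ n x)))))
                 (sym (*-distribˡ-+ (weight x) (geometricSum n (z * x[1-x]³ x)) ((z * x[1-x]³ x) ^ n))))
      (diff-+ (diff-∫partialSum n) (diff-scale (z ^ n) (diff-∫term n)))
      where
      lemma : ∀ p y x → y * (p * x) ≡ p * (y * x)
      lemma = solve-∀ ring

    ∫partialSum-0 : ∀ n → ∫partialSum n 0ℚ ≡ 0ℚ
    ∫partialSum-0 zero    = refl
    ∫partialSum-0 (suc n) = trans
      (cong₂ (λ s t → s + z ^ n * t) (∫partialSum-0 n)
        (trans (cong₂ (λ s t → α * s + β * t + γ * beta n (2 ℕ.+ 3 ℕ.* n) 0ℚ)
          (beta-0 (2 ℕ.+ n) (3 ℕ.* n)) (beta-0 (1 ℕ.+ n) (1 ℕ.+ 3 ℕ.* n)))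
          (trans (cong (λ s → α * 0ℚ + β * 0ℚ + γ * s) (beta-0 n (2 ℕ.+ 3 ℕ.* n))) (zeros α β γ))))
      (lemma (z ^ n))
      where
      zeros : ∀ α β γ → α * 0ℚ + β * 0ℚ + γ * 0ℚ ≡ 0ℚ
      zeros = solve-∀ ring
      lemma : ∀ x → 0ℚ + x * 0ℚ ≡ 0ℚ
      lemma = solve-∀ ring

    module _ (c : ℚ) (num : ℕ → ℤ)
             (num≡ : ∀ k → 4ℚ * moment α β γ (fromℕ k) ≡ 3ℚ * (c * fromℤ (num (suc k)))) where

      -- Multiplied by 4 (4k + 3)!, both sides become k! (3k)! times a polynomial in k, and these
      -- polynomials agree by `num≡`. The constant c makes up for the lowest power of z: it is 1 if
      -- the series starts with z^0 and z if it starts with z^1.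
      ∫term-1 : ∀ k → ∫term k 1ℚ ≡ c * ratio num k
      ∫term-1 k = *-cancelʳ-≡ (4ℚ * F) (0<* (positive⁻¹ 4ℚ)
        (0<fromℕ ((3 ℕ.+ 4 ℕ.* k) !) {{(3 ℕ.+ 4 ℕ.* k) ℕ.!≢0}}))
        (lemma α β γ c (fromℕ k) F (fromℕ (k !)) (fromℕ ((3 ℕ.* k) !)) (ratio num k) (fromℕ (denom (suc k)))
          (fromℤ (num (suc k)))
          (beta (2 ℕ.+ k) (3 ℕ.* k) 1ℚ) (beta (1 ℕ.+ k) (1 ℕ.+ 3 ℕ.* k) 1ℚ) (beta k (2 ℕ.+ 3 ℕ.* k) 1ℚ)
          (trans (beta-1 (2 ℕ.+ k) (3 ℕ.* k) (index₁ k)) (cong (_* fromℕ ((3 ℕ.* k) !)) (fromℕ-!₂ k)))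
          (trans (beta-1 (1 ℕ.+ k) (1 ℕ.+ 3 ℕ.* k) (index₂ k))
            (cong₂ _*_ (fromℕ-!₁ k) (trans (fromℕ-!₁ (3 ℕ.* k))
            (cong (λ m → (1ℚ + m) * fromℕ ((3 ℕ.* k) !)) fromℕ-3k))))
          (trans (beta-1 k (2 ℕ.+ 3 ℕ.* k) (index₃ k))
            (cong (fromℕ (k !) *_) (trans (fromℕ-!₂ (3 ℕ.* k))
            (cong (λ m → (2ℚ + m) * ((1ℚ + m) * fromℕ ((3 ℕ.* k) !))) fromℕ-3k))))
          (num≡ k) (/-*-cancel (num (suc k)) (denom (suc k)) {{denom-nonZero {suc k}}}) den)
        where
        F = fromℕ ((3 ℕ.+ 4 ℕ.* k) !)
        index₁ : ∀ k → 3 ℕ.+ 4 ℕ.* k ≡ suc (2 ℕ.+ k ℕ.+ 3 ℕ.* k)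
        index₁ = ℕ-Ring.solve-∀
        index₂ : ∀ k → 3 ℕ.+ 4 ℕ.* k ≡ suc (1 ℕ.+ k ℕ.+ (1 ℕ.+ 3 ℕ.* k))
        index₂ = ℕ-Ring.solve-∀
        index₃ : ∀ k → 3 ℕ.+ 4 ℕ.* k ≡ suc (k ℕ.+ (2 ℕ.+ 3 ℕ.* k))
        index₃ = ℕ-Ring.solve-∀
        fromℕ-3k : fromℕ (3 ℕ.* k) ≡ 3ℚ * fromℕ k
        fromℕ-3k = trans (fromℕ-* 3 k) (cong (_* fromℕ k) (fromℤ≡/1 (ℤ.+ 3)))
        fromℕ-!₁ : ∀ k → fromℕ ((1 ℕ.+ k) !) ≡ (1ℚ + fromℕ k) * fromℕ (k !)
        fromℕ-!₁ k = trans (fromℕ-! k) (cong (_* fromℕ (k !)) (fromℕ-suc k))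
        fromℕ-!₂ : ∀ k → fromℕ ((2 ℕ.+ k) !) ≡ (2ℚ + fromℕ k) * ((1ℚ + fromℕ k) * fromℕ (k !))
        fromℕ-!₂ k = trans (fromℕ-! (suc k)) (cong₂ _*_
          (trans (fromℕ-+ 2 k) (cong (_+ fromℕ k) (fromℤ≡/1 (ℤ.+ 2)))) (fromℕ-!₁ k))
        den : fromℕ (denom (suc k)) * (3ℚ * (fromℕ (k !) * fromℕ ((3 ℕ.* k) !))) ≡ 4ℚ * F
        den = begin
          fromℕ (denom (suc k)) * (3ℚ * (fromℕ (k !) * fromℕ ((3 ℕ.* k) !)))
            ≡⟨ cong₂ (λ x y → fromℕ (denom (suc k)) * (x * y)) (fromℤ≡/1 (ℤ.+ 3))
              (fromℕ-* (k !) ((3 ℕ.* k) !)) ⟨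
          fromℕ (denom (suc k)) * (fromℕ 3 * fromℕ (k ! ℕ.* (3 ℕ.* k) !))
            ≡⟨ trans (fromℕ-* (denom (suc k)) _) (cong (fromℕ (denom (suc k)) *_) (fromℕ-* 3 _)) ⟨
          fromℕ (denom (suc k) ℕ.* (3 ℕ.* (k ! ℕ.* (3 ℕ.* k) !)))
            ≡⟨ cong fromℕ (denom-! k) ⟩
          fromℕ (4 ℕ.* (3 ℕ.+ 4 ℕ.* k) !)
            ≡⟨ trans (fromℕ-* 4 ((3 ℕ.+ 4 ℕ.* k) !)) (cong (_* F) (fromℤ≡/1 (ℤ.+ 4))) ⟩
          4ℚ * F ∎
          where open ≡-Reasoning
        lemma : ∀ α β γ c κ F x y T d N b₁ b₂ b₃ →
          b₁ * F ≡ (2ℚ + κ) * ((1ℚ + κ) * x) * y →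
          b₂ * F ≡ (1ℚ + κ) * x * ((1ℚ + 3ℚ * κ) * y) →
          b₃ * F ≡ x * ((2ℚ + 3ℚ * κ) * ((1ℚ + 3ℚ * κ) * y)) →
          4ℚ * (α * ((1ℚ + κ) * (2ℚ + κ)) + β * ((1ℚ + κ) * (1ℚ + 3ℚ * κ)) +
            γ * ((1ℚ + 3ℚ * κ) * (2ℚ + 3ℚ * κ))) ≡ 3ℚ * (c * N) →
          T * d ≡ N → d * (3ℚ * (x * y)) ≡ 4ℚ * F →
          (α * b₁ + β * b₂ + γ * b₃) * (4ℚ * F) ≡ c * T * (4ℚ * F)
        lemma α β γ c κ F x y T d N b₁ b₂ b₃ e₁ e₂ e₃ e₄ refl e₅ = begin
          (α * b₁ + β * b₂ + γ * b₃) * (4ℚ * F)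
            ≡⟨ s₁ α β γ F b₁ b₂ b₃ ⟩
          4ℚ * (α * (b₁ * F) + β * (b₂ * F) + γ * (b₃ * F))
            ≡⟨ cong₂ (λ u v → 4ℚ * (u + γ * v)) (cong₂ (λ u v → α * u + β * v) e₁ e₂) e₃ ⟩
          4ℚ * (α * ((2ℚ + κ) * ((1ℚ + κ) * x) * y) + β * ((1ℚ + κ) * x * ((1ℚ + 3ℚ * κ) * y)) +
            γ * (x * ((2ℚ + 3ℚ * κ) * ((1ℚ + 3ℚ * κ) * y))))
            ≡⟨ s₂ α β γ κ x y ⟩
          4ℚ * (α * ((1ℚ + κ) * (2ℚ + κ)) + β * ((1ℚ + κ) * (1ℚ + 3ℚ * κ)) +
            γ * ((1ℚ + 3ℚ * κ) * (2ℚ + 3ℚ * κ))) * (x * y)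
            ≡⟨ cong (_* (x * y)) e₄ ⟩
          3ℚ * (c * (T * d)) * (x * y)
            ≡⟨ s₃ c T d x y ⟩
          c * T * (d * (3ℚ * (x * y)))
            ≡⟨ cong (c * T *_) e₅ ⟩
          c * T * (4ℚ * F) ∎
          where
          open ≡-Reasoning
          s₁ : ∀ α β γ F b₁ b₂ b₃ → (α * b₁ + β * b₂ + γ * b₃) * (4ℚ * F) ≡
            4ℚ * (α * (b₁ * F) + β * (b₂ * F) + γ * (b₃ * F))
          s₁ = solve-∀ ring
          s₂ : ∀ α β γ κ x y →
            4ℚ * (α * ((2ℚ + κ) * ((1ℚ + κ) * x) * y) + β * ((1ℚ + κ) * x * ((1ℚ + 3ℚ * κ) * y)) +
              γ * (x * ((2ℚ + 3ℚ * κ) * ((1ℚ + 3ℚ * κ) * y)))) ≡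
            4ℚ * (α * ((1ℚ + κ) * (2ℚ + κ)) + β * ((1ℚ + κ) * (1ℚ + 3ℚ * κ)) +
              γ * ((1ℚ + 3ℚ * κ) * (2ℚ + 3ℚ * κ))) * (x * y)
          s₂ = solve-∀ ring
          s₃ : ∀ c T d x y → 3ℚ * (c * (T * d)) * (x * y) ≡ c * T * (d * (3ℚ * (x * y)))
          s₃ = solve-∀ ring

      module _ (t : (k : ℕ) .{{_ : ℕ.NonZero k}} → ℚ)
               (t≡ : ∀ k → t (suc k) ≡ c * ratio num k * z ^ k) where

        ∑₁≡∫partialSum : ∀ n → ∑₁ t n ≡ ∫partialSum n 1ℚ
        ∑₁≡∫partialSum zero    = refl
        ∑₁≡∫partialSum (suc n) = cong₂ _+_ (∑₁≡∫partialSum n)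
          (trans (t≡ n) (trans (*-comm (c * ratio num n) (z ^ n)) (cong (z ^ n *_) (sym (∫term-1 n)))))

    module _ (0≤z : 0ℚ ≤ z) (z≤8 : z ≤ ℤ.+ 8 / 1) where

      z*x[1-x]³-bound : ∀ {x} → x ∈[ 0ℚ , 1ℚ ] → (z * x[1-x]³ x) ∈[ 0ℚ , ρ ]
      z*x[1-x]³-bound {x} x∈ = 0≤* 0≤z (x[1-x]³≥0 x∈) ,
        subst (z * x[1-x]³ x ≤_) 8ν≡ρ (*-mono-≤ 0≤z (x[1-x]³≥0 x∈) z≤8 (x[1-x]³≤ν x))

      ν≤1-z*x[1-x]³ : ∀ {x} → x ∈[ 0ℚ , 1ℚ ] → ν ≤ 1ℚ - z * x[1-x]³ x
      ν≤1-z*x[1-x]³ {x} x∈ = ≤-by (p≤q⇒0≤q-p (proj₂ (z*x[1-x]³-bound x∈))) (lemma ν (z * x[1-x]³ x))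
        where
        lemma : ∀ ν y → ν + (1ℚ - ν - y) ≡ 1ℚ - y
        lemma = solve-∀ ring

      integrand : ℚ → ℚ
      integrand x = weight x * recip (1ℚ - z * x[1-x]³ x)

      -- The same mechanism as for arctan: the n-th partial sum of the geometric series with ratio z
      -- y is its limit times 1 - (z y)^n, and z ≤ 8 gives z y ≤ 8 ν.
      ∫partialSum-primitive : ∀ n → Primitive (ρ ^ n) 0ℚ 1ℚ (∫partialSum n) integrand
      ∫partialSum-primitive n = record
        { err  = λ x → (z * x[1-x]³ x) ^ n
        ; diff = diff-∫partialSum n
        ; F′≡  = λ {x} x∈ → ≡-by₂ (- (weight x * geometricSum n (z * x[1-x]³ x)))
          (weight x * recip (1ℚ - z * x[1-x]³ x))
                   (recip-inverseˡ (<-≤-trans 0<ν (ν≤1-z*x[1-x]³ x∈))) (geometricSum-closed n (z * x[1-x]³ x))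
                   (lemma (weight x) (geometricSum n (z * x[1-x]³ x)) (recip (1ℚ - z * x[1-x]³ x))
                     (z * x[1-x]³ x) ((z * x[1-x]³ x) ^ n))
        ; err≤ = λ x∈ → ∣∣≤-^ (let 0≤y , y≤ρ = z*x[1-x]³-bound x∈ in 0≤p≤q⇒∣p∣≤q 0≤y y≤ρ) n
        }
        where
        lemma : ∀ p g r y x → p * g ≡ p * r * (1ℚ - x) + - (p * g) * (r * (1ℚ - y) - 1ℚ) +
          p * r * (g * (1ℚ - y) - (1ℚ - x))
        lemma = solve-∀ ring

-- Substitutions in the arctan integrand

module Substitution where

  open import Data.Rational.Base
  open import Data.Rational.Properties
  open import Algebra.Definitions.RawSemiring +-*-rawSemiring using (_^_)
  open import Defs using (recip)
  open Basics
  open Calculus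
  open Antiderivative
  open Arctan

  private
    variable
      a b c d p q r s ε δ : ℚ
      F G h k N N′ M M′ : ℚ → ℚ

  ≡-by₃ : ∀ {l m p₁ p₂ p₃ q₁ q₂ q₃} c₁ c₂ c₃ → p₁ ≡ q₁ → p₂ ≡ q₂ → p₃ ≡ q₃ →
          l ≡ m + c₁ * (p₁ - q₁) + c₂ * (p₂ - q₂) + c₃ * (p₃ - q₃) → l ≡ m
  ≡-by₃ c₁ c₂ c₃ e₁ e₂ e₃ e = ≡-by₁ c₁ e₁ (≡-by₂ c₂ c₃ e₂ e₃ e)

  -- The derivative identity for a substitution, with denominators cleared.
  recip-transfer : ∀ A B m n → 0ℚ < A → 0ℚ < B → m * A ≡ n * B → recip B * m ≡ n * recip A
  recip-transfer A B m n 0<A 0<B e =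
    ≡-by₃ (n * recip A) (- (recip B * m)) (recip B * recip A) (recip-inverseˡ 0<B) (recip-inverseˡ 0<A) e
      (lemma A B (recip B) (recip A) m n)
    where
    lemma : ∀ A B S X m n → S * m ≡ n * X + n * X * (S * B - 1ℚ) + - (S * m) * (X * A - 1ℚ) +
      S * X * (m * A - n * B)
    lemma = solve-∀ ring

  diff-quadratic : ∀ p q r → Diff a b (λ x → p + x * (q + x * r)) (λ x → q + x * (r + r))
  diff-quadratic p q r = diff-cong (λ {x} _ → lemma q r x)
    (diff-+ (diff-const p) (diff-* diff-id (diff-+ (diff-const q) (diff-* diff-id (diff-const r)))))
    where
    lemma : ∀ q r x → 0ℚ + (1ℚ * (q + x * r) + x * (0ℚ + (1ℚ * r + x * 0ℚ))) ≡ q + x * (r + r)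
    lemma = solve-∀ ring

  *recip≤ : ∀ {m n} → 0ℚ < m → n ≤ c * m → n * recip m ≤ c
  *recip≤ {c} {m} {n} 0<m n≤cm = subst (n * recip m ≤_)
    (≡-by₁ c (recip-inverseˡ 0<m) (lemma c m (recip m)))
    (*-monoʳ-≤-nonNeg (recip m) {{nonNegative (<⇒≤ (0<recip 0<m))}} n≤cm)
    where
    lemma : ∀ c m r → c * m * r ≡ c + c * (r * m - 1ℚ)
    lemma = solve-∀ ring

  ≤*recip : ∀ {m n} → 0ℚ < m → c * m ≤ n → c ≤ n * recip m
  ≤*recip {c} {m} {n} 0<m cm≤n = subst (_≤ n * recip m)
    (≡-by₁ c (recip-inverseˡ 0<m) (lemma c m (recip m)))
    (*-monoʳ-≤-nonNeg (recip m) {{nonNegative (<⇒≤ (0<recip 0<m))}} cm≤n)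
    where
    lemma : ∀ c m r → c * m * r ≡ c + c * (r * m - 1ℚ)
    lemma = solve-∀ ring

  diff-quotient : 0ℚ < d → (∀ {s} → s ∈[ a , b ] → d ≤ M s) → Diff a b N N′ → Diff a b M M′ →
    Diff a b (λ s → N s * recip (M s)) (λ s → N′ s * recip (M s) - N s * M′ s * (recip (M s) * recip (M s)))
  diff-quotient {M = M} {N = N} {N′ = N′} {M′ = M′} 0<d d≤M D E = diff-cong
    (λ {s} _ → lemma (N s) (N′ s) (M′ s) (recip (M s)))
    (diff-* D (diff-1/ 0<d d≤M E))
    where
    lemma : ∀ n n′ m′ r → n′ * r + n * - (m′ * (r * r)) ≡ n′ * r - n * m′ * (r * r)
    lemma = solve-∀ ring

  -- The derivative of arctan (N / M) is the Wronskian over M² + N². The reciprocal of M is gone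
  -- from this form, so that pieces with different quotients can share one integrand. The range
  -- condition keeps N / M within [-4 , 4].
  arctan-quotient : Primitive ε (- 4ℚ) 4ℚ F arctan′ → 0ℚ < d → (∀ {s} → s ∈[ a , b ] → d ≤ M s) →
    Diff a b N N′ → Diff a b M M′ → (∀ {s} → s ∈[ a , b ] → (- 4ℚ * M s ≤ N s) × (N s ≤ 4ℚ * M s)) →
    Primitive ε a b (λ s → F (N s * recip (M s)))
      (λ s → (N′ s * M s - N s * M′ s) * recip (M s * M s + N s * N s))
  arctan-quotient {M = M} {N = N} {N′ = N′} {M′ = M′} P 0<d d≤M D E range = primitive-cong
    (λ {s} s∈ → let 0<M = <-≤-trans 0<d (d≤M s∈) in
      recip-transfer (M s * M s + N s * N s) (1ℚ + N s * recip (M s) * (N s * recip (M s)))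
        (N′ s * recip (M s) - N s * M′ s * (recip (M s) * recip (M s))) (N′ s * M s - N s * M′ s)
        (<-≤-trans (0<* 0<M 0<M) (≤-by (0≤p² (N s)) refl)) (0<1+p² (N s * recip (M s)))
        (≡-by₁ (N′ s * M s - recip (M s) * N s * N s * N′ s - N s * M′ s * (recip (M s) * M s + 1ℚ))
          (recip-inverseˡ 0<M)
          (lemma (N s) (N′ s) (M s) (M′ s) (recip (M s)))))
    (primitive-∘ P (diff-quotient 0<d d≤M D E)
      (λ s∈ → let 0<M = <-≤-trans 0<d (d≤M s∈) ; lo , hi = range s∈ in ≤*recip 0<M lo , *recip≤ 0<M hi))
    where
    lemma : ∀ n n′ m m′ r →
      (n′ * r - n * m′ * (r * r)) * (m * m + n * n) ≡
      (n′ * m - n * m′) * (1ℚ + n * r * (n * r)) +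
        (n′ * m - r * n * n * n′ - n * m′ * (r * m + 1ℚ)) * (r * m - 1ℚ)
    lemma = solve-∀ ring

  module _ (c p : ℚ) (0<c : 0ℚ < c) where

    0<1+c*s² : ∀ s → 0ℚ < 1ℚ + c * (s * s)
    0<1+c*s² s = <-≤-trans (positive⁻¹ 1ℚ) (≤-by (0≤* (<⇒≤ 0<c) (0≤p² s)) refl)

    -- Up to a constant factor the derivative of arctan (√c s), written without √c, which need not
    -- be rational.
    lorentzian : ℚ → ℚ
    lorentzian s = p * recip (1ℚ + c * (s * s))

    lorentzian-bound : 0ℚ ≤ p → ∀ s → ∣ lorentzian s ∣ ≤ p
    lorentzian-bound 0≤p s = 0≤p≤q⇒∣p∣≤q (0≤* 0≤p (<⇒≤ (0<recip (0<1+c*s² s))))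
      (*recip≤ {n = p} (0<1+c*s² s) (≤-by (0≤* 0≤p (0≤* (<⇒≤ 0<c) (0≤p² s))) (lemma p c s)))
      where
      lemma : ∀ p c s → p + p * (c * (s * s)) ≡ p * (1ℚ + c * (s * s))
      lemma = solve-∀ ring

    -- The substitution s ↦ 1 / (c s) changes the sign of p ds / (1 + c s²). This is the constancy
    -- of arctan x + arctan (1 / x), at x = √c s, in terms of increments, so that the constant π/2
    -- need not be known.
    inversion : ∀ {l u} → Primitive ε a b F lorentzian → 0ℚ ≤ p → 0ℚ < l → l ≤ u →
      l ∈[ a , b ] → u ∈[ a , b ] → recip (c * u) ∈[ a , b ] → recip (c * l) ∈[ a , b ] →
      ∣ (F u - F l) + (F (recip (c * u)) - F (recip (c * l))) ∣ ≤ p * (ε + ε) * (u - l)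
    inversion {ε = ε} {F = F} {l} {u} P 0≤p 0<l l≤u l∈ u∈ 1/cu∈ 1/cl∈ =
      subst (λ z → ∣ z ∣ ≤ p * (ε + ε) * (u - l))
        (rearrange (F l) (F u) (F (recip (c * l))) (F (recip (c * u))))
        (primitive-compare l≤u (primitive-restrict l∈ u∈ P) inverted (λ {s} _ → lorentzian-bound 0≤p s))
      where
      rearrange : ∀ x y z w → (y - x) - (- 1ℚ * w - - 1ℚ * z) ≡ (y - x) + (w - z)
      rearrange = solve-∀ ring
      0<cl = 0<* 0<c 0<l
      c*-mono : ∀ {s t} → s ≤ t → c * s ≤ c * t
      c*-mono = *-mono-≤ˡ (<⇒≤ 0<c)
      lemma : ∀ c s r → - (c * 1ℚ * (r * r)) * (1ℚ + c * (s * s)) ≡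
        - 1ℚ * (1ℚ + c * (r * r)) + - (r * (c * s) + 1ℚ) * (r * (c * s) - 1ℚ)
      lemma = solve-∀ ring
      pull : ∀ p X m → - 1ℚ * (p * X * m) ≡ - p * (X * m)
      pull = solve-∀ ring
      push : ∀ p X → - p * (- 1ℚ * X) ≡ p * X
      push = solve-∀ ring
      inverted : Primitive ε l u (λ s → - 1ℚ * F (recip (c * s))) lorentzian
      inverted = primitive-cong
        (λ {s} (l≤s , _) → let σ = recip (c * s) in
          trans (pull p (recip (1ℚ + c * (σ * σ))) (- (c * 1ℚ * (σ * σ))))
            (trans (cong (- p *_) (recip-transfer (1ℚ + c * (s * s)) (1ℚ + c * (σ * σ))
              (- (c * 1ℚ * (σ * σ))) (- 1ℚ)
                (0<1+c*s² s) (0<1+c*s² σ)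
                (≡-by₁ (- (σ * (c * s) + 1ℚ)) (recip-inverseˡ (<-≤-trans 0<cl (c*-mono l≤s))) (lemma c s σ))))
              (push p (recip (1ℚ + c * (s * s))))))
        (primitive-scale (- 1ℚ) (primitive-∘ P
          (diff-1/ 0<cl (λ (l≤s , _) → c*-mono l≤s) (diff-scale c diff-id))
          (λ (l≤s , s≤u) →
            ≤-trans (proj₁ 1/cu∈) (recip-anti-≤ (<-≤-trans 0<cl (c*-mono l≤s)) (c*-mono s≤u)) ,
            ≤-trans (recip-anti-≤ 0<cl (c*-mono l≤s)) (proj₂ 1/cl∈))))

-- The second series as the increment of an argument

module SecondSeries where

  open import Data.Rational.Base
  open import Data.Rational.Properties
  open import Algebra.Definitions.RawSemiring +-*-rawSemiring using (_^_)
  open import Defs using (recip)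
  open Basics
  open Calculus
  open Limits
  open Antiderivative
  open Arctan
  open Beta
  open Series
  open Substitution

  integrand₂ : ℚ → ℚ
  integrand₂ = integrand (ℤ.+ 8 / 1) 3ℚ 0ℚ 3ℚ (nonNegative⁻¹ (ℤ.+ 8 / 1)) ≤-refl

  F₂ : ℕ → ℚ → ℚ
  F₂ = ∫partialSum (ℤ.+ 8 / 1) 3ℚ 0ℚ 3ℚ

  -- Horner form with all three coefficients written out, the shape in which `diff-quadratic`
  -- delivers a polynomial and its derivative.
  v v′ D D′ : ℚ → ℚ
  v x = 0ℚ + x * (2ℚ + x * (- 2ℚ))
  v′ x = 2ℚ + x * (- 2ℚ + - 2ℚ)
  D x = 1ℚ + x * (- 4ℚ + x * 2ℚ)
  D′ x = - 4ℚ + x * (2ℚ + 2ℚ)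

  u u′ : ℚ → ℚ
  u x = - 1ℚ + x * (4ℚ + x * (- 2ℚ))
  u′ x = 4ℚ + x * (- 2ℚ + - 2ℚ)

  F₂-primitive : ∀ n → Primitive (ρ ^ n) 0ℚ 1ℚ (F₂ n) integrand₂
  F₂-primitive = ∫partialSum-primitive (ℤ.+ 8 / 1) 3ℚ 0ℚ 3ℚ (nonNegative⁻¹ (ℤ.+ 8 / 1)) ≤-refl

  -- The weight 3 (x² + (1 - x)²) equals 6 - 6 (x (1 - x) + ½), hence is at most 6, and the
  -- denominator 1 - 8y is at least `ν`.
  Q₂ : ℚ
  Q₂ = (ℤ.+ 6 / 1) * recip ν

  integrand₂-bound : ∀ {x} → x ∈[ 0ℚ , 1ℚ ] → ∣ integrand₂ x ∣ ≤ Q₂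
  integrand₂-bound {x} x∈@(0≤x , x≤1) = 0≤p≤q⇒∣p∣≤q
    (0≤* 0≤g (<⇒≤ (0<recip (<-≤-trans 0<ν ν≤))))
    (*-mono-≤ 0≤g (<⇒≤ (0<recip (<-≤-trans 0<ν ν≤)))
      (≤-by (0≤* (nonNegative⁻¹ (ℤ.+ 6 / 1)) (0≤+ (0≤* 0≤x (p≤q⇒0≤q-p x≤1)) (nonNegative⁻¹ ½))) (upper x))
      (recip-anti-≤ 0<ν ν≤))
    where
    ν≤ = ν≤1-z*x[1-x]³ (ℤ.+ 8 / 1) 3ℚ 0ℚ 3ℚ (nonNegative⁻¹ (ℤ.+ 8 / 1)) ≤-refl x∈
    0≤g : 0ℚ ≤ weight (ℤ.+ 8 / 1) 3ℚ 0ℚ 3ℚ x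
    0≤g = 0≤+ (0≤+ (0≤* (nonNegative⁻¹ 3ℚ) (0≤p² x)) (≤-reflexive (sym (*-zeroˡ (x * (1ℚ - x))))))
      (0≤* (nonNegative⁻¹ 3ℚ) (0≤p² (1ℚ - x)))
    upper : ∀ x → 3ℚ * (x * x) + 0ℚ * (x * (1ℚ - x)) + 3ℚ * ((1ℚ - x) * (1ℚ - x)) +
      (ℤ.+ 6 / 1) * (x * (1ℚ - x) + ½) ≡ ℤ.+ 6 / 1
    upper = solve-∀ ring

  -- On [0 , ¼], [¼ , ½] and [½ , 1] the argument of D + i v is read off v / D, u / v and
  -- v / u, where u = - D, so that no denominator vanishes. At ¼ and ½ its tangent is 3
  -- and -1.
  module _ (n K : ℕ) where

    -- Whichever quotient represents the tangent, M² + N² is 1 - 8y and the Wronskian is the weight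
    -- up to κ. The factor κ is 3/2 for v / D and for u / v, the tangent of the argument less π/2.
    -- It is - 3/2 for v / u, the tangent of π less the argument.
    piece : ∀ κ {a b d} {N N′ M M′ : ℚ → ℚ} → a ∈[ 0ℚ , 1ℚ ] → b ∈[ 0ℚ , 1ℚ ] → a ≤ b →
      0ℚ < d → (∀ {s} → s ∈[ a , b ] → d ≤ M s) →
      Diff a b N N′ → Diff a b M M′ → (∀ {s} → s ∈[ a , b ] → (- 4ℚ * M s ≤ N s) × (N s ≤ 4ℚ * M s)) →
      (∀ s → κ * (N′ s * M s - N s * M′ s) ≡ weight (ℤ.+ 8 / 1) 3ℚ 0ℚ 3ℚ s) →
      (∀ s → M s * M s + N s * N s ≡ 1ℚ - (ℤ.+ 8 / 1) * x[1-x]³ s) →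
      ∣ (F₂ n b - F₂ n a) - (κ * arctan K (N b * recip (M b)) - κ * arctan K (N a * recip (M a))) ∣ ≤
        Q₂ * (ρ ^ n + ρ ^ K) * (b - a)
    piece κ {N = N} {N′} {M} {M′} a∈@(0≤a , _) b∈@(_ , b≤1) a≤b 0<d d≤M diff-N diff-M range e₁ e₂ =
      primitive-compare a≤b (primitive-restrict a∈ b∈ (F₂-primitive n))
        (primitive-cong
          (λ {s} _ → trans (sym (*-assoc κ (N′ s * M s - N s * M′ s) (recip (M s * M s + N s * N s))))
            (cong₂ (λ x y → x * recip y) (e₁ s) (e₂ s)))
          (primitive-scale κ (arctan-quotient (arctan-primitive K) 0<d d≤M diff-N diff-M range)))
        (λ { (a≤s , s≤b) → integrand₂-bound (≤-trans 0≤a a≤s , ≤-trans s≤b b≤1) })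

    0≤¼ : 0ℚ ≤ ℤ.+ 1 / 4
    0≤¼ = nonNegative⁻¹ (ℤ.+ 1 / 4)
    ¼≤½ : ℤ.+ 1 / 4 ≤ ½
    ¼≤½ = ≤ᵇ⇒≤ _
    ½≤1 : ½ ≤ 1ℚ
    ½≤1 = ≤ᵇ⇒≤ _

    1½ : ℚ
    1½ = ℤ.+ 3 / 2

    piece₁ : ∣ (F₂ n (ℤ.+ 1 / 4) - F₂ n 0ℚ) - (1½ * arctan K 3ℚ - 1½ * arctan K 0ℚ) ∣ ≤
             Q₂ * (ρ ^ n + ρ ^ K) * (ℤ.+ 1 / 4 - 0ℚ)
    piece₁ = piece 1½ {N = v} {v′} {D} {D′} (≤-refl , ≤-trans 0≤¼ (≤-trans ¼≤½ ½≤1)) (0≤¼ , ≤-trans ¼≤½ ½≤1) 0≤¼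
      -- D decreases on [0 , ¼], with minimum D ¼ = 1/8. The certificates expand each polynomial in
      -- powers of ¼ - s.
      (positive⁻¹ (ℤ.+ 1 / 8))
      (λ {s} (_ , s≤¼) → let 0≤t = p≤q⇒0≤q-p s≤¼ in
        ≤-by (0≤* 0≤t (0≤+ (0≤* 0≤2 0≤t) (nonNegative⁻¹ 3ℚ))) (D-bound s))
      (diff-quadratic 0ℚ 2ℚ (- 2ℚ)) (diff-quadratic 1ℚ (- 4ℚ) 2ℚ)
      (λ {s} (0≤s , s≤¼) → let 0≤t = p≤q⇒0≤q-p s≤¼ in
        ≤-by (0≤+ (0≤* 0≤t (0≤+ (0≤* (nonNegative⁻¹ (ℤ.+ 6 / 1)) 0≤t) (nonNegative⁻¹ (ℤ.+ 11 / 1))))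
          (nonNegative⁻¹ (ℤ.+ 7 / 8))) (lower s) ,
        ≤-by (0≤+ (0≤* 0≤t (0≤+ (0≤* (nonNegative⁻¹ (ℤ.+ 10 / 1)) 0≤t) (nonNegative⁻¹ (ℤ.+ 13 / 1))))
          (nonNegative⁻¹ (ℤ.+ 1 / 8))) (upper s))
      wronskian norm
      where
      0≤2 = nonNegative⁻¹ 2ℚ
      D-bound : ∀ s → ℤ.+ 1 / 8 + (ℤ.+ 1 / 4 - s) * (2ℚ * (ℤ.+ 1 / 4 - s) + 3ℚ) ≡ 1ℚ + s * (- 4ℚ + s * 2ℚ)
      D-bound = solve-∀ ring
      lower : ∀ s → - 4ℚ * (1ℚ + s * (- 4ℚ + s * 2ℚ)) +
        ((ℤ.+ 1 / 4 - s) * ((ℤ.+ 6 / 1) * (ℤ.+ 1 / 4 - s) + ℤ.+ 11 / 1) + ℤ.+ 7 / 8) ≡ 0ℚ +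
        s * (2ℚ + s * (- 2ℚ))
      lower = solve-∀ ring
      upper : ∀ s → 0ℚ + s * (2ℚ + s * (- 2ℚ)) +
        ((ℤ.+ 1 / 4 - s) * ((ℤ.+ 10 / 1) * (ℤ.+ 1 / 4 - s) + ℤ.+ 13 / 1) + ℤ.+ 1 / 8) ≡
        4ℚ * (1ℚ + s * (- 4ℚ + s * 2ℚ))
      upper = solve-∀ ring
      wronskian : ∀ s → (ℤ.+ 3 / 2) * ((2ℚ + s * (- 2ℚ + - 2ℚ)) * (1ℚ + s * (- 4ℚ + s * 2ℚ)) -
        (0ℚ + s * (2ℚ + s * (- 2ℚ))) * (- 4ℚ + s * (2ℚ + 2ℚ))) ≡
        3ℚ * (s * s) + 0ℚ * (s * (1ℚ - s)) + 3ℚ * ((1ℚ - s) * (1ℚ - s))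
      wronskian = solve-∀ ring
      norm : ∀ s → (1ℚ + s * (- 4ℚ + s * 2ℚ)) * (1ℚ + s * (- 4ℚ + s * 2ℚ)) +
        (0ℚ + s * (2ℚ + s * (- 2ℚ))) * (0ℚ + s * (2ℚ + s * (- 2ℚ))) ≡
        1ℚ - (ℤ.+ 8 / 1) * (s * ((1ℚ - s) * ((1ℚ - s) * (1ℚ - s))))
      norm = solve-∀ ring

    piece₂ : ∣ (F₂ n ½ - F₂ n (ℤ.+ 1 / 4)) - (1½ * arctan K 1ℚ - 1½ * arctan K (- (ℤ.+ 1 / 3))) ∣ ≤
             Q₂ * (ρ ^ n + ρ ^ K) * (½ - ℤ.+ 1 / 4)
    piece₂ = piece 1½ {N = u} {u′} {v} {v′} (0≤¼ , ≤-trans ¼≤½ ½≤1) (≤-trans 0≤¼ ¼≤½ , ½≤1) ¼≤½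
      -- v increases up to ½, so its minimum on [¼ , ½] is v ¼ = 3/8.
      (positive⁻¹ (ℤ.+ 3 / 8))
      (λ {s} (¼≤s , s≤½) → let 0≤t = p≤q⇒0≤q-p ¼≤s in
        ≤-by (0≤* 0≤t (0≤+ (0≤* 0≤2 (p≤q⇒0≤q-p s≤½)) (nonNegative⁻¹ ½))) (v-bound s))
      (diff-quadratic (- 1ℚ) 4ℚ (- 2ℚ)) (diff-quadratic 0ℚ 2ℚ (- 2ℚ))
      (λ {s} (¼≤s , s≤½) → let 0≤t = p≤q⇒0≤q-p ¼≤s in
        ≤-by (0≤+ (0≤* 0≤t (0≤+ (0≤* (nonNegative⁻¹ (ℤ.+ 10 / 1)) (p≤q⇒0≤q-p s≤½))
          (nonNegative⁻¹ (ℤ.+ 9 / 2)))) (nonNegative⁻¹ (ℤ.+ 11 / 8))) (lower s) ,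
        ≤-by (0≤+ (0≤* (0≤+ (0≤* (nonNegative⁻¹ (ℤ.+ 6 / 1)) 0≤t) (nonNegative⁻¹ ½)) (p≤q⇒0≤q-p s≤½))
          (nonNegative⁻¹ (ℤ.+ 3 / 2))) (upper s))
      wronskian norm
      where
      0≤2 = nonNegative⁻¹ 2ℚ
      v-bound : ∀ s → ℤ.+ 3 / 8 + (s - ℤ.+ 1 / 4) * (2ℚ * (½ - s) + ½) ≡ 0ℚ + s * (2ℚ + s * (- 2ℚ))
      v-bound = solve-∀ ring
      lower : ∀ s → - 4ℚ * (0ℚ + s * (2ℚ + s * (- 2ℚ))) +
        ((s - ℤ.+ 1 / 4) * ((ℤ.+ 10 / 1) * (½ - s) + ℤ.+ 9 / 2) + ℤ.+ 11 / 8) ≡ - 1ℚ + s * (4ℚ + s * (- 2ℚ))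
      lower = solve-∀ ring
      upper : ∀ s → - 1ℚ + s * (4ℚ + s * (- 2ℚ)) +
        (((ℤ.+ 6 / 1) * (s - ℤ.+ 1 / 4) + ½) * (½ - s) + ℤ.+ 3 / 2) ≡ 4ℚ * (0ℚ + s * (2ℚ + s * (- 2ℚ)))
      upper = solve-∀ ring
      wronskian : ∀ s → (ℤ.+ 3 / 2) * ((4ℚ + s * (- 2ℚ + - 2ℚ)) * (0ℚ + s * (2ℚ + s * (- 2ℚ))) -
        (- 1ℚ + s * (4ℚ + s * (- 2ℚ))) * (2ℚ + s * (- 2ℚ + - 2ℚ))) ≡
        3ℚ * (s * s) + 0ℚ * (s * (1ℚ - s)) + 3ℚ * ((1ℚ - s) * (1ℚ - s))
      wronskian = solve-∀ ring
      norm : ∀ s → (0ℚ + s * (2ℚ + s * (- 2ℚ))) * (0ℚ + s * (2ℚ + s * (- 2ℚ))) +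
        (- 1ℚ + s * (4ℚ + s * (- 2ℚ))) * (- 1ℚ + s * (4ℚ + s * (- 2ℚ))) ≡
        1ℚ - (ℤ.+ 8 / 1) * (s * ((1ℚ - s) * ((1ℚ - s) * (1ℚ - s))))
      norm = solve-∀ ring

    piece₃ : ∣ (F₂ n 1ℚ - F₂ n ½) - (- 1½ * arctan K 0ℚ - - 1½ * arctan K 1ℚ) ∣ ≤
             Q₂ * (ρ ^ n + ρ ^ K) * (1ℚ - ½)
    piece₃ = piece (- 1½) {N = v} {v′} {u} {u′} (≤-trans 0≤¼ ¼≤½ , ½≤1)
      (≤-trans 0≤¼ (≤-trans ¼≤½ ½≤1) , ≤-refl) ½≤1
      -- u increases on [½ , 1], and u ½ = ½.
      (positive⁻¹ ½)
      (λ {s} (½≤s , s≤1) → let 0≤t = p≤q⇒0≤q-p ½≤s in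
        ≤-by (0≤* 0≤t (0≤+ (0≤* 0≤2 (p≤q⇒0≤q-p s≤1)) (nonNegative⁻¹ 1ℚ))) (u-bound s))
      (diff-quadratic 0ℚ 2ℚ (- 2ℚ)) (diff-quadratic (- 1ℚ) 4ℚ (- 2ℚ))
      (λ {s} (½≤s , s≤1) → let 0≤t = p≤q⇒0≤q-p ½≤s in
        ≤-by (0≤+ (0≤* 0≤t (0≤+ (0≤* (nonNegative⁻¹ (ℤ.+ 10 / 1)) (p≤q⇒0≤q-p s≤1)) (nonNegative⁻¹ 3ℚ)))
          (nonNegative⁻¹ (ℤ.+ 5 / 2))) (lower s) ,
        ≤-by (0≤+ (0≤* 0≤t (0≤+ (0≤* (nonNegative⁻¹ (ℤ.+ 6 / 1)) (p≤q⇒0≤q-p s≤1))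
          (nonNegative⁻¹ (ℤ.+ 5 / 1)))) (nonNegative⁻¹ (ℤ.+ 3 / 2))) (upper s))
      wronskian norm
      where
      0≤2 = nonNegative⁻¹ 2ℚ
      u-bound : ∀ s → ½ + (s - ½) * (2ℚ * (1ℚ - s) + 1ℚ) ≡ - 1ℚ + s * (4ℚ + s * (- 2ℚ))
      u-bound = solve-∀ ring
      lower : ∀ s → - 4ℚ * (- 1ℚ + s * (4ℚ + s * (- 2ℚ))) +
        ((s - ½) * ((ℤ.+ 10 / 1) * (1ℚ - s) + 3ℚ) + ℤ.+ 5 / 2) ≡ 0ℚ + s * (2ℚ + s * (- 2ℚ))
      lower = solve-∀ ring
      upper : ∀ s → 0ℚ + s * (2ℚ + s * (- 2ℚ)) +
        ((s - ½) * ((ℤ.+ 6 / 1) * (1ℚ - s) + ℤ.+ 5 / 1) + ℤ.+ 3 / 2) ≡ 4ℚ * (- 1ℚ + s * (4ℚ + s * (- 2ℚ)))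
      upper = solve-∀ ring
      wronskian : ∀ s → - (ℤ.+ 3 / 2) * ((2ℚ + s * (- 2ℚ + - 2ℚ)) * (- 1ℚ + s * (4ℚ + s * (- 2ℚ))) -
        (0ℚ + s * (2ℚ + s * (- 2ℚ))) * (4ℚ + s * (- 2ℚ + - 2ℚ))) ≡
        3ℚ * (s * s) + 0ℚ * (s * (1ℚ - s)) + 3ℚ * ((1ℚ - s) * (1ℚ - s))
      wronskian = solve-∀ ring
      norm : ∀ s → (- 1ℚ + s * (4ℚ + s * (- 2ℚ))) * (- 1ℚ + s * (4ℚ + s * (- 2ℚ))) +
        (0ℚ + s * (2ℚ + s * (- 2ℚ))) * (0ℚ + s * (2ℚ + s * (- 2ℚ))) ≡
        1ℚ - (ℤ.+ 8 / 1) * (s * ((1ℚ - s) * ((1ℚ - s) * (1ℚ - s))))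
      norm = solve-∀ ring

    -- The pieces leave the values at 3 and ⅓ behind; s ↦ 1 / s on [1 , 3] trades their sum for 2
    -- arctan 1.
    arctan-inversion : ∣ (arctan K 3ℚ - arctan K 1ℚ) + (arctan K (ℤ.+ 1 / 3) - arctan K 1ℚ) ∣ ≤
                       1ℚ * (ρ ^ K + ρ ^ K) * (3ℚ - 1ℚ)
    arctan-inversion = inversion 1ℚ 1ℚ (positive⁻¹ 1ℚ)
      (primitive-cong (λ {s} _ → lemma s) (arctan-primitive K))
      (nonNegative⁻¹ 1ℚ) (positive⁻¹ 1ℚ) (≤ᵇ⇒≤ _)
      (≤ᵇ⇒≤ _ , ≤ᵇ⇒≤ _) (≤ᵇ⇒≤ _ , ≤ᵇ⇒≤ _) (≤ᵇ⇒≤ _ , ≤ᵇ⇒≤ _) (≤ᵇ⇒≤ _ , ≤ᵇ⇒≤ _)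
      where
      lemma : ∀ s → recip (1ℚ + s * s) ≡ 1ℚ * recip (1ℚ + 1ℚ * (s * s))
      lemma s = trans (cong (λ z → recip (1ℚ + z)) (sym (*-identityˡ (s * s)))) (sym (*-identityˡ _))

    F₂≈6arctan : ∣ F₂ n 1ℚ - (ℤ.+ 6 / 1) * arctan K 1ℚ ∣ ≤ (Q₂ + ℤ.+ 6 / 1) * (ρ ^ n + ρ ^ K)
    F₂≈6arctan = combine (F₂ n 0ℚ) (F₂ n (ℤ.+ 1 / 4)) (F₂ n ½) (F₂ n 1ℚ)
      (arctan K 0ℚ) (arctan K (ℤ.+ 1 / 3)) (arctan K (- (ℤ.+ 1 / 3))) (arctan K 1ℚ) (arctan K 3ℚ)
      Q₂ (ρ ^ n) (ρ ^ K) (^-nonNeg 0≤ρ n)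
      (∫partialSum-0 (ℤ.+ 8 / 1) 3ℚ 0ℚ 3ℚ n) (arctan-0 K) (arctan-odd K (ℤ.+ 1 / 3))
      piece₁ piece₂ piece₃ arctan-inversion
      where
      combine : ∀ f₀ f₁ f₂ f₃ a₀ a a₋ a₁ a₃ Q x y → 0ℚ ≤ x → f₀ ≡ 0ℚ → a₀ ≡ 0ℚ → a₋ ≡ - a →
        ∣ (f₁ - f₀) - (1½ * a₃ - 1½ * a₀) ∣ ≤ Q * (x + y) * (ℤ.+ 1 / 4 - 0ℚ) →
        ∣ (f₂ - f₁) - (1½ * a₁ - 1½ * a₋) ∣ ≤ Q * (x + y) * (½ - ℤ.+ 1 / 4) →
        ∣ (f₃ - f₂) - (- 1½ * a₀ - - 1½ * a₁) ∣ ≤ Q * (x + y) * (1ℚ - ½) →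
        ∣ (a₃ - a₁) + (a - a₁) ∣ ≤ 1ℚ * (y + y) * (3ℚ - 1ℚ) →
        ∣ f₃ - (ℤ.+ 6 / 1) * a₁ ∣ ≤ (Q + ℤ.+ 6 / 1) * (x + y)
      combine _ f₁ f₂ f₃ _ a _ a₁ a₃ Q x y 0≤x refl refl refl h₁ h₂ h₃ h₄ = ≤-trans
        (subst (λ z → ∣ z ∣ ≤ _) (sum f₁ f₂ f₃ a a₁ a₃)
          (∣∣≤-+ (∣∣≤-+ (∣∣≤-+ h₁ h₂) h₃) (∣∣≤-* {ℤ.+ 3 / 2} ≤-refl h₄)))
        -- The lengths of the three intervals add up to 1, which gives Q (x + y); the inversion adds
        -- 6 y, and 6 x is given away for a common factor.
        (≤-by (0≤* (nonNegative⁻¹ (ℤ.+ 6 / 1)) 0≤x) (bound Q x y))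
        where
        sum : ∀ f₁ f₂ f₃ a a₁ a₃ →
          (f₁ - 0ℚ) - ((ℤ.+ 3 / 2) * a₃ - (ℤ.+ 3 / 2) * 0ℚ) +
            ((f₂ - f₁) - ((ℤ.+ 3 / 2) * a₁ - (ℤ.+ 3 / 2) * - a)) +
          ((f₃ - f₂) - (- (ℤ.+ 3 / 2) * 0ℚ - - (ℤ.+ 3 / 2) * a₁)) + (ℤ.+ 3 / 2) * ((a₃ - a₁) + (a - a₁)) ≡
          f₃ - (ℤ.+ 6 / 1) * a₁
        sum = solve-∀ ring
        bound : ∀ Q x y → Q * (x + y) * (ℤ.+ 1 / 4 - 0ℚ) + Q * (x + y) * (½ - ℤ.+ 1 / 4) +
          Q * (x + y) * (1ℚ - ½) +
          (ℤ.+ 3 / 2) * (1ℚ * (y + y) * (3ℚ - 1ℚ)) + (ℤ.+ 6 / 1) * x ≡ (Q + ℤ.+ 6 / 1) * (x + y)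
        bound = solve-∀ ring

-- The first series as an increment of arctan (√3 x)

module FirstSeries where

  open import Data.Rational.Base
  open import Data.Rational.Properties
  open import Algebra.Definitions.RawSemiring +-*-rawSemiring using (_^_)
  open import Defs using (recip)
  open Basics
  open Calculus
  open Limits
  open Antiderivative
  open Arctan
  open Beta
  open Series
  open Substitution

  private
    variable
      a b ε : ℚ
      F h k : ℚ → ℚ

  -- Relative errors multiply: (1 - d) (1 - e) = 1 - (e + d - e d), whence the cross term ε δ in the
  -- new bound.
  primitive-perturb : ∀ {δ} (d : ℚ → ℚ) → (∀ {s} → s ∈[ a , b ] → h s ≡ k s * (1ℚ - d s)) →
    (∀ {s} → s ∈[ a , b ] → ∣ d s ∣ ≤ δ) → Primitive ε a b F h → Primitive (ε + δ + ε * δ) a b F k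
  primitive-perturb {h = h} {k = k} d e d≤δ P = record
    { err  = λ s → err s + d s - err s * d s
    ; diff = Primitive.diff P
    ; F′≡  = λ {s} s∈ → trans (Primitive.F′≡ P s∈)
      (trans (cong (_* (1ℚ - err s)) (e s∈)) (lemma (k s) (d s) (err s)))
    ; err≤ = λ s∈ → ∣∣≤-- (∣∣≤-+ (Primitive.err≤ P s∈) (d≤δ s∈)) (∣∣≤-* (Primitive.err≤ P s∈) (d≤δ s∈))
    }
    where
    err = Primitive.err P
    lemma : ∀ k d x → k * (1ℚ - d) * (1ℚ - x) ≡ k * (1ℚ - (x + d - x * d))
    lemma = solve-∀ ring

  0<3 : 0ℚ < 3ℚ
  0<3 = positive⁻¹ 3ℚ

  6ℚ : ℚ
  6ℚ = ℤ.+ 6 / 1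

  ⅓ : ℚ
  ⅓ = ℤ.+ 1 / 3

  F₁ : ℕ → ℚ → ℚ
  F₁ = ∫partialSum (ℤ.+ 9 / 8) (ℤ.+ 3 / 2) (ℤ.+ 21 / 4) 6ℚ

  F₁′ : ℚ → ℚ
  F₁′ = lorentzian 3ℚ 6ℚ 0<3

  -- The quartic 1 - (9/8) x (1 - x)³ has the rational factor 1 + 3 x², and the weight is 6 times
  -- the complementary quadratic factor, so it cancels.
  F₁-primitive : ∀ n → Primitive (ρ ^ n) 0ℚ 1ℚ (F₁ n) F₁′
  F₁-primitive n = primitive-cong
    (λ {s} s∈ → trans (*-comm (weight (ℤ.+ 9 / 8) (ℤ.+ 3 / 2) (ℤ.+ 21 / 4) 6ℚ s)
      (recip (1ℚ - (ℤ.+ 9 / 8) * x[1-x]³ s)))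
      (recip-transfer (1ℚ + 3ℚ * (s * s)) (1ℚ - (ℤ.+ 9 / 8) * x[1-x]³ s)
        (weight (ℤ.+ 9 / 8) (ℤ.+ 3 / 2) (ℤ.+ 21 / 4) 6ℚ s) 6ℚ
        (0<1+c*s² 3ℚ 6ℚ 0<3 s)
        (<-≤-trans 0<ν (ν≤1-z*x[1-x]³ (ℤ.+ 9 / 8) (ℤ.+ 3 / 2) (ℤ.+ 21 / 4) 6ℚ 0≤z z≤8 s∈))
        (factorisation s)))
    (∫partialSum-primitive (ℤ.+ 9 / 8) (ℤ.+ 3 / 2) (ℤ.+ 21 / 4) 6ℚ 0≤z z≤8 n)
    where
    0≤z = nonNegative⁻¹ (ℤ.+ 9 / 8)
    z≤8 : ℤ.+ 9 / 8 ≤ ℤ.+ 8 / 1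
    z≤8 = ≤ᵇ⇒≤ _
    factorisation : ∀ s →
      ((ℤ.+ 3 / 2) * (s * s) + (ℤ.+ 21 / 4) * (s * (1ℚ - s)) + (ℤ.+ 6 / 1) * ((1ℚ - s) * (1ℚ - s))) *
        (1ℚ + 3ℚ * (s * s)) ≡
      (ℤ.+ 6 / 1) * (1ℚ - (ℤ.+ 9 / 8) * (s * ((1ℚ - s) * ((1ℚ - s) * (1ℚ - s)))))
    factorisation = solve-∀ ring

  -- Up to a constant F₁ is arctan (√3 x): the values at 1, ⅓ and 1/√3 are those of the
  -- angles π/3, π/6 and π/4. A rational r near √3 gives R = 1/r and r/3 near 1/√3.
  module _ (n : ℕ) where

    -- The substitution 2s / (1 - 3 s²) is the duplication formula of the tangent with √3 scaled
    -- out. It maps ⅓ to 1, and its pole 1/√3 lies beyond ⅓.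
    F₁-doubling : ∣ (F₁ n 1ℚ - F₁ n 0ℚ) - (2ℚ * F₁ n ⅓ - 2ℚ * F₁ n 0ℚ) ∣ ≤ 2ℚ * 6ℚ * (ρ ^ n + ρ ^ n) * (⅓ - 0ℚ)
    F₁-doubling = primitive-compare (nonNegative⁻¹ ⅓) doubled
      (primitive-scale 2ℚ (primitive-restrict (≤-refl , nonNegative⁻¹ 1ℚ) (nonNegative⁻¹ ⅓ , ≤ᵇ⇒≤ _)
        (F₁-primitive n)))
      (λ {s} _ → ∣∣≤-* {2ℚ} ≤-refl (lorentzian-bound 3ℚ 6ℚ 0<3 (nonNegative⁻¹ 6ℚ) s))
      where
      M : ℚ → ℚ
      M s = 1ℚ + s * (0ℚ + s * - 3ℚ)
      ⅔ : ℚ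
      ⅔ = ℤ.+ 2 / 3
      0<⅔ : 0ℚ < ⅔
      0<⅔ = positive⁻¹ ⅔
      ⅔≤M : ∀ {s} → s ∈[ 0ℚ , ⅓ ] → ⅔ ≤ M s
      ⅔≤M {s} (0≤s , s≤⅓) = ≤-by (0≤* (0≤* (<⇒≤ 0<3) (p≤q⇒0≤q-p s≤⅓)) (0≤+ 0≤s (nonNegative⁻¹ ⅓))) (lemma s)
        where
        lemma : ∀ s → ℤ.+ 2 / 3 + 3ℚ * (ℤ.+ 1 / 3 - s) * (s + ℤ.+ 1 / 3) ≡ 1ℚ + s * (0ℚ + s * - 3ℚ)
        lemma = solve-∀ ring
      range : ∀ {s} → s ∈[ 0ℚ , ⅓ ] → (2ℚ * s * recip (M s)) ∈[ 0ℚ , 1ℚ ]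
      range {s} s∈@(0≤s , s≤⅓) = 0≤* (0≤* (nonNegative⁻¹ 2ℚ) 0≤s) (<⇒≤ (0<recip 0<M)) ,
        *recip≤ {n = 2ℚ * s} 0<M (≤-by (0≤* (0≤* (<⇒≤ 0<3) (p≤q⇒0≤q-p s≤⅓))
          (0≤+ 0≤s (nonNegative⁻¹ 1ℚ))) (lemma s))
        where
        0<M = <-≤-trans 0<⅔ (⅔≤M s∈)
        lemma : ∀ s → 2ℚ * s + 3ℚ * (ℤ.+ 1 / 3 - s) * (s + 1ℚ) ≡ 1ℚ * (1ℚ + s * (0ℚ + s * - 3ℚ))
        lemma = solve-∀ ring
      identity : ∀ s R → (2ℚ * 1ℚ * R - 2ℚ * s * (0ℚ + s * (- 3ℚ + - 3ℚ)) * (R * R)) * (1ℚ + 3ℚ * (s * s)) ≡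
        2ℚ * (1ℚ + 3ℚ * (2ℚ * s * R * (2ℚ * s * R))) +
        (2ℚ - (ℤ.+ 12 / 1) * (s * s * R)) * (R * (1ℚ + s * (0ℚ + s * - 3ℚ)) - 1ℚ)
      identity = solve-∀ ring
      rearrange : ∀ k X m → k * X * m ≡ k * (X * m)
      rearrange = solve-∀ ring
      rearrange′ : ∀ k X → k * (2ℚ * X) ≡ 2ℚ * (k * X)
      rearrange′ = solve-∀ ring
      doubled : Primitive (ρ ^ n) 0ℚ ⅓ (λ s → F₁ n (2ℚ * s * recip (M s))) (λ s → 2ℚ * F₁′ s)
      doubled = primitive-cong
        (λ {s} s∈ → let R = recip (M s) ; σ = 2ℚ * s * R in
          trans (rearrange 6ℚ (recip (1ℚ + 3ℚ * (σ * σ)))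
            (2ℚ * 1ℚ * R - 2ℚ * s * (0ℚ + s * (- 3ℚ + - 3ℚ)) * (R * R)))
            (trans (cong (6ℚ *_) (recip-transfer (1ℚ + 3ℚ * (s * s)) (1ℚ + 3ℚ * (σ * σ))
                (2ℚ * 1ℚ * R - 2ℚ * s * (0ℚ + s * (- 3ℚ + - 3ℚ)) * (R * R)) 2ℚ
                (0<1+c*s² 3ℚ 6ℚ 0<3 s) (0<1+c*s² 3ℚ 6ℚ 0<3 σ)
                (≡-by₁ (2ℚ - (ℤ.+ 12 / 1) * (s * s * R)) (recip-inverseˡ (<-≤-trans 0<⅔ (⅔≤M s∈)))
                  (identity s R))))
              (rearrange′ 6ℚ (recip (1ℚ + 3ℚ * (s * s))))))
        (primitive-∘ (F₁-primitive n)
          (diff-quotient 0<⅔ ⅔≤M (diff-scale 2ℚ diff-id) (diff-quadratic 1ℚ 0ℚ (- 3ℚ))) range)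

    -- If 3 τ² were 1, s ↦ τ s would turn 6 ds / (1 + 3 s²) into 6 τ ds / (1 + s²). For rational τ
    -- the quotient of the two integrands is 1 - δ s, where δ s is 3 τ² - 1 times a factor between 0
    -- and 1: a relative error of at most η.
    F₁-scaling : ∀ K τ {η} → τ ∈[ 0ℚ , 1ℚ ] → ∣ 3ℚ * (τ * τ) - 1ℚ ∣ ≤ η →
      ∣ (F₁ n τ - F₁ n 0ℚ) - (6ℚ * τ * arctan K 1ℚ - 6ℚ * τ * arctan K 0ℚ) ∣ ≤
        6ℚ * (ρ ^ n + η + ρ ^ n * η + ρ ^ K) * (1ℚ - 0ℚ)
    F₁-scaling K τ {η} (0≤τ , τ≤1) h = subst₂
      (λ x y → ∣ (F₁ n x - F₁ n y) - (6ℚ * τ * arctan K 1ℚ - 6ℚ * τ * arctan K 0ℚ) ∣ ≤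
        6ℚ * (ρ ^ n + η + ρ ^ n * η + ρ ^ K) * (1ℚ - 0ℚ))
      (*-identityʳ τ) (*-zeroʳ τ)
      (primitive-compare (nonNegative⁻¹ 1ℚ) scaled
        (primitive-scale (6ℚ * τ) (primitive-restrict (≤ᵇ⇒≤ _ , ≤ᵇ⇒≤ _) (≤ᵇ⇒≤ _ , ≤ᵇ⇒≤ _) (arctan-primitive K)))
        (λ {s} _ → bound s))
      where
      bound : ∀ s → ∣ 6ℚ * τ * recip (1ℚ + s * s) ∣ ≤ 6ℚ
      bound s = 0≤p≤q⇒∣p∣≤q (0≤* (0≤* (nonNegative⁻¹ 6ℚ) 0≤τ) (<⇒≤ (0<recip (0<1+p² s))))
        (*recip≤ {n = 6ℚ * τ} (0<1+p² s)
          (≤-by (0≤+ (0≤* (nonNegative⁻¹ 6ℚ) (p≤q⇒0≤q-p τ≤1)) (0≤* (nonNegative⁻¹ 6ℚ) (0≤p² s))) (lemma τ s)))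
        where
        lemma : ∀ τ s → (ℤ.+ 6 / 1) * τ + ((ℤ.+ 6 / 1) * (1ℚ - τ) + (ℤ.+ 6 / 1) * (s * s)) ≡
          (ℤ.+ 6 / 1) * (1ℚ + s * s)
        lemma = solve-∀ ring
      δ : ℚ → ℚ
      δ s = (3ℚ * (τ * τ) - 1ℚ) * (s * s * recip (1ℚ + 3ℚ * (τ * s * (τ * s))))
      δ≤η : ∀ {s} → s ∈[ 0ℚ , 1ℚ ] → ∣ δ s ∣ ≤ η
      δ≤η {s} (0≤s , s≤1) = subst (∣ δ s ∣ ≤_) (*-identityʳ η) (∣∣≤-* h
        (0≤p≤q⇒∣p∣≤q (0≤* (0≤p² s) (<⇒≤ (0<recip (0<1+c*s² 3ℚ 6ℚ 0<3 (τ * s)))))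
          (*recip≤ {n = s * s} (0<1+c*s² 3ℚ 6ℚ 0<3 (τ * s))
            (≤-by (0≤+ (0≤* (p≤q⇒0≤q-p s≤1) (0≤+ (nonNegative⁻¹ 1ℚ) 0≤s)) (0≤* (<⇒≤ 0<3) (0≤p² (τ * s))))
              (lemma s (τ * s))))))
        where
        lemma : ∀ s x → s * s + ((1ℚ - s) * (1ℚ + s) + 3ℚ * (x * x)) ≡ 1ℚ * (1ℚ + 3ℚ * (x * x))
        lemma = solve-∀ ring
      identity : ∀ k τ s X Y → k * Y * (τ * 1ℚ) ≡
        k * τ * X * (1ℚ - (3ℚ * (τ * τ) - 1ℚ) * (s * s * Y)) +
        - (k * τ * Y) * (X * (1ℚ + s * s) - 1ℚ) + k * τ * X * (Y * (1ℚ + 3ℚ * (τ * s * (τ * s))) - 1ℚ)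
      identity = solve-∀ ring
      scaled : Primitive (ρ ^ n + η + ρ ^ n * η) 0ℚ 1ℚ (λ s → F₁ n (τ * s)) (λ s → 6ℚ * τ * recip (1ℚ + s * s))
      scaled = primitive-perturb δ
        (λ {s} _ → let X = recip (1ℚ + s * s) ; Y = recip (1ℚ + 3ℚ * (τ * s * (τ * s))) in
          ≡-by₂ (- (6ℚ * τ * Y)) (6ℚ * τ * X) (recip-inverseˡ (0<1+p² s))
            (recip-inverseˡ (0<1+c*s² 3ℚ 6ℚ 0<3 (τ * s)))
            (identity 6ℚ τ s X Y))
        δ≤η
        (primitive-∘ (F₁-primitive n) (diff-scale τ diff-id)
          (λ (0≤s , s≤1) → 0≤* 0≤τ 0≤s , *-mono-≤ 0≤τ 0≤s τ≤1 s≤1))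

  ^≤1 : ∀ {x} → 0ℚ ≤ x → x ≤ 1ℚ → ∀ n → x ^ n ≤ 1ℚ
  ^≤1 0≤x x≤1 zero    = ≤-refl
  ^≤1 0≤x x≤1 (suc n) = *-mono-≤ 0≤x (^-nonNeg 0≤x n) x≤1 (^≤1 0≤x x≤1 n)

  0≤ρ^≤1 : ∀ n → 0ℚ ≤ ρ ^ n × ρ ^ n ≤ 1ℚ
  0≤ρ^≤1 n = ^-nonNeg 0≤ρ n , ^≤1 0≤ρ (<⇒≤ ρ<1) n

  -- A bound uniform in K for the factor by which the defect r² - 3 gets multiplied: the exact
  -- derivative and the relative error are both at most 1.
  arctan-1-bound : ∀ K → ∣ arctan K 1ℚ ∣ ≤ 2ℚ
  arctan-1-bound K = subst (λ x → ∣ x ∣ ≤ 2ℚ)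
    (trans (cong (λ x → arctan K 1ℚ - x) (arctan-0 K)) (+-identityʳ (arctan K 1ℚ)))
    (increment≤ {a = 0ℚ} {b = 1ℚ} {ε = 2ℚ} (nonNegative⁻¹ 1ℚ) (Primitive.diff P) (λ {s} s∈ →
      subst (λ z → ∣ z ∣ ≤ 1ℚ * (1ℚ + 1ℚ)) (sym (Primitive.F′≡ P s∈))
        (∣∣≤-* (0≤p≤q⇒∣p∣≤q (<⇒≤ (0<recip (0<1+p² s)))
          (≤-trans (recip-anti-≤ (positive⁻¹ 1ℚ) (≤-by (0≤p² s) refl)) ≤-refl))
          (∣∣≤-- ≤-refl (≤-trans (Primitive.err≤ P s∈) (proj₂ (0≤ρ^≤1 K)))))))
    where
    P = primitive-restrict {c = 0ℚ} {d = 1ℚ} (≤ᵇ⇒≤ _ , ≤ᵇ⇒≤ _) (≤ᵇ⇒≤ _ , ≤ᵇ⇒≤ _) (arctan-primitive K)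

  module _ (n K : ℕ) (r : ℚ) (1≤r : 1ℚ ≤ r) (r≤3 : r ≤ 3ℚ) where

    private

      0<r : 0ℚ < r
      0<r = <-≤-trans (positive⁻¹ 1ℚ) 1≤r

      R : ℚ
      R = recip r

      R*r≡1 : R * r ≡ 1ℚ
      R*r≡1 = recip-inverseˡ 0<r

      0≤R : 0ℚ ≤ R
      0≤R = <⇒≤ (0<recip 0<r)

      R≤1 : R ≤ 1ℚ
      R≤1 = recip-anti-≤ (positive⁻¹ 1ℚ) 1≤r

      ⅓≤R : ⅓ ≤ R
      ⅓≤R = recip-anti-≤ 0<r r≤3

      η : ℚ
      η = ∣ r * r - 3ℚ ∣

      0≤⅓r : 0ℚ ≤ ⅓ * r
      0≤⅓r = 0≤* (nonNegative⁻¹ ⅓) (<⇒≤ 0<r)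

      ⅓r≤1 : ⅓ * r ≤ 1ℚ
      ⅓r≤1 = *-mono-≤ˡ (nonNegative⁻¹ ⅓) r≤3

      recip-3R : recip (3ℚ * R) ≡ ⅓ * r
      recip-3R = *-cancelʳ-≡ (3ℚ * R) 0<3R (trans (recip-inverseˡ 0<3R)
        (sym (≡-by₁ 1ℚ R*r≡1 (lemma r R))))
        where
        0<3R = 0<* 0<3 (0<recip 0<r)
        lemma : ∀ r R → ℤ.+ 1 / 3 * r * (3ℚ * R) ≡ 1ℚ + 1ℚ * (R * r - 1ℚ)
        lemma = solve-∀ ring

      F₁-inversion : ∣ (F₁ n R - F₁ n ⅓) + (F₁ n (⅓ * r) - F₁ n 1ℚ) ∣ ≤ 6ℚ * (ρ ^ n + ρ ^ n) * (R - ⅓)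
      F₁-inversion = subst (λ x → ∣ (F₁ n R - F₁ n ⅓) + (F₁ n x - F₁ n 1ℚ) ∣ ≤
        6ℚ * (ρ ^ n + ρ ^ n) * (R - ⅓)) recip-3R
        (inversion 3ℚ 6ℚ 0<3 (F₁-primitive n) (nonNegative⁻¹ 6ℚ) (positive⁻¹ ⅓) ⅓≤R
          (≤ᵇ⇒≤ _ , ≤ᵇ⇒≤ _) (0≤R , R≤1)
          (subst (_∈[ 0ℚ , 1ℚ ]) (sym recip-3R) (0≤⅓r , ⅓r≤1)) (≤ᵇ⇒≤ _ , ≤ᵇ⇒≤ _))

      scaling-R : ∣ 3ℚ * (R * R) - 1ℚ ∣ ≤ η
      scaling-R = subst₂ _≤_
        (cong ∣_∣ (≡-by₁ (- (R * r + 1ℚ)) R*r≡1 (lemma r R))) (*-identityʳ η)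
        (∣∣≤-* (∣∣≤-neg {r * r - 3ℚ} ≤-refl) (0≤p≤q⇒∣p∣≤q (0≤* 0≤R 0≤R) (*-mono-≤ 0≤R 0≤R R≤1 R≤1)))
        where
        lemma : ∀ r R → - (r * r - 3ℚ) * (R * R) ≡ 3ℚ * (R * R) - 1ℚ + - (R * r + 1ℚ) * (R * r - 1ℚ)
        lemma = solve-∀ ring

      scaling-⅓r : ∣ 3ℚ * (⅓ * r * (⅓ * r)) - 1ℚ ∣ ≤ η
      scaling-⅓r = subst₂ _≤_ (cong ∣_∣ (lemma r)) (*-identityʳ η)
        (∣∣≤-* {r * r - 3ℚ} {η} {⅓} ≤-refl (≤ᵇ⇒≤ _))
        where
        lemma : ∀ r → (r * r - 3ℚ) * (ℤ.+ 1 / 3) ≡ 3ℚ * (ℤ.+ 1 / 3 * r * (ℤ.+ 1 / 3 * r)) - 1ℚ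
        lemma = solve-∀ ring

    -- With a = arctan 1, R = 1 / r and F₁ 0 = 0, inversion on [⅓ , R] gives F₁ 1 + F₁ ⅓ ≈ F₁ R + F₁
    -- (r / 3). The left side is (3/2) F₁ 1 by duplication and the right side 6 R a + 2 r a by
    -- scaling. As r ≈ 3 R, the latter is about 12 R a.
    F₁≈8arctan/r : ∣ F₁ n 1ℚ - (ℤ.+ 8 / 1) * arctan K 1ℚ * recip r ∣ ≤
      (ℤ.+ 19 / 1) * (ρ ^ n + ρ ^ K + ∣ r * r - 3ℚ ∣)
    F₁≈8arctan/r = combine (F₁ n 0ℚ) (F₁ n 1ℚ) (F₁ n ⅓) (F₁ n R) (F₁ n (⅓ * r)) (arctan K 0ℚ) (arctan K 1ℚ) r R
      (ρ ^ n) (ρ ^ K) η R*r≡1 0≤R R≤1 (proj₁ (0≤ρ^≤1 n)) (proj₂ (0≤ρ^≤1 n)) (proj₁ (0≤ρ^≤1 K)) ≤-refl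
      (∫partialSum-0 (ℤ.+ 9 / 8) (ℤ.+ 3 / 2) (ℤ.+ 21 / 4) 6ℚ n) (arctan-0 K) (arctan-1-bound K)
      (F₁-doubling n) F₁-inversion (F₁-scaling n K R (0≤R , R≤1) scaling-R)
      (F₁-scaling n K (⅓ * r) (0≤⅓r , ⅓r≤1) scaling-⅓r)
      where
      combine : ∀ f₀ f₁ f₃ g₁ g₂ a₀ a r R x y η → R * r ≡ 1ℚ → 0ℚ ≤ R → R ≤ 1ℚ → 0ℚ ≤ x → x ≤ 1ℚ → 0ℚ ≤ y →
        ∣ r * r - 3ℚ ∣ ≤ η → f₀ ≡ 0ℚ → a₀ ≡ 0ℚ → ∣ a ∣ ≤ 2ℚ →
        ∣ (f₁ - f₀) - (2ℚ * f₃ - 2ℚ * f₀) ∣ ≤ 2ℚ * 6ℚ * (x + x) * (⅓ - 0ℚ) →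
        ∣ (g₁ - f₃) + (g₂ - f₁) ∣ ≤ 6ℚ * (x + x) * (R - ⅓) →
        ∣ (g₁ - f₀) - (6ℚ * R * a - 6ℚ * R * a₀) ∣ ≤ 6ℚ * (x + η + x * η + y) * (1ℚ - 0ℚ) →
        ∣ (g₂ - f₀) - (6ℚ * (⅓ * r) * a - 6ℚ * (⅓ * r) * a₀) ∣ ≤ 6ℚ * (x + η + x * η + y) * (1ℚ - 0ℚ) →
        ∣ f₁ - (ℤ.+ 8 / 1) * a * R ∣ ≤ (ℤ.+ 19 / 1) * (x + y + η)
      combine _ f₁ f₃ g₁ g₂ _ a r R x y η Rr 0≤R R≤1 0≤x x≤1 0≤y r²≈3 refl refl a≤2 h₁ h₂ h₃ h₄ = ≤-trans
        (subst (λ z → ∣ z ∣ ≤ _) (≡-by₁ ((ℤ.+ 4 / 3) * a * r) Rr (sum f₁ f₃ g₁ g₂ a r R))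
          (∣∣≤-* {⅓} ≤-refl
            (∣∣≤-+ (∣∣≤-+ (∣∣≤-- h₁ (∣∣≤-* {2ℚ} ≤-refl h₂)) (∣∣≤-* {2ℚ} ≤-refl (∣∣≤-+ h₃ h₄)))
              (∣∣≤-* (∣∣≤-* {4ℚ} ≤-refl a≤2) (∣∣≤-* r²≈3 (0≤p≤q⇒∣p∣≤q 0≤R R≤1))))))
        -- With R ≤ 1 and x ≤ 1 the errors are 16 x + 8 y + (56/3) η; 19 is the largest coefficient
        -- rounded up.
        (≤-by (0≤+ (0≤* (nonNegative⁻¹ (ℤ.+ 8 / 1)) (0≤+ (0≤* 0≤x (p≤q⇒0≤q-p R≤1)) (0≤* (p≤q⇒0≤q-p x≤1) 0≤η)))
                   (0≤+ (0≤+ (0≤* (nonNegative⁻¹ 3ℚ) 0≤x) (0≤* (nonNegative⁻¹ (ℤ.+ 11 / 1)) 0≤y))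
                     (0≤* (nonNegative⁻¹ ⅓) 0≤η)))
          (bound x y η R))
        where
        0≤η = ∣∣≤⇒0≤ r²≈3
        sum : ∀ f₁ f₃ g₁ g₂ a r R →
          (ℤ.+ 1 / 3) * ((((f₁ - 0ℚ) - (2ℚ * f₃ - 2ℚ * 0ℚ)) - 2ℚ * ((g₁ - f₃) + (g₂ - f₁))) +
            2ℚ * (((g₁ - 0ℚ) - ((ℤ.+ 6 / 1) * R * a - (ℤ.+ 6 / 1) * R * 0ℚ)) +
                  ((g₂ - 0ℚ) - ((ℤ.+ 6 / 1) * (ℤ.+ 1 / 3 * r) * a - (ℤ.+ 6 / 1) * (ℤ.+ 1 / 3 * r) * 0ℚ))) +
            4ℚ * a * ((r * r - 3ℚ) * R)) ≡
          f₁ - (ℤ.+ 8 / 1) * a * R + (ℤ.+ 4 / 3) * a * r * (R * r - 1ℚ)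
        sum = solve-∀ ring
        bound : ∀ x y η R →
          (ℤ.+ 1 / 3) * (2ℚ * (ℤ.+ 6 / 1) * (x + x) * (ℤ.+ 1 / 3 - 0ℚ) +
            2ℚ * ((ℤ.+ 6 / 1) * (x + x) * (R - ℤ.+ 1 / 3)) +
            2ℚ * ((ℤ.+ 6 / 1) * (x + η + x * η + y) * (1ℚ - 0ℚ) +
              (ℤ.+ 6 / 1) * (x + η + x * η + y) * (1ℚ - 0ℚ)) +
            4ℚ * 2ℚ * (η * 1ℚ)) +
          ((ℤ.+ 8 / 1) * (x * (1ℚ - R) + (1ℚ - x) * η) + (3ℚ * x + (ℤ.+ 11 / 1) * y + (ℤ.+ 1 / 3) * η)) ≡
          (ℤ.+ 19 / 1) * (x + y + η)
        bound = solve-∀ ring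

-- Lattice points of a disk, counted by columns

module Lattice where

  open import Data.Nat.Base
  open import Data.Nat.Properties
  open import Data.Nat.Tactic.RingSolver using (solve-∀)
  open import Defs using (∑[_]_; [_≤_]; _²; latticePoints)

  [≤]≤1 : ∀ m n → [ m ≤ n ] ≤ 1
  [≤]≤1 m n with m ≤ᵇ n
  ... | true  = ≤-refl
  ... | false = z≤n

  ≤⇒[≤]≡1 : ∀ {m n} → m ≤ n → [ m ≤ n ] ≡ 1
  ≤⇒[≤]≡1 {m} {n} m≤n with m ≤ᵇ n in e
  ... | true  = refl
  ... | false = contradiction (≤⇒≤ᵇ m≤n) (subst T e)

  >⇒[≤]≡0 : ∀ {m n} → n < m → [ m ≤ n ] ≡ 0
  >⇒[≤]≡0 {m} {n} n<m with m ≤ᵇ n in e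
  ... | true  = contradiction (≤ᵇ⇒≤ m n (subst T (sym e) _)) (<⇒≱ n<m)
  ... | false = refl

  ∑-cong : ∀ n {f g} → (∀ i → f i ≡ g i) → ∑[ n ] f ≡ ∑[ n ] g
  ∑-cong zero    h = refl
  ∑-cong (suc n) h = cong₂ _+_ (h 0) (∑-cong n (λ i → h (suc i)))

  ∑-+ : ∀ n f g → ∑[ n ] (λ i → f i + g i) ≡ (∑[ n ] f) + (∑[ n ] g)
  ∑-+ zero    f g = refl
  ∑-+ (suc n) f g = trans (cong (f 0 + g 0 +_) (∑-+ n (λ i → f (suc i)) (λ i → g (suc i))))
    (lemma (f 0) (g 0) (∑[ n ] λ i → f (suc i)) (∑[ n ] λ i → g (suc i)))
    where
    lemma : ∀ a b c d → a + b + (c + d) ≡ a + c + (b + d)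
    lemma = solve-∀

  ∑-split : ∀ m n f → ∑[ m + n ] f ≡ (∑[ m ] f) + (∑[ n ] λ i → f (m + i))
  ∑-split zero    n f = refl
  ∑-split (suc m) n f = trans (cong (f 0 +_) (∑-split m n (λ i → f (suc i)))) (sym (+-assoc (f 0) _ _))

  ∑-last : ∀ n f → ∑[ suc n ] f ≡ (∑[ n ] f) + f n
  ∑-last n f = trans (cong (λ m → ∑[ m ] f) (+-comm 1 n)) (trans (∑-split n 1 f)
    (cong ((∑[ n ] f) +_) (trans (+-identityʳ (f (n + 0))) (cong f (+-identityʳ n)))))

  ∑-≤ : ∀ n {f c} → (∀ i → i < n → f i ≤ c) → ∑[ n ] f ≤ n * c
  ∑-≤ zero    h = z≤n
  ∑-≤ (suc n) h = +-mono-≤ (h 0 z<s) (∑-≤ n (λ i i<n → h (suc i) (s<s i<n)))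

  ∑-≥ : ∀ n {f c} → (∀ i → i < n → c ≤ f i) → n * c ≤ ∑[ n ] f
  ∑-≥ zero    h = z≤n
  ∑-≥ (suc n) h = +-mono-≤ (h 0 z<s) (∑-≥ n (λ i i<n → h (suc i) (s<s i<n)))

  ∑-symmetric : ∀ n (g : ℕ → ℕ) → (∑[ suc (n + n) ] λ i → g ∣ i - n ∣) ≡ g 0 +
    ((∑[ n ] λ i → g (suc i)) + (∑[ n ] λ i → g (suc i)))
  ∑-symmetric zero    g = refl
  ∑-symmetric (suc n) g = begin
    g (suc n) + (∑[ suc n + suc n ] λ i → g ∣ i - n ∣)
      ≡⟨ cong (λ m → g (suc n) + (∑[ m ] λ i → g ∣ i - n ∣)) (cong suc (+-suc n n)) ⟩
    g (suc n) + (∑[ suc (suc (n + n)) ] λ i → g ∣ i - n ∣)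
      ≡⟨ cong (g (suc n) +_) (∑-last (suc (n + n)) (λ i → g ∣ i - n ∣)) ⟩
    g (suc n) + ((∑[ suc (n + n) ] λ i → g ∣ i - n ∣) + g ∣ suc (n + n) - n ∣)
      ≡⟨ cong₂ (λ x y → g (suc n) + (x + g y)) (∑-symmetric n g) far ⟩
    g (suc n) + (g 0 + (s + s) + g (suc n))
      ≡⟨ lemma (g (suc n)) (g 0) s ⟩
    g 0 + ((s + g (suc n)) + (s + g (suc n)))
      ≡⟨ cong (λ x → g 0 + (x + x)) (∑-last n (λ i → g (suc i))) ⟨
    g 0 + ((∑[ suc n ] λ i → g (suc i)) + (∑[ suc n ] λ i → g (suc i))) ∎
    where
    open ≡-Reasoning
    s = ∑[ n ] λ i → g (suc i)
    far : ∣ suc (n + n) - n ∣ ≡ suc n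
    far = trans (∣-∣-comm (suc (n + n)) n) (trans (cong (∣ n -_∣) (sym (+-suc n n))) (∣m-m+n∣≡n n (suc n)))
    lemma : ∀ a b s → a + (b + (s + s) + a) ≡ b + ((s + a) + (s + a))
    lemma = solve-∀

  ²-mono : ∀ {m n} → m ≤ n → m ² ≤ n ²
  ²-mono h = *-mono-≤ h h

  ²-cancel : ∀ m n → m ² ≤ n ² → m ≤ n
  ²-cancel m n h = ≮⇒≥ λ n<m → <⇒≱ (*-mono-< n<m n<m) h

  module _ (n : ℕ) where

    column : ℕ → ℕ
    column a = ∑[ n ] λ j → [ a ² + suc j ² ≤ n ² ]

    -- The number of lattice points of the disk with 1 ≤ x ≤ X and 1 ≤ y.
    quadrant : ℕ → ℕ
    quadrant X = ∑[ X ] λ a → column (suc a)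

    column-≤n : ∀ a → column a ≤ n
    column-≤n a = subst (column a ≤_) (*-identityʳ n) (∑-≤ n (λ j _ → [≤]≤1 (a ² + suc j ²) (n ²)))

    column-≥ : ∀ a Y → a ² + Y ² ≤ n ² → Y ≤ column a
    column-≥ a Y h = begin
      Y
        ≡⟨ *-identityʳ Y ⟨
      Y * 1
        ≤⟨ ∑-≥ Y (λ j j<Y → ≤-reflexive (sym (≤⇒[≤]≡1 (≤-trans (+-monoʳ-≤ (a ²) (²-mono j<Y)) h)))) ⟩
      (∑[ Y ] f)
        ≤⟨ m≤m+n _ _ ⟩
      (∑[ Y ] f) + (∑[ n ∸ Y ] λ i → f (Y + i))
        ≡⟨ trans (sym (∑-split Y (n ∸ Y) f)) (cong (λ m → ∑[ m ] f)
          (m+[n∸m]≡n (²-cancel Y n (≤-trans (m≤n+m (Y ²) (a ²)) h)))) ⟩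
      column a ∎
      where
      open ≤-Reasoning
      f : ℕ → ℕ
      f j = [ a ² + suc j ² ≤ n ² ]

    column-≤ : ∀ a Y → n ² ≤ a ² + Y ² → Y ≤ n → column a ≤ Y
    column-≤ a Y h Y≤n = begin
      column a
        ≡⟨ trans (cong (λ m → ∑[ m ] f) (sym (m+[n∸m]≡n Y≤n))) (∑-split Y (n ∸ Y) f) ⟩
      (∑[ Y ] f) + (∑[ n ∸ Y ] λ i → f (Y + i))
        ≤⟨ +-mono-≤ (∑-≤ Y (λ j _ → [≤]≤1 (a ² + suc j ²) (n ²)))
             (∑-≤ (n ∸ Y) {c = 0} (λ i _ → ≤-reflexive
               (>⇒[≤]≡0 (≤-<-trans h (+-monoʳ-< (a ²) (*-mono-< (s≤s (m≤m+n Y i)) (s≤s (m≤m+n Y i)))))))) ⟩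
      Y * 1 + (n ∸ Y) * 0
        ≡⟨ cong₂ _+_ (*-identityʳ Y) (*-zeroʳ (n ∸ Y)) ⟩
      Y + 0
        ≡⟨ +-identityʳ Y ⟩
      Y ∎
      where
      open ≤-Reasoning
      f : ℕ → ℕ
      f j = [ a ² + suc j ² ≤ n ² ]

    -- The circle descends in the quadrant, so each column from X + 1 to X′ has between Y′ and Y
    -- points. The bounds are exact because both corners lie on the circle.
    quadrant-block : ∀ {X Y X′ Y′} → X ² + Y ² ≡ n ² → X′ ² + Y′ ² ≡ n ² → X ≤ X′ →
      quadrant X + (X′ ∸ X) * Y′ ≤ quadrant X′ × quadrant X′ ≤ quadrant X + (X′ ∸ X) * Y
    quadrant-block {X} {Y} {X′} {Y′} e e′ X≤X′ =
      subst (quadrant X + (X′ ∸ X) * Y′ ≤_) (sym split) (+-monoʳ-≤ (quadrant X)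
        (∑-≥ (X′ ∸ X) (λ i i<d → column-≥ (suc (X + i)) Y′
          (subst (suc (X + i) ² + Y′ ² ≤_) e′ (+-monoˡ-≤ (Y′ ²) (²-mono (inside i<d))))))) ,
      subst (_≤ quadrant X + (X′ ∸ X) * Y) (sym split) (+-monoʳ-≤ (quadrant X)
        (∑-≤ (X′ ∸ X) (λ i _ → column-≤ (suc (X + i)) Y
          (subst (_≤ suc (X + i) ² + Y ²) e (+-monoˡ-≤ (Y ²) (²-mono (m≤n⇒m≤1+n (m≤m+n X i)))))
          (²-cancel Y n (subst (Y ² ≤_) e (m≤n+m (Y ²) (X ²)))))))
      where
      split : quadrant X′ ≡ quadrant X + (∑[ X′ ∸ X ] λ i → column (suc (X + i)))
      split = trans (cong quadrant (sym (m+[n∸m]≡n X≤X′))) (∑-split X (X′ ∸ X) (λ a → column (suc a)))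
      inside : ∀ {i} → i < X′ ∸ X → suc (X + i) ≤ X′
      inside {i} i<d = subst₂ _≤_ (+-suc X i) (m+[n∸m]≡n X≤X′) (+-monoʳ-≤ X i<d)

    -- The disk is four open quadrants together with the points on the axes, at most 4n + 1 in
    -- number.
    latticePoints-quadrant : 4 * quadrant n ≤ latticePoints n × latticePoints n ≤ 4 * quadrant n + (4 * n + 1)
    latticePoints-quadrant =
      subst (4 * q ≤_) (sym expand) (subst (4 * q ≤_) (lemma₁ (cell 0 0) (column 0) axis q) (m≤m+n (4 * q) _)) ,
      subst (_≤ 4 * q + (4 * n + 1)) (sym expand) (≤-trans
        (+-mono-≤ (+-mono-≤ ([≤]≤1 (0 ² + 0 ²) (n ²)) (+-mono-≤ (column-≤n 0) (column-≤n 0)))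
          (+-mono-≤ (+-monoˡ-≤ (q + q) axis≤n) (+-monoˡ-≤ (q + q) axis≤n)))
        (≤-reflexive (lemma₂ n q)))
      where
      open ≡-Reasoning
      q = quadrant n
      cell : ℕ → ℕ → ℕ
      cell a b = [ a ² + b ² ≤ n ² ]
      axis : ℕ
      axis = ∑[ n ] λ a → cell (suc a) 0
      axis≤n : axis ≤ n
      axis≤n = subst (axis ≤_) (*-identityʳ n) (∑-≤ n (λ a _ → [≤]≤1 (suc a ² + 0 ²) (n ²)))
      row : ℕ → ℕ
      row a = cell a 0 + (column a + column a)
      2n : suc (2 * n) ≡ suc (n + n)
      2n = cong (λ m → suc (n + m)) (+-identityʳ n)
      expand : latticePoints n ≡ cell 0 0 + (column 0 + column 0) + ((axis + (q + q)) + (axis + (q + q)))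
      expand = begin
        latticePoints n
          ≡⟨ cong (λ m → ∑[ m ] λ i → ∑[ m ] λ j → cell ∣ i - n ∣ ∣ j - n ∣) 2n ⟩
        (∑[ suc (n + n) ] λ i → ∑[ suc (n + n) ] λ j → cell ∣ i - n ∣ ∣ j - n ∣)
          ≡⟨ ∑-cong (suc (n + n)) (λ i → ∑-symmetric n (cell ∣ i - n ∣)) ⟩
        (∑[ suc (n + n) ] λ i → row ∣ i - n ∣)
          ≡⟨ ∑-symmetric n row ⟩
        row 0 + ((∑[ n ] λ a → row (suc a)) + (∑[ n ] λ a → row (suc a)))
          ≡⟨ cong (λ x → row 0 + (x + x)) (trans
            (∑-+ n (λ a → cell (suc a) 0) (λ a → column (suc a) + column (suc a)))
               (cong (axis +_) (∑-+ n (λ a → column (suc a)) (λ a → column (suc a))))) ⟩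
        row 0 + ((axis + (q + q)) + (axis + (q + q))) ∎
      lemma₁ : ∀ c k a q → 4 * q + (c + 2 * k + 2 * a) ≡ c + (k + k) + ((a + (q + q)) + (a + (q + q)))
      lemma₁ = solve-∀
      lemma₂ : ∀ n q → 1 + (n + n) + ((n + (q + q)) + (n + (q + q))) ≡ 4 * q + (4 * n + 1)
      lemma₂ = solve-∀

-- Sectors of the circle and the value of π

module Circle where

  open import Data.Rational.Base
  open import Data.Rational.Properties
  open import Algebra.Definitions.RawSemiring +-*-rawSemiring using (_^_)
  open import Defs using (recip; _²; latticePoints; π; seq)
  open Basics
  open Calculus
  open Limits
  open Antiderivative
  open Arctan
  open Substitution
  open Lattice

  private
    variable
      a b : ℚ
      F f : ℚ → ℚ

  lipschitz : Diff a b F f → ∃[ L ]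
    (∀ {s t} → s ∈[ a , b ] → t ∈[ a , b ] → s ≤ t → ∣ F t - F s ∣ ≤ L * (t - s))
  lipschitz {F = F} {f = f} D =
    let L , bound = bounded-+ (f-bounded D) (bounded-* bounded-Δ (rem-bounded D))
    in L , λ {s} {t} s∈ t∈ s≤t → subst (λ z → ∣ z ∣ ≤ L * (t - s))
      (trans (lemma (F s) (f s + (t - s) * rem D s t) (t - s)) (cong (_- F s) (sym (expand D s∈ t∈))))
      (∣∣≤-* (bound s∈ t∈) (0≤p≤q⇒∣p∣≤q (p≤q⇒0≤q-p s≤t) ≤-refl))
    where
    open Diff
    lemma : ∀ F g d → g * d ≡ F + d * g - F
    lemma = solve-∀ ring

  -- The point (2t / (1 + t²) , (1 - t²) / (1 + t²)) runs from (0 , 1) at t = 0 to (1 , 0) at t = 1;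
  -- the angle 2 arctan t is measured from the y axis.
  E x y : ℚ → ℚ
  E t = recip (1ℚ + t * (0ℚ + t * 1ℚ))
  x t = (1ℚ + 1ℚ) * t * E t
  y t = (1ℚ + t * (0ℚ + t * - 1ℚ)) * E t

  0<den : ∀ t → 0ℚ < 1ℚ + t * (0ℚ + t * 1ℚ)
  0<den t = subst (0ℚ <_) (lemma t) (0<1+p² t)
    where
    lemma : ∀ t → 1ℚ + t * t ≡ 1ℚ + t * (0ℚ + t * 1ℚ)
    lemma = solve-∀ ring

  E-inverse : ∀ t → E t * (1ℚ + t * (0ℚ + t * 1ℚ)) ≡ 1ℚ
  E-inverse t = recip-inverseˡ (0<den t)

  x²+y²≡1 : ∀ t → x t * x t + y t * y t ≡ 1ℚ
  x²+y²≡1 t = ≡-by₁ (E t * (1ℚ + t * (0ℚ + t * 1ℚ)) + 1ℚ) (E-inverse t) (lemma t (E t))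
    where
    lemma : ∀ t e → (1ℚ + 1ℚ) * t * e * ((1ℚ + 1ℚ) * t * e) +
      (1ℚ + t * (0ℚ + t * - 1ℚ)) * e * ((1ℚ + t * (0ℚ + t * - 1ℚ)) * e) ≡
      1ℚ + (e * (1ℚ + t * (0ℚ + t * 1ℚ)) + 1ℚ) * (e * (1ℚ + t * (0ℚ + t * 1ℚ)) - 1ℚ)
    lemma = solve-∀ ring

  -- The difference is 2 (t - s) (1 - s t) over the two denominators, which is nonnegative on
  -- [0 , 1].
  x-mono : ∀ {s t} → s ∈[ 0ℚ , 1ℚ ] → t ∈[ 0ℚ , 1ℚ ] → s ≤ t → x s ≤ x t
  x-mono {s} {t} (0≤s , s≤1) (0≤t , t≤1) s≤t = ≤-by
    (0≤* (0≤* (0≤* (nonNegative⁻¹ (1ℚ + 1ℚ)) (0≤* (<⇒≤ (0<recip (0<den s))) (<⇒≤ (0<recip (0<den t)))))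
      (p≤q⇒0≤q-p s≤t))
         (p≤q⇒0≤q-p (*-mono-≤ 0≤s 0≤t s≤1 t≤1)))
    (≡-by₂ (- ((1ℚ + 1ℚ) * s * E s)) ((1ℚ + 1ℚ) * t * E t) (E-inverse t) (E-inverse s) (lemma s t (E s) (E t)))
    where
    lemma : ∀ s t e f → (1ℚ + 1ℚ) * s * e + (1ℚ + 1ℚ) * (e * f) * (t - s) * (1ℚ * 1ℚ - s * t) ≡
      (1ℚ + 1ℚ) * t * f + - ((1ℚ + 1ℚ) * s * e) * (f * (1ℚ + t * (0ℚ + t * 1ℚ)) - 1ℚ) +
        (1ℚ + 1ℚ) * t * f * (e * (1ℚ + s * (0ℚ + s * 1ℚ)) - 1ℚ)
    lemma = solve-∀ ring

  1≤den : ∀ {s} → s ∈[ 0ℚ , 1ℚ ] → 1ℚ ≤ 1ℚ + s * (0ℚ + s * 1ℚ)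
  1≤den {s} _ = ≤-by (0≤p² s) (lemma s)
    where
    lemma : ∀ s → 1ℚ + s * s ≡ 1ℚ + s * (0ℚ + s * 1ℚ)
    lemma = solve-∀ ring

  x′ y′ : ℚ → ℚ
  x′ t = (1ℚ + 1ℚ) * 1ℚ * E t - (1ℚ + 1ℚ) * t * (0ℚ + t * (1ℚ + 1ℚ)) * (E t * E t)
  y′ t = (0ℚ + t * (- 1ℚ + - 1ℚ)) * E t - (1ℚ + t * (0ℚ + t * - 1ℚ)) * (0ℚ + t * (1ℚ + 1ℚ)) * (E t * E t)

  diff-x : Diff 0ℚ 1ℚ x x′
  diff-x = diff-quotient (positive⁻¹ 1ℚ) 1≤den (diff-scale (1ℚ + 1ℚ) diff-id) (diff-quadratic 1ℚ 0ℚ 1ℚ)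

  diff-y : Diff 0ℚ 1ℚ y y′
  diff-y = diff-quotient (positive⁻¹ 1ℚ) 1≤den (diff-quadratic 1ℚ 0ℚ (- 1ℚ)) (diff-quadratic 1ℚ 0ℚ 1ℚ)

  module _ (K : ℕ) where

    private
      P = primitive-restrict {c = 0ℚ} {d = 1ℚ} (≤ᵇ⇒≤ _ , ≤ᵇ⇒≤ _) (≤ᵇ⇒≤ _ , ≤ᵇ⇒≤ _) (arctan-primitive K)

    -- The region under the arc up to x t is a sector of angle 2 arctan t and a triangle.
    area : ℚ → ℚ
    area t = arctan K t + ½ * (x t * y t)

    area′ : ℚ → ℚ
    area′ t = Primitive.F′ P t + ½ * (x′ t * y t + x t * y′ t)

    diff-area : Diff 0ℚ 1ℚ area area′
    diff-area = diff-+ (Primitive.diff P) (diff-scale ½ (diff-* diff-x diff-y))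

    -- For the exact arctan the area below the arc has derivative y x′. The truncated one leaves
    -- precisely E t times its relative error, and E t ≤ 1.
    area′≈x′y : ∀ {t} → t ∈[ 0ℚ , 1ℚ ] → ∣ x′ t * y t - area′ t ∣ ≤ ρ ^ K
    area′≈x′y {t} t∈ = subst₂ _≤_
      (cong ∣_∣ (sym (trans (cong (λ z → x′ t * y t - (z + ½ * (x′ t * y t + x t * y′ t)))
          (trans (Primitive.F′≡ P t∈) (cong (λ d → recip d * (1ℚ - Primitive.err P t)) (den t))))
        (≡-by₁ (E t) (E-inverse t) (lemma t (E t) (Primitive.err P t))))))
      (*-identityˡ (ρ ^ K))
      (∣∣≤-* (0≤p≤q⇒∣p∣≤q (<⇒≤ (0<recip (0<den t))) (recip-anti-≤ (positive⁻¹ 1ℚ) (1≤den t∈)))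
        (Primitive.err≤ P t∈))
      where
      den : ∀ t → 1ℚ + t * t ≡ 1ℚ + t * (0ℚ + t * 1ℚ)
      den = solve-∀ ring
      lemma : ∀ t e d →
        ((1ℚ + 1ℚ) * 1ℚ * e - (1ℚ + 1ℚ) * t * (0ℚ + t * (1ℚ + 1ℚ)) * (e * e)) *
          ((1ℚ + t * (0ℚ + t * - 1ℚ)) * e) -
        (e * (1ℚ - d) + ½ * (((1ℚ + 1ℚ) * 1ℚ * e - (1ℚ + 1ℚ) * t * (0ℚ + t * (1ℚ + 1ℚ)) * (e * e)) *
          ((1ℚ + t * (0ℚ + t * - 1ℚ)) * e) +
          (1ℚ + 1ℚ) * t * e * ((0ℚ + t * (- 1ℚ + - 1ℚ)) * e -
            (1ℚ + t * (0ℚ + t * - 1ℚ)) * (0ℚ + t * (1ℚ + 1ℚ)) * (e * e)))) ≡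
        e * d + e * (e * (1ℚ + t * (0ℚ + t * 1ℚ)) - 1ℚ)
      lemma = solve-∀ ring

    -- A quantity q between the lower and the upper rectangle over [x s , x t] approximates the area
    -- of the strip. The rectangles differ by a product of two Lipschitz increments, and the
    -- expansions of x and `area` have quadratic remainders. Hence only the truncation of arctan
    -- contributes to first order in t - s.
    area-increment : ∃[ C ] (∀ {s t} → s ∈[ 0ℚ , 1ℚ ] → t ∈[ 0ℚ , 1ℚ ] → s ≤ t → ∀ q →
      (x t - x s) * y t ≤ q → q ≤ (x t - x s) * y s →
      ∣ q - (area t - area s) ∣ ≤ ρ ^ K * (t - s) + C * ((t - s) * (t - s)))
    area-increment =
      let Lx , lip-x = lipschitz diff-x
          Ly , lip-y = lipschitz diff-y
          B , rem-bound = bounded-+ (bounded-* (rem-bounded diff-x) (F-bounded diff-y))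
            (bounded-neg (rem-bounded diff-area))
      in Lx * Ly + B , λ {s} {t} s∈ t∈ s≤t q lo hi →
        let d = t - s
            0≤d = p≤q⇒0≤q-p s≤t
        in subst₂ _≤_ refl (regroup (ρ ^ K) Lx Ly B d)
          (∣-∣-trans q ((x t - x s) * y s) (area t - area s)
            (sandwich q (x t - x s) (y s) (y t) lo hi (∣∣≤-* (lip-x s∈ t∈ s≤t) (lip-y s∈ t∈ s≤t)))
            (subst (λ z → ∣ z ∣ ≤ ρ ^ K * d + B * (d * d))
              (sym (trans (cong₂ (λ z w → (z - x s) * y s - (w - area s)) (expand diff-x s∈ t∈)
                (expand diff-area s∈ t∈))
                (collect (x s) (y s) (area s) (x′ s) (area′ s) (rem diff-x s t) (rem diff-area s t) d)))
              (∣∣≤-+ (∣∣≤-* (area′≈x′y s∈) (0≤p≤q⇒∣p∣≤q 0≤d ≤-refl))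
                     (∣∣≤-* (rem-bound s∈ t∈) (0≤p≤q⇒∣p∣≤q (0≤* 0≤d 0≤d) ≤-refl)))))
      where
      open Diff
      sandwich : ∀ q d y y₁ {c} → d * y₁ ≤ q → q ≤ d * y → ∣ d * (y₁ - y) ∣ ≤ c → ∣ q - d * y ∣ ≤ c
      sandwich q d y y₁ lo hi h = ∣∣≤
        (≤-trans (≤-by (p≤q⇒0≤q-p hi) (cancel q (d * y))) (∣∣≤⇒0≤ h))
        (≤-trans (≤-by (p≤q⇒0≤q-p lo) (swap q d y y₁)) (≤-trans (-p≤∣p∣ (d * (y₁ - y))) h))
        where
        cancel : ∀ q w → q - w + (w - q) ≡ 0ℚ
        cancel = solve-∀ ring
        swap : ∀ q d y y₁ → - (q - d * y) + (q - d * y₁) ≡ - (d * (y₁ - y))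
        swap = solve-∀ ring
      collect : ∀ x y a x′ a′ p q d → (x + d * (x′ + d * p) - x) * y - (a + d * (a′ + d * q) - a) ≡
        (x′ * y - a′) * d + (p * y + - q) * (d * d)
      collect = solve-∀ ring
      regroup : ∀ e l m B d → l * d * (m * d) + (e * d + B * (d * d)) ≡ e * d + (l * m + B) * (d * d)
      regroup = solve-∀ ring

  telescope : ∀ (g : ℕ → ℚ) {e} N → (∀ j → j ℕ.< N → ∣ g (suc j) - g j ∣ ≤ e) → ∣ g N - g 0 ∣ ≤ fromℕ N * e
  telescope g {e} zero    h = ≤-reflexive
    (trans (cong ∣_∣ (+-inverseʳ (g 0))) (sym (trans (cong (_* e) fromℕ-0) (*-zeroˡ e))))
  telescope g {e} (suc N) h = subst (∣ g (suc N) - g 0 ∣ ≤_)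
    (sym (trans (cong (_* e) (fromℕ-suc N)) (lemma e (fromℕ N))))
    (∣-∣-trans (g (suc N)) (g N) (g 0) (h N ℕ.≤-refl) (telescope g N (λ j j<N → h j (ℕ.m≤n⇒m≤1+n j<N))))
    where
    lemma : ∀ e n → (1ℚ + n) * e ≡ e + n * e
    lemma = solve-∀ ring

  fromℕ-injective : ∀ {m n} → fromℕ m ≡ fromℕ n → m ≡ n
  fromℕ-injective e = ℕ.≤-antisym (fromℕ-cancel-≤ (≤-reflexive e)) (fromℕ-cancel-≤ (≤-reflexive (sym e)))

  fromℕ-∸ : ∀ {m n} → n ℕ.≤ m → fromℕ (m ℕ.∸ n) ≡ fromℕ m - fromℕ n
  fromℕ-∸ {m} {n} n≤m = trans (sym (lemma (fromℕ (m ℕ.∸ n)) (fromℕ n)))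
    (cong (_- fromℕ n) (trans (sym (fromℕ-+ (m ℕ.∸ n) n)) (cong fromℕ (ℕ.m∸n+n≡m n≤m))))
    where
    lemma : ∀ p q → p + q - q ≡ p
    lemma = solve-∀ ring

  module _ (N n : ℕ) .{{_ : ℕ.NonZero N}} .{{_ : ℕ.NonZero n}}
           (k : ℕ → ℕ) (k≡ : ∀ {j} → j ℕ.≤ N → k j ℕ.* (N ² ℕ.+ j ²) ≡ n) where

    private

      d r : ℚ
      d = recip (fromℕ N)
      r = recip (fromℕ n)

      d*N≡1 : d * fromℕ N ≡ 1ℚ
      d*N≡1 = recip-inverseˡ (0<fromℕ N)

      r*n≡1 : r * fromℕ n ≡ 1ℚ
      r*n≡1 = recip-inverseˡ (0<fromℕ n)

      0≤r : 0ℚ ≤ r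
      0≤r = <⇒≤ (0<recip (0<fromℕ n))

    node : ℕ → ℚ
    node j = fromℕ j * d

    node-step : ∀ j → node (suc j) - node j ≡ d
    node-step j = trans (cong (λ m → m * d - fromℕ j * d) (fromℕ-suc j)) (lemma (fromℕ j) d)
      where
      lemma : ∀ j d → (1ℚ + j) * d - j * d ≡ d
      lemma = solve-∀ ring

    node∈ : ∀ {j} → j ℕ.≤ N → node j ∈[ 0ℚ , 1ℚ ]
    node∈ {j} j≤N = 0≤* (0≤fromℕ j) (<⇒≤ (0<recip (0<fromℕ N))) ,
      *recip≤ {n = fromℕ j} (0<fromℕ N) (subst (fromℕ j ≤_) (sym (*-identityˡ (fromℕ N))) (fromℕ-mono-≤ j≤N))

    -- Pythagorean triples (2jN , N² - j² , N² + j²), scaled by k j to the common hypotenuse n: the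
    -- points with half-angle tangents j / N become integral on one circle.
    X Y : ℕ → ℕ
    X j = 2 ℕ.* j ℕ.* N ℕ.* k j
    Y j = (N ² ℕ.∸ j ²) ℕ.* k j

    private

      fromℕ-n : ∀ {j} → j ℕ.≤ N → fromℕ n ≡ fromℕ (k j) * (fromℕ N * fromℕ N + fromℕ j * fromℕ j)
      fromℕ-n {j} j≤N = trans (cong fromℕ (sym (k≡ j≤N))) (trans (fromℕ-* (k j) (N ² ℕ.+ j ²))
        (cong (fromℕ (k j) *_) (trans (fromℕ-+ (N ²) (j ²)) (cong₂ _+_ (fromℕ-* N N) (fromℕ-* j j)))))

      node*N : ∀ j → fromℕ j ≡ node j * fromℕ N
      node*N j = sym (≡-by₁ (fromℕ j) d*N≡1 (lemma (fromℕ j) d (fromℕ N)))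
        where
        lemma : ∀ j d N → j * d * N ≡ j + j * (d * N - 1ℚ)
        lemma = solve-∀ ring

    fromℕ-X : ∀ {j} → j ℕ.≤ N → fromℕ (X j) ≡ fromℕ n * x (node j)
    fromℕ-X {j} j≤N = begin
      fromℕ (2 ℕ.* j ℕ.* N ℕ.* k j)
        ≡⟨ trans (fromℕ-* (2 ℕ.* j ℕ.* N) (k j))
          (cong (_* fromℕ (k j)) (trans (fromℕ-* (2 ℕ.* j) N) (cong (_* fromℕ N)
             (trans (fromℕ-* 2 j) (cong (_* fromℕ j) (trans (fromℕ-suc 1) (cong (1ℚ +_) fromℕ-1))))))) ⟩
      (1ℚ + 1ℚ) * fromℕ j * fromℕ N * fromℕ (k j)
        ≡⟨ cong (λ z → (1ℚ + 1ℚ) * z * fromℕ N * fromℕ (k j)) (node*N j) ⟩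
      (1ℚ + 1ℚ) * (t * fromℕ N) * fromℕ N * fromℕ (k j)
        ≡⟨ ≡-by₁ (- ((1ℚ + 1ℚ) * t * fromℕ N * fromℕ N * fromℕ (k j))) (E-inverse t)
          (lemma t (E t) (fromℕ N) (fromℕ (k j))) ⟩
      fromℕ (k j) * (fromℕ N * fromℕ N + (t * fromℕ N) * (t * fromℕ N)) * x t
        ≡⟨ cong (λ z → fromℕ (k j) * (fromℕ N * fromℕ N + z * z) * x t) (node*N j) ⟨
      fromℕ (k j) * (fromℕ N * fromℕ N + fromℕ j * fromℕ j) * x t
        ≡⟨ cong (_* x t) (fromℕ-n j≤N) ⟨
      fromℕ n * x t ∎
      where
      open ≡-Reasoning
      t = node j
      lemma : ∀ t e N k → (1ℚ + 1ℚ) * (t * N) * N * k ≡ k * (N * N + (t * N) * (t * N)) * ((1ℚ + 1ℚ) * t * e) +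
        - ((1ℚ + 1ℚ) * t * N * N * k) * (e * (1ℚ + t * (0ℚ + t * 1ℚ)) - 1ℚ)
      lemma = solve-∀ ring

    fromℕ-Y : ∀ {j} → j ℕ.≤ N → fromℕ (Y j) ≡ fromℕ n * y (node j)
    fromℕ-Y {j} j≤N = begin
      fromℕ ((N ² ℕ.∸ j ²) ℕ.* k j)
        ≡⟨ trans (fromℕ-* (N ² ℕ.∸ j ²) (k j))
          (cong (_* fromℕ (k j)) (trans (fromℕ-∸ {N ²} {j ²} (²-mono j≤N))
          (cong₂ _-_ (fromℕ-* N N) (fromℕ-* j j)))) ⟩
      (fromℕ N * fromℕ N - fromℕ j * fromℕ j) * fromℕ (k j)
        ≡⟨ cong (λ z → (fromℕ N * fromℕ N - z * z) * fromℕ (k j)) (node*N j) ⟩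
      (fromℕ N * fromℕ N - t * fromℕ N * (t * fromℕ N)) * fromℕ (k j)
        ≡⟨ ≡-by₁ (- ((1ℚ - t * t) * fromℕ N * fromℕ N * fromℕ (k j))) (E-inverse t)
          (lemma t (E t) (fromℕ N) (fromℕ (k j))) ⟩
      fromℕ (k j) * (fromℕ N * fromℕ N + (t * fromℕ N) * (t * fromℕ N)) * y t
        ≡⟨ cong (λ z → fromℕ (k j) * (fromℕ N * fromℕ N + z * z) * y t) (node*N j) ⟨
      fromℕ (k j) * (fromℕ N * fromℕ N + fromℕ j * fromℕ j) * y t
        ≡⟨ cong (_* y t) (fromℕ-n j≤N) ⟨
      fromℕ n * y t ∎
      where
      open ≡-Reasoning
      t = node j
      lemma : ∀ t e N k → (N * N - t * N * (t * N)) * k ≡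
        k * (N * N + (t * N) * (t * N)) * ((1ℚ + t * (0ℚ + t * - 1ℚ)) * e) +
        - ((1ℚ - t * t) * N * N * k) * (e * (1ℚ + t * (0ℚ + t * 1ℚ)) - 1ℚ)
      lemma = solve-∀ ring

    onCircle : ∀ {j} → j ℕ.≤ N → X j ² ℕ.+ Y j ² ≡ n ²
    onCircle {j} j≤N = fromℕ-injective (begin
      fromℕ (X j ² ℕ.+ Y j ²)
        ≡⟨ trans (fromℕ-+ (X j ²) (Y j ²)) (cong₂ _+_ (fromℕ-* (X j) (X j)) (fromℕ-* (Y j) (Y j))) ⟩
      fromℕ (X j) * fromℕ (X j) + fromℕ (Y j) * fromℕ (Y j)
        ≡⟨ cong₂ (λ p q → p * p + q * q) (fromℕ-X j≤N) (fromℕ-Y j≤N) ⟩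
      fromℕ n * x t * (fromℕ n * x t) + fromℕ n * y t * (fromℕ n * y t)
        ≡⟨ ≡-by₁ (fromℕ n * fromℕ n) (x²+y²≡1 t) (lemma (fromℕ n) (x t) (y t)) ⟩
      fromℕ n * fromℕ n
        ≡⟨ fromℕ-* n n ⟨
      fromℕ (n ²) ∎)
      where
      open ≡-Reasoning
      t = node j
      lemma : ∀ n x y → n * x * (n * x) + n * y * (n * y) ≡ n * n + n * n * (x * x + y * y - 1ℚ)
      lemma = solve-∀ ring

    node-mono : ∀ j → node j ≤ node (suc j)
    node-mono j = ≤-by (<⇒≤ (0<recip (0<fromℕ N)))
      (trans (cong (node j +_) (sym (node-step j))) (lemma (node j) (node (suc j))))
      where
      lemma : ∀ p q → p + (q - p) ≡ q
      lemma = solve-∀ ring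

    X-mono : ∀ {j} → j ℕ.< N → X j ℕ.≤ X (suc j)
    X-mono {j} j<N = fromℕ-cancel-≤ (subst₂ _≤_ (sym (fromℕ-X (ℕ.<⇒≤ j<N))) (sym (fromℕ-X j<N))
      (*-mono-≤ˡ (0≤fromℕ n) (x-mono (node∈ (ℕ.<⇒≤ j<N)) (node∈ j<N) (node-mono j))))

    scaledQuadrant : ℕ → ℚ
    scaledQuadrant j = fromℕ (quadrant n (X j)) * (r * r)

    scaledQuadrant-step : ∀ {j} → j ℕ.< N → let q = scaledQuadrant (suc j) - scaledQuadrant j in
      (x (node (suc j)) - x (node j)) * y (node (suc j)) ≤ q × q ≤ (x (node (suc j)) - x (node j)) * y (node j)
    scaledQuadrant-step {j} j<N =
      let lo , hi = quadrant-block n (onCircle (ℕ.<⇒≤ j<N)) (onCircle j<N) (X-mono j<N)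
      in lower (fromℕ n) r (x (node j)) (x (node (suc j))) (y (node (suc j))) (fromℕ (quadrant n (X j)))
        (fromℕ (quadrant n (X (suc j)))) r*n≡1 0≤r
           (subst (_≤ fromℕ (quadrant n (X (suc j)))) (cast (suc j) j<N) (fromℕ-mono-≤ lo)) ,
         upper (fromℕ n) r (x (node j)) (x (node (suc j))) (y (node j)) (fromℕ (quadrant n (X j)))
           (fromℕ (quadrant n (X (suc j)))) r*n≡1 0≤r
           (subst (fromℕ (quadrant n (X (suc j))) ≤_) (cast j (ℕ.<⇒≤ j<N)) (fromℕ-mono-≤ hi))
      where
      cast : ∀ i → i ℕ.≤ N → fromℕ (quadrant n (X j) ℕ.+ (X (suc j) ℕ.∸ X j) ℕ.* Y i) ≡
        fromℕ (quadrant n (X j)) + (fromℕ n * x (node (suc j)) - fromℕ n * x (node j)) * (fromℕ n * y (node i))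
      cast i i≤N = trans (fromℕ-+ (quadrant n (X j)) ((X (suc j) ℕ.∸ X j) ℕ.* Y i))
        (cong (fromℕ (quadrant n (X j)) +_)
        (trans (fromℕ-* (X (suc j) ℕ.∸ X j) (Y i)) (cong₂ _*_
          (trans (fromℕ-∸ {X (suc j)} {X j} (X-mono j<N))
            (cong₂ _-_ (fromℕ-X j<N) (fromℕ-X (ℕ.<⇒≤ j<N)))) (fromℕ-Y i≤N))))
      expanded : ∀ n r x₀ x₁ y q → (q + (n * x₁ - n * x₀) * (n * y)) * (r * r) ≡
        q * (r * r) + (x₁ - x₀) * y + (x₁ - x₀) * y * (r * n + 1ℚ) * (r * n - 1ℚ)
      expanded = solve-∀ ring
      move : ∀ a b → a + b - a ≡ b
      move = solve-∀ ring
      module _ (n r x₀ x₁ y q q′ : ℚ) (e : r * n ≡ 1ℚ) (0≤r : 0ℚ ≤ r) where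
        identity : (q + (n * x₁ - n * x₀) * (n * y)) * (r * r) - q * (r * r) ≡ (x₁ - x₀) * y
        identity = trans (cong (_- q * (r * r))
          (≡-by₁ {m = q * (r * r) + (x₁ - x₀) * y} ((x₁ - x₀) * y * (r * n + 1ℚ)) e (expanded n r x₀ x₁ y q)))
          (move (q * (r * r)) ((x₁ - x₀) * y))
        scale-mono : ∀ {a b} → a ≤ b → a * (r * r) - q * (r * r) ≤ b * (r * r) - q * (r * r)
        scale-mono h = +-monoˡ-≤ (- (q * (r * r))) (*-monoʳ-≤-nonNeg (r * r) {{nonNegative (0≤* 0≤r 0≤r)}} h)
        lower : q + (n * x₁ - n * x₀) * (n * y) ≤ q′ → (x₁ - x₀) * y ≤ q′ * (r * r) - q * (r * r)
        lower h = subst (_≤ q′ * (r * r) - q * (r * r)) identity (scale-mono h)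
        upper : q′ ≤ q + (n * x₁ - n * x₀) * (n * y) → q′ * (r * r) - q * (r * r) ≤ (x₁ - x₀) * y
        upper h = subst (q′ * (r * r) - q * (r * r) ≤_) identity (scale-mono h)

    X-N : X N ≡ n
    X-N = fromℕ-injective (trans (fromℕ-X {N} ℕ.≤-refl)
      (trans (cong (λ t → fromℕ n * x t) (trans (*-comm (fromℕ N) d) d*N≡1))
      (*-identityʳ (fromℕ n))))

    -- N strips of parameter width d = 1/N, each with error ρ^K d + C d², give ρ^K + C d in total.
    -- At t = 1 the triangle in `area` degenerates, as y = 0, and arctan 1 remains.
    quadrant≈arctan : ∀ K → ∣ fromℕ (quadrant n n) * (r * r) - arctan K 1ℚ ∣ ≤
      ρ ^ K + proj₁ (area-increment K) * d
    quadrant≈arctan K = subst₂ _≤_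
      (cong ∣_∣ (ends (scaledQuadrant N) (fromℕ (quadrant n n) * (r * r)) (scaledQuadrant 0)
        (area K (node N)) (area K (node 0)) (arctan K 1ℚ)
        (cong (λ m → fromℕ (quadrant n m) * (r * r)) X-N)
        (trans (cong (_* (r * r)) fromℕ-0) (*-zeroˡ (r * r)))
        (trans (cong (area K) (trans (*-comm (fromℕ N) d) d*N≡1)) (+-identityʳ (arctan K 1ℚ)))
        (trans (cong (area K) (trans (cong (_* d) fromℕ-0) (*-zeroˡ d))) (cong (_+ 0ℚ) (arctan-0 K)))))
      (≡-by₁ (ρ ^ K + C * d) d*N≡1 (regroup (ρ ^ K) C d (fromℕ N)))
      (telescope (λ j → scaledQuadrant j - area K (node j)) N increment)
      where
      C = proj₁ (area-increment K)
      regroup : ∀ e C d N → N * (e * d + C * (d * d)) ≡ e + C * d + (e + C * d) * (d * N - 1ℚ)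
      regroup = solve-∀ ring
      swap : ∀ q q′ a a′ → (q′ - q) - (a′ - a) ≡ (q′ - a′) - (q - a)
      swap = solve-∀ ring
      tidy : ∀ q a → (q - a) - (0ℚ - 0ℚ) ≡ q - a
      tidy = solve-∀ ring
      ends : ∀ q q′ q₀ a a₀ a′ → q ≡ q′ → q₀ ≡ 0ℚ → a ≡ a′ → a₀ ≡ 0ℚ → (q - a) - (q₀ - a₀) ≡ q′ - a′
      ends q _ _ a _ _ refl refl refl refl = tidy q a
      increment : ∀ j → j ℕ.< N →
        ∣ (scaledQuadrant (suc j) - area K (node (suc j))) - (scaledQuadrant j - area K (node j)) ∣ ≤ ρ
          ^ K * d + C * (d * d)
      increment j j<N =
        let lo , hi = scaledQuadrant-step j<N
        in subst₂ _≤_ (cong ∣_∣ (swap (scaledQuadrant j) (scaledQuadrant (suc j)) (area K (node j))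
          (area K (node (suc j)))))
             (cong (λ z → ρ ^ K * z + C * (z * z)) (node-step j))
             (proj₂ (area-increment K) (node∈ (ℕ.<⇒≤ j<N)) (node∈ j<N) (node-mono j)
               (scaledQuadrant (suc j) - scaledQuadrant j) lo hi)

    latticePoints≈arctan : ∀ K → ∣ fromℕ (latticePoints n) * (r * r) - 4ℚ * arctan K 1ℚ ∣ ≤
      (4ℚ + 1ℚ) * r + 4ℚ * (ρ ^ K + proj₁ (area-increment K) * d)
    latticePoints≈arctan K = ∣-∣-trans (fromℕ (latticePoints n) * (r * r))
      (4ℚ * (fromℕ (quadrant n n) * (r * r))) (4ℚ * arctan K 1ℚ)
      (0≤p≤q⇒∣p∣≤q
        (p≤q⇒0≤q-p (subst (_≤ L * (r * r)) (trans (cong (_* (r * r)) 4q) (assoc q r))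
          (*-monoʳ-≤-nonNeg (r * r) {{0≤r²}} (fromℕ-mono-≤ lo))))
        (≤-trans (+-monoˡ-≤ (- (4ℚ * (q * (r * r))))
          (subst (L * (r * r) ≤_) (cong (_* (r * r)) 4q+4n+1)
          (*-monoʳ-≤-nonNeg (r * r) {{0≤r²}} (fromℕ-mono-≤ hi))))
          -- The axes contribute (4n + 1) / n² = 4 r + r², which is at most 5 r because r ≤ 1.
          (≤-by (0≤* 0≤r (p≤q⇒0≤q-p r≤1)) (≡-by₁ {m = (4ℚ + 1ℚ) * r} (4ℚ * r) r*n≡1 (excess q r (fromℕ n))))))
      (subst₂ _≤_ (cong ∣_∣ (distrib (q * (r * r)) (arctan K 1ℚ))) refl
        (∣∣≤-* {4ℚ} ≤-refl (quadrant≈arctan K)))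
      where
      q = fromℕ (quadrant n n)
      L = fromℕ (latticePoints n)
      lo = proj₁ (latticePoints-quadrant n)
      hi = proj₂ (latticePoints-quadrant n)
      0≤r² = nonNegative (0≤* 0≤r 0≤r)
      fromℕ-4 : fromℕ 4 ≡ 4ℚ
      fromℕ-4 = fromℤ≡/1 (ℤ.+ 4)
      4q : fromℕ (4 ℕ.* quadrant n n) ≡ 4ℚ * q
      4q = trans (fromℕ-* 4 (quadrant n n)) (cong (_* q) fromℕ-4)
      4q+4n+1 : fromℕ (4 ℕ.* quadrant n n ℕ.+ (4 ℕ.* n ℕ.+ 1)) ≡ 4ℚ * q + (4ℚ * fromℕ n + 1ℚ)
      4q+4n+1 = trans (fromℕ-+ (4 ℕ.* quadrant n n) (4 ℕ.* n ℕ.+ 1)) (cong₂ _+_ 4q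
        (trans (fromℕ-+ (4 ℕ.* n) 1) (cong₂ _+_ (trans (fromℕ-* 4 n) (cong (_* fromℕ n) fromℕ-4)) fromℕ-1)))
      r≤1 : r ≤ 1ℚ
      r≤1 = recip-anti-≤ (positive⁻¹ 1ℚ) (subst (_≤ fromℕ n) fromℕ-1 (fromℕ-mono-≤ (ℕ.>-nonZero⁻¹ n)))
      assoc : ∀ q r → 4ℚ * q * (r * r) ≡ 4ℚ * (q * (r * r))
      assoc = solve-∀ ring
      excess : ∀ q r n → (4ℚ * q + (4ℚ * n + 1ℚ)) * (r * r) - 4ℚ * (q * (r * r)) + r * (1ℚ - r) ≡
        (4ℚ + 1ℚ) * r + 4ℚ * r * (r * n - 1ℚ)
      excess = solve-∀ ring
      distrib : ∀ x y → 4ℚ * (x - y) ≡ 4ℚ * x - 4ℚ * y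
      distrib = solve-∀ ring

  n∣n! : ∀ n .{{_ : ℕ.NonZero n}} → n ℕ.∣ n !
  n∣n! (suc n) = ℕ.m∣m*n (n !)

  0<⇒∣! : ∀ {m n} .{{_ : ℕ.NonZero m}} → m ℕ.≤ n → m ℕ.∣ n !
  0<⇒∣! {m} m≤n = ℕ.∣-trans (n∣n! m) (ℕ.m≤n⇒m!∣n! m≤n)

  n≤n! : ∀ n → n ℕ.≤ n !
  n≤n! zero      = ℕ.z≤n
  n≤n! n@(suc _) = ℕ.∣⇒≤ {{n ℕ.!≢0}} (n∣n! n)

  recip-small : ∀ C {ε} → 0ℚ < ε → ∃[ N ] (∀ n .{{_ : ℕ.NonZero n}} → N ℕ.≤ n → C * recip (fromℕ n) ≤ ε)
  recip-small C {ε} 0<ε =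
    let N , C≤Nε = archimedean C 0<ε
    in N , λ n N≤n → *recip≤ {n = C} (0<fromℕ n) (≤-trans C≤Nε (subst (_≤ ε * fromℕ n) (*-comm ε (fromℕ N))
         (*-mono-≤ˡ (<⇒≤ 0<ε) (fromℕ-mono-≤ N≤n))))

  π-term : ∀ m → seq π m ≡ fromℕ (latticePoints (suc m)) * (recip (fromℕ (suc m)) * recip (fromℕ (suc m)))
  π-term m = *-cancelʳ-≡ (fromℕ (n ℕ.* n)) (0<fromℕ (n ℕ.* n))
    (trans (/-*-cancel (ℤ.+ latticePoints n) (n ℕ.* n))
    (sym (trans (cong (L * (r * r) *_) (fromℕ-* n n))
      (≡-by₁ {m = L} (L * (r * fromℕ n + 1ℚ)) (recip-inverseˡ (0<fromℕ n)) (lemma L r (fromℕ n))))))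
    where
    n = suc m
    L = fromℕ (latticePoints n)
    r = recip (fromℕ n)
    lemma : ∀ L r n → L * (r * r) * (n * n) ≡ L + L * (r * n + 1ℚ) * (r * n - 1ℚ)
    lemma = solve-∀ ring

  -- The radius B ! makes the chosen rational points of the circle integral; cauchy π
  -- takes care of the other radii.
  π≈4arctan-frequently : ∀ K {ε} → 0ℚ < ε → ∀ M →
    ∃[ m ] (M ℕ.≤ m × ∣ seq π m - 4ℚ * arctan K 1ℚ ∣ ≤ 4ℚ * ρ ^ K + (4ℚ + 1ℚ) * ε)
  π≈4arctan-frequently K {ε} 0<ε M =
    let N₀ , N-large = recip-small (proj₁ (area-increment K)) 0<ε
        n₀ , n-large = recip-small (4ℚ + 1ℚ) 0<ε
        N = suc N₀
        -- N² + N² bounds every N² + j² with j ≤ N, so that each divides the factorial; the other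
        -- summands push the radius beyond M and n₀. N depends on K, because the constant of
        -- `area-increment` does.
        B = N ² ℕ.+ N ² ℕ.+ (suc M ℕ.+ n₀)
        instance _ = B ℕ.!≢0
        m = ℕ.pred (B !)
        m+1≡B! = ℕ.suc-pred (B !)
        B≤m+1 = subst (B ℕ.≤_) (sym m+1≡B!) (n≤n! B)
        large = ℕ.≤-trans (ℕ.m≤n+m (suc M ℕ.+ n₀) (N ² ℕ.+ N ²)) B≤m+1
        N²+j²∣ = λ {j} (j≤N : j ℕ.≤ N) → subst (N ² ℕ.+ j ² ℕ.∣_) (sym m+1≡B!)
          (0<⇒∣! {N ² ℕ.+ j ²} (ℕ.≤-trans (ℕ.+-monoʳ-≤ (N ²) (²-mono j≤N))
            (ℕ.m≤m+n (N ² ℕ.+ N ²) (suc M ℕ.+ n₀))))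
    in m , ℕ.s≤s⁻¹ (ℕ.≤-trans (ℕ.m≤m+n (suc M) n₀) large) ,
       estimate (proj₁ (area-increment K)) (recip (fromℕ N)) (recip (fromℕ (suc m))) (seq π m)
         (fromℕ (latticePoints (suc m)) * (recip (fromℕ (suc m)) * recip (fromℕ (suc m)))) (π-term m)
         (latticePoints≈arctan N (suc m) (λ j → suc m ℕ./ (N ² ℕ.+ j ²)) (λ j≤N → ℕ.m/n*n≡m (N²+j²∣ j≤N)) K)
         (n-large (suc m) (ℕ.≤-trans (ℕ.m≤n+m n₀ (suc M)) large))
         (N-large N (ℕ.n≤1+n N₀))
    where
    regroup : ∀ e ε → ε + 4ℚ * (e + ε) ≡ 4ℚ * e + (4ℚ + 1ℚ) * ε
    regroup = solve-∀ ring
    estimate : ∀ C d r p q → p ≡ q → ∣ q - 4ℚ * arctan K 1ℚ ∣ ≤ (4ℚ + 1ℚ) * r + 4ℚ * (ρ ^ K + C * d) →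
      (4ℚ + 1ℚ) * r ≤ ε → C * d ≤ ε → ∣ p - 4ℚ * arctan K 1ℚ ∣ ≤ 4ℚ * ρ ^ K + (4ℚ + 1ℚ) * ε
    estimate C d r p _ refl h r≤ε Cd≤ε = ≤-trans h
      (subst ((4ℚ + 1ℚ) * r + 4ℚ * (ρ ^ K + C * d) ≤_) (regroup (ρ ^ K) ε)
      (+-mono-≤ r≤ε (*-mono-≤ˡ (nonNegative⁻¹ 4ℚ) (+-monoʳ-≤ (ρ ^ K) Cd≤ε))))

-- Approximations to √3, the numerators and the two limits

module Sums where

  open import Data.Rational.Base
  open import Data.Rational.Properties
  open import Algebra.Definitions.RawSemiring +-*-rawSemiring using (_^_)
  open import Defs using (ℝ; seq; cauchy; recip; isqrt; √; π; HasSum; ∑₁; fromℚ; √-apart₀; denom; denom-nonZero)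
  import Defs as ℝ
  open Basics
  open Limits
  open Antiderivative
  open Arctan
  open Series
  open FirstSeries
  open SecondSeries
  open Circle

  -- The order on ℝ asks for a positive rational gap. The estimate is therefore made with a δ
  -- strictly below ε, divided by c, and ε - δ is the gap.
  hasSum : ∀ {a} x c → 0ℚ < c →
    (∀ {ε} → 0ℚ < ε → ∃[ N ] ∃[ M ] (∀ n m → N ℕ.≤ n → M ℕ.≤ m → ∣ ∑₁ a n - seq x m ∣ ≤ c * ε)) → HasSum a x
  hasSum {a} x c 0<c h ε 0<ε =
    let δ , 0<δ , δ<ε = <-dense 0<ε
        N , M , bound = h (0<* (0<recip 0<c) 0<δ)
    in N , λ n N≤n → ε - δ , subst (_< ε - δ) (+-inverseʳ δ) (+-monoˡ-< (- δ) δ<ε) , M ,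
         λ m M≤m → subst (∣ ∑₁ a n - seq x m ∣ + (ε - δ) ≤_)
           (≡-by₁ δ (recip-inverseˡ 0<c) (lemma c (recip c) δ ε)) (+-monoˡ-≤ (ε - δ) (bound n m N≤n M≤m))
    where
    lemma : ∀ c r δ ε → c * (r * δ) + (ε - δ) ≡ ε + δ * (r * c - 1ℚ)
    lemma = solve-∀ ring

  π≈4arctan : ∀ K {ε} → 0ℚ < ε → ∃[ M ]
    (∀ m → M ℕ.≤ m → ∣ seq π m - 4ℚ * arctan K 1ℚ ∣ ≤ 4ℚ * ρ ^ K + (4ℚ + 2ℚ) * ε)
  π≈4arctan K {ε} 0<ε =
    let M , π-close = cauchy π ε 0<ε
        m₀ , M≤m₀ , h = π≈4arctan-frequently K 0<ε M
    in M , λ m M≤m → subst (∣ seq π m - 4ℚ * arctan K 1ℚ ∣ ≤_) (lemma (ρ ^ K) ε)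
         (∣-∣-trans (seq π m) (seq π m₀) (4ℚ * arctan K 1ℚ) (<⇒≤ (π-close m m₀ M≤m M≤m₀)) h)
    where
    lemma : ∀ e ε → ε + (4ℚ * e + (4ℚ + 1ℚ) * ε) ≡ 4ℚ * e + (4ℚ + 2ℚ) * ε
    lemma = solve-∀ ring

  isqrt-spec : ∀ n → isqrt n ℕ.* isqrt n ℕ.≤ n × n ℕ.< suc (isqrt n) ℕ.* suc (isqrt n)
  isqrt-spec zero = ℕ.z≤n , ℕ.s≤s ℕ.z≤n
  isqrt-spec (suc n) with suc (isqrt n) ℕ.* suc (isqrt n) ℕ.≤ᵇ suc n in e
  ... | true  = ℕ.≤ᵇ⇒≤ _ _ (subst T (sym e) _) ,
    ℕ.≤-<-trans (proj₂ (isqrt-spec n)) (ℕ.*-mono-< (ℕ.n<1+n (suc (isqrt n))) (ℕ.n<1+n (suc (isqrt n))))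
  ... | false = ℕ.m≤n⇒m≤1+n (proj₁ (isqrt-spec n)) , ℕ.≰⇒> (λ h → subst T e (ℕ.≤⇒≤ᵇ h))

  module _ (m : ℕ) where

    private

      n s : ℕ
      n = suc m
      s = isqrt (3 ℕ.* (n ℕ.* n))

      r d : ℚ
      r = seq (√ 3) m
      d = recip (fromℕ n)

      r*n≡s : r * fromℕ n ≡ fromℕ s
      r*n≡s = /-*-cancel (ℤ.+ s) n

      d*n≡1 : d * fromℕ n ≡ 1ℚ
      d*n≡1 = recip-inverseˡ (0<fromℕ n)

      0<n : 0ℚ < fromℕ n
      0<n = 0<fromℕ n

      cancel : ∀ {p q} → p * (fromℕ n * fromℕ n) ≤ q * (fromℕ n * fromℕ n) → p ≤ q
      cancel = *-cancelʳ-≤-pos (fromℕ n * fromℕ n) {{positive (0<* 0<n 0<n)}}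

      fromℕ-3n² : fromℕ (3 ℕ.* (n ℕ.* n)) ≡ 3ℚ * (fromℕ n * fromℕ n)
      fromℕ-3n² = trans (fromℕ-* 3 (n ℕ.* n)) (cong₂ _*_ (fromℤ≡/1 (ℤ.+ 3)) (fromℕ-* n n))

      square : ∀ r n → r * n * (r * n) ≡ r * r * (n * n)
      square = solve-∀ ring

    1≤√3 : 1ℚ ≤ r
    1≤√3 = *-cancelʳ-≤-pos (fromℕ n) {{positive 0<n}}
      (subst₂ _≤_ (sym (*-identityˡ (fromℕ n))) (sym r*n≡s) (fromℕ-mono-≤ n≤s))
      where
      n≤s : n ℕ.≤ s
      n≤s = ℕ.≮⇒≥ λ s<n → ℕ.<⇒≱ (proj₂ (isqrt-spec (3 ℕ.* (n ℕ.* n))))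
        (ℕ.≤-trans (ℕ.*-mono-≤ s<n s<n) (ℕ.m≤n*m (n ℕ.* n) 3))

    √3²≤3 : r * r ≤ 3ℚ
    √3²≤3 = cancel (subst₂ _≤_
      (trans (fromℕ-* s s) (trans (cong₂ _*_ (sym r*n≡s) (sym r*n≡s)) (square r (fromℕ n)))) fromℕ-3n²
      (fromℕ-mono-≤ (proj₁ (isqrt-spec (3 ℕ.* (n ℕ.* n))))))

    √3≤3 : r ≤ 3ℚ
    √3≤3 = ≤-trans (≤-by (0≤* (≤-trans (nonNegative⁻¹ 1ℚ) 1≤√3) (p≤q⇒0≤q-p 1≤√3)) (lemma r)) √3²≤3
      where
      lemma : ∀ r → r + r * (r - 1ℚ) ≡ r * r
      lemma = solve-∀ ring

    -- By the choice of the integer root, 3 lies between r² and (r + d)²; these differ by d (2 r +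
    -- d), and r ≤ 3, d ≤ 1 give 7.
    √3²≈3 : ∣ r * r - 3ℚ ∣ ≤ (ℤ.+ 7 / 1) * d
    √3²≈3 = ∣∣≤
      (≤-trans (≤-by (p≤q⇒0≤q-p √3²≤3) (cancel₀ (r * r))) (0≤* (nonNegative⁻¹ (ℤ.+ 7 / 1)) (<⇒≤ (0<recip 0<n))))
      (≤-trans (subst (_≤ (r + d) * (r + d) - r * r) (flip (r * r)) (+-monoˡ-≤ (- (r * r)) 3≤[r+d]²))
        (≤-by (0≤* 0≤d (0≤+ (0≤* (nonNegative⁻¹ 2ℚ) (p≤q⇒0≤q-p √3≤3)) (p≤q⇒0≤q-p d≤1))) (expanded r d)))
      where
      0≤d : 0ℚ ≤ d
      0≤d = <⇒≤ (0<recip 0<n)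
      d≤1 : d ≤ 1ℚ
      d≤1 = recip-anti-≤ (positive⁻¹ 1ℚ) (1≤fromℕ-suc m)
      cancel₀ : ∀ q → q - 3ℚ + (3ℚ - q) ≡ 0ℚ
      cancel₀ = solve-∀ ring
      flip : ∀ q → 3ℚ - q ≡ - (q - 3ℚ)
      flip = solve-∀ ring
      expanded : ∀ r d → (r + d) * (r + d) - r * r + d * (2ℚ * (3ℚ - r) + (1ℚ - d)) ≡ (ℤ.+ 7 / 1) * d
      expanded = solve-∀ ring
      suc-s : fromℕ (suc s) ≡ (r + d) * fromℕ n
      suc-s = trans (fromℕ-suc s) (trans (cong₂ _+_ (sym d*n≡1) (sym r*n≡s)) (lemma r d (fromℕ n)))
        where
        lemma : ∀ r d n → d * n + r * n ≡ (r + d) * n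
        lemma = solve-∀ ring
      3≤[r+d]² : 3ℚ ≤ (r + d) * (r + d)
      3≤[r+d]² = cancel (subst₂ _≤_ fromℕ-3n²
        (trans (fromℕ-* (suc s) (suc s)) (trans (cong₂ _*_ suc-s suc-s) (square (r + d) (fromℕ n))))
        (fromℕ-mono-≤ (ℕ.<⇒≤ (proj₂ (isqrt-spec (3 ℕ.* (n ℕ.* n)))))))

  numerator₁ numerator₂ : ℕ → ℤ
  numerator₁ k = ℤ.+ 95 ℤ.* (ℤ.+ k) ℤ.^ 2 ℤ.- ℤ.+ 84 ℤ.* ℤ.+ k ℤ.+ ℤ.+ 16
  numerator₂ k = ℤ.+ 5 ℤ.* (ℤ.+ k) ℤ.^ 2 ℤ.- ℤ.+ 4 ℤ.* ℤ.+ k ℤ.+ ℤ.+ 1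

  fromℤ-quadratic : ∀ a b c k → let κ = 1ℚ + fromℕ k in
    fromℤ (ℤ.+ a ℤ.* (ℤ.+ suc k) ℤ.^ 2 ℤ.- ℤ.+ b ℤ.* ℤ.+ suc k ℤ.+ ℤ.+ c) ≡
    (ℤ.+ a / 1) * (κ * (κ * 1ℚ)) - (ℤ.+ b / 1) * κ + (ℤ.+ c / 1)
  fromℤ-quadratic a b c k =
    trans (fromℤ-+ (ℤ.+ a ℤ.* K ℤ.^ 2 ℤ.- ℤ.+ b ℤ.* K) (ℤ.+ c)) (cong₂ _+_
      (trans (fromℤ-- (ℤ.+ a ℤ.* K ℤ.^ 2) (ℤ.+ b ℤ.* K)) (cong₂ _-_
        (trans (fromℤ-* (ℤ.+ a) (K ℤ.^ 2)) (cong₂ _*_ (fromℤ≡/1 (ℤ.+ a))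
          (trans (fromℤ-* K (K ℤ.* ℤ.+ 1)) (cong₂ _*_ (fromℕ-suc k)
            (trans (fromℤ-* K (ℤ.+ 1)) (cong₂ _*_ (fromℕ-suc k) fromℕ-1))))))
        (trans (fromℤ-* (ℤ.+ b) K) (cong₂ _*_ (fromℤ≡/1 (ℤ.+ b)) (fromℕ-suc k)))))
      (fromℤ≡/1 (ℤ.+ c)))
    where
    K : ℤ
    K = ℤ.+ suc k

  -- The coefficients are forced: in `moment` only γ survives at κ = -1 and only α at κ = -1/3,
  -- after which any other value yields β. The factors 4 and 3 are those of `denom-!`.
  numerator₁≡ : ∀ k → 4ℚ * moment (ℤ.+ 3 / 2) (ℤ.+ 21 / 4) 6ℚ (fromℕ k) ≡ 3ℚ * (1ℚ * fromℤ (numerator₁ (suc k)))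
  numerator₁≡ k = trans (lemma (fromℕ k)) (cong (λ x → 3ℚ * (1ℚ * x)) (sym (fromℤ-quadratic 95 84 16 k)))
    where
    lemma : ∀ κ →
      4ℚ * ((ℤ.+ 3 / 2) * ((1ℚ + κ) * (2ℚ + κ)) + (ℤ.+ 21 / 4) * ((1ℚ + κ) * (1ℚ + 3ℚ * κ)) +
        (ℤ.+ 6 / 1) * ((1ℚ + 3ℚ * κ) * (2ℚ + 3ℚ * κ))) ≡
      3ℚ * (1ℚ * ((ℤ.+ 95 / 1) * ((1ℚ + κ) * ((1ℚ + κ) * 1ℚ)) - (ℤ.+ 84 / 1) * (1ℚ + κ) + (ℤ.+ 16 / 1)))
    lemma = solve-∀ ring

  numerator₂≡ : ∀ k → 4ℚ * moment 3ℚ 0ℚ 3ℚ (fromℕ k) ≡ 3ℚ * ((ℤ.+ 8 / 1) * fromℤ (numerator₂ (suc k)))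
  numerator₂≡ k = trans (lemma (fromℕ k)) (cong (λ x → 3ℚ * ((ℤ.+ 8 / 1) * x)) (sym (fromℤ-quadratic 5 4 1 k)))
    where
    lemma : ∀ κ →
      4ℚ * (3ℚ * ((1ℚ + κ) * (2ℚ + κ)) + 0ℚ * ((1ℚ + κ) * (1ℚ + 3ℚ * κ)) +
        3ℚ * ((1ℚ + 3ℚ * κ) * (2ℚ + 3ℚ * κ))) ≡
      3ℚ * ((ℤ.+ 8 / 1) * ((ℤ.+ 5 / 1) * ((1ℚ + κ) * ((1ℚ + κ) * 1ℚ)) - (ℤ.+ 4 / 1) * (1ℚ + κ) + (ℤ.+ 1 / 1)))
    lemma = solve-∀ ring

  term₁ term₂ : (k : ℕ) .{{_ : ℕ.NonZero k}} → ℚ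
  term₁ k = (numerator₁ k / denom k) * (ℤ.+ 9 / 8) ^ (k ℕ.∸ 1)
  term₂ k = (numerator₂ k / denom k) * (ℤ.+ 8 / 1) ^ k

  ∑term₁ : ∀ n → ∑₁ term₁ n ≡ F₁ n 1ℚ
  ∑term₁ = ∑₁≡∫partialSum (ℤ.+ 9 / 8) (ℤ.+ 3 / 2) (ℤ.+ 21 / 4) 6ℚ 1ℚ numerator₁ numerator₁≡ term₁
    (λ k → cong (_* (ℤ.+ 9 / 8) ^ k) (sym (*-identityˡ (ratio numerator₁ k))))

  ∑term₂ : ∀ n → ∑₁ term₂ n ≡ F₂ n 1ℚ
  ∑term₂ = ∑₁≡∫partialSum (ℤ.+ 8 / 1) 3ℚ 0ℚ 3ℚ (ℤ.+ 8 / 1) numerator₂ numerator₂≡ term₂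
    (λ k → lemma (ratio numerator₂ k) (ℤ.+ 8 / 1) ((ℤ.+ 8 / 1) ^ k))
    where
    lemma : ∀ t z p → t * (z * p) ≡ z * t * p
    lemma = solve-∀ ring

  hasSum₁ : HasSum term₁ (fromℚ (ℤ.+ 2 / 1) ℝ.* π ℝ.÷ √ 3)
  hasSum₁ = hasSum (fromℚ (ℤ.+ 2 / 1) ℝ.* π ℝ.÷ √ 3) (ℤ.+ 33 / 1) (positive⁻¹ (ℤ.+ 33 / 1)) λ {ε} 0<ε →
    -- With x = ρ^n, y = ρ^K and η = ∣ r² - 3 ∣ for the m-th approximation r to √3, the errors total
    -- 19 x + 27 y + 19 η + 12 ε. Here 8 y and 12 ε stem from twice the error of π; 33 = 1 + 1 + 19
    -- + 12.
    let N , hN = geometric-decay 0≤ρ ρ<1 (ℤ.+ 19 / 1) 0<ε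
        K , hK = geometric-decay 0≤ρ ρ<1 (ℤ.+ 27 / 1) 0<ε
        M , hM = π≈4arctan K 0<ε
        L , hL = recip-small (ℤ.+ 7 / 1) 0<ε
    in N , M ℕ.⊔ L , λ n m N≤n M⊔L≤m →
      estimate (∑₁ term₁ n) (F₁ n 1ℚ) (arctan K 1ℚ) (seq π m) (recip (seq (√ 3) m)) (ρ ^ n) (ρ ^ K)
        (∣ seq (√ 3) m * seq (√ 3) m - 3ℚ ∣) ε
        (∑term₁ n)
        (0≤p≤q⇒∣p∣≤q (<⇒≤ (0<recip (<-≤-trans (positive⁻¹ 1ℚ) (1≤√3 m))))
          (recip-anti-≤ (positive⁻¹ 1ℚ) (1≤√3 m)))
        (F₁≈8arctan/r n K (seq (√ 3) m) (1≤√3 m) (√3≤3 m))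
        (hM m (ℕ.≤-trans (ℕ.m≤m⊔n M L) M⊔L≤m))
        (hN n N≤n) (hK K ℕ.≤-refl)
        (≤-trans (√3²≈3 m) (hL (suc m) (ℕ.m≤n⇒m≤1+n (ℕ.≤-trans (ℕ.m≤n⊔m M L) M⊔L≤m))))
    where
    estimate : ∀ S F a p r x y η ε → S ≡ F → ∣ r ∣ ≤ 1ℚ →
      ∣ F - (ℤ.+ 8 / 1) * a * r ∣ ≤ (ℤ.+ 19 / 1) * (x + y + η) → ∣ p - 4ℚ * a ∣ ≤ 4ℚ * y + (4ℚ + 2ℚ) * ε →
      (ℤ.+ 19 / 1) * x ≤ ε → (ℤ.+ 27 / 1) * y ≤ ε → η ≤ ε → ∣ S - (ℤ.+ 2 / 1) * p * r ∣ ≤ (ℤ.+ 33 / 1) * ε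
    estimate _ F a p r x y η ε refl r≤1 h₁ h₂ hx hy hη = ≤-trans
      (subst (λ z → ∣ z ∣ ≤ (ℤ.+ 19 / 1) * (x + y + η) + 2ℚ * (4ℚ * y + (4ℚ + 2ℚ) * ε) * 1ℚ)
        (difference F a p r)
        (∣∣≤-- h₁ (∣∣≤-* (∣∣≤-* {2ℚ} ≤-refl h₂) r≤1)))
      (≤-by (0≤+ (0≤+ (p≤q⇒0≤q-p hx) (p≤q⇒0≤q-p hy)) (0≤* (nonNegative⁻¹ (ℤ.+ 19 / 1)) (p≤q⇒0≤q-p hη)))
        (total x y η ε))
      where
      difference : ∀ F a p r → F - (ℤ.+ 8 / 1) * a * r - 2ℚ * (p - 4ℚ * a) * r ≡ F - (ℤ.+ 2 / 1) * p * r
      difference = solve-∀ ring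
      total : ∀ x y η ε → (ℤ.+ 19 / 1) * (x + y + η) + 2ℚ * (4ℚ * y + (4ℚ + 2ℚ) * ε) * 1ℚ +
        (ε - (ℤ.+ 19 / 1) * x + (ε - (ℤ.+ 27 / 1) * y) + (ℤ.+ 19 / 1) * (ε - η)) ≡ (ℤ.+ 33 / 1) * ε
      total = solve-∀ ring

  hasSum₂ : HasSum term₂ (fromℚ (ℤ.+ 3 / 2) ℝ.* π)
  hasSum₂ = hasSum (fromℚ (ℤ.+ 3 / 2) ℝ.* π) (ℤ.+ 11 / 1) (positive⁻¹ (ℤ.+ 11 / 1)) λ {ε} 0<ε →
    -- The errors total C x + (C + 6) y + 9 ε, where 6 y and 9 ε are 3/2 of the error of π; hence 11
    -- = 1 + 1 + 9.
    let C = Q₂ + ℤ.+ 6 / 1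
        N , hN = geometric-decay 0≤ρ ρ<1 C 0<ε
        K , hK = geometric-decay 0≤ρ ρ<1 (C + ℤ.+ 6 / 1) 0<ε
        M , hM = π≈4arctan K 0<ε
    in N , M , λ n m N≤n M≤m →
      estimate (∑₁ term₂ n) (F₂ n 1ℚ) (arctan K 1ℚ) (seq π m) (Q₂ + ℤ.+ 6 / 1) (ρ ^ n) (ρ ^ K) ε (∑term₂ n)
        (F₂≈6arctan n K) (hM m M≤m) (hN n N≤n) (hK K ℕ.≤-refl)
    where
    estimate : ∀ S F a p C x y ε → S ≡ F →
      ∣ F - (ℤ.+ 6 / 1) * a ∣ ≤ C * (x + y) → ∣ p - 4ℚ * a ∣ ≤ 4ℚ * y + (4ℚ + 2ℚ) * ε →
      C * x ≤ ε → (C + ℤ.+ 6 / 1) * y ≤ ε → ∣ S - (ℤ.+ 3 / 2) * p ∣ ≤ (ℤ.+ 11 / 1) * ε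
    estimate _ F a p C x y ε refl h₁ h₂ hx hy = ≤-trans
      (subst (λ z → ∣ z ∣ ≤ C * (x + y) + (ℤ.+ 3 / 2) * (4ℚ * y + (4ℚ + 2ℚ) * ε)) (difference F a p)
        (∣∣≤-- h₁ (∣∣≤-* {ℤ.+ 3 / 2} ≤-refl h₂)))
      (≤-by (0≤+ (p≤q⇒0≤q-p hx) (p≤q⇒0≤q-p hy)) (total C x y ε))
      where
      difference : ∀ F a p → F - (ℤ.+ 6 / 1) * a - (ℤ.+ 3 / 2) * (p - 4ℚ * a) ≡ F - (ℤ.+ 3 / 2) * p
      difference = solve-∀ ring
      total : ∀ C x y ε → C * (x + y) + (ℤ.+ 3 / 2) * (4ℚ * y + (4ℚ + 2ℚ) * ε) +
        (ε - C * x + (ε - (C + ℤ.+ 6 / 1) * y)) ≡ (ℤ.+ 11 / 1) * ε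
      total = solve-∀ ring

open import Defs
open import Data.Nat.Base as ℕ using (ℕ; _∸_)
open import Data.Integer.Base as ℤ using (+_)
open import Data.Rational.Base as ℚ using (_/_)
open import Algebra.Definitions.RawSemiring ℚ.+-*-rawSemiring using (_^_)
open import Data.Product.Base using (_×_)

theorem1p1 : HasSum (λ k → ((+ 95 ℤ.* (+ k) ℤ.^ 2 ℤ.- + 84 ℤ.* + k ℤ.+ + 16) / denom k) ℚ.* (+ 9 / 8) ^ (k ∸ 1))
    (fromℚ (+ 2 / 1) * π ÷ √ 3)
    × HasSum (λ k → ((+ 5 ℤ.* (+ k) ℤ.^ 2 ℤ.- + 4 ℤ.* + k ℤ.+ + 1) / denom k) ℚ.* (+ 8 / 1) ^ k)
    (fromℚ (+ 3 / 2) * π)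
theorem1p1 = Sums.hasSum₁ , Sums.hasSum₂
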